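{- None of the following circulant weighing matrices exists: $$CW(105,36),\quad CW(140,36),\quad CW(116,49),\quad CW(120,49),\quad CW(192,49),\quad CW(140,64),\quad CW(180,64),\quad CW(196,64).$$
   Context: A weighing matrix $W(v,n)$ is a square matrix $W$ of order $v$ with entries in $\{0,1,-1\}$ satisfying $WW^T=nI_v$; the integer $n$ is its weight. If each row after the first is a cyclic shift (by one position, indices modulo $v$) of the preceding row, i.e. $W$ is a circulant matrix, it is called a circulant weighing matrix and denoted by $CW(v,n)$. Equivalently, a $CW(v,n)$ is an element $A=\sum_{g\in C_v}a_g g$ of the integral group ring $\mathbb Z[C_v]$ of the cyclic group $C_v$ of order $v$ with all $a_g\in\{0,1,-1\}$ and $AA^{(-1)}=n$, where $A^{(-1)}=\sum_g a_g g^{ -1}$ and the scalar $n$ means $n$ times the identity element. -}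

module Defs where

open import Algebra.Properties.Monoid.Sum using (sum-syntax)
open import Data.Bool.Base using (if_then_else_)
open import Data.Fin.Base using (Fin; toℕ)
open import Data.Fin.Properties using (_≟_)
open import Data.Integer.Base using (ℤ; +_; 0ℤ; 1ℤ; -1ℤ; _*_)
open import Data.Integer.Properties using (+-0-monoid)
open import Data.Nat.Base using (ℕ; suc; NonZero)
open import Data.Nat.DivMod using (_mod_)
open import Data.Product.Base using (∃-syntax)
open import Data.Sum.Base using (_⊎_)
open import Data.Vec.Functional using (Vector; transpose)
open import Relation.Binary.PropositionalEquality.Core using (_≡_)
open import Relation.Nullary.Decidable.Core using (does)

Matrix : ℕ → Set
Matrix v = Vector (Vector ℤ v) v

infixl 7 _⊗_ _·_

_⊗_ : ∀ {v} → Matrix v → Matrix v → Matrix v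
_⊗_ {v} A B i j = sum-syntax +-0-monoid v (λ k → A i k * B k j)

_·_ : ∀ {v} → ℤ → Matrix v → Matrix v
(c · A) i j = c * A i j

I : ∀ {v} → Matrix v
I i j = if does (i ≟ j) then 1ℤ else 0ℤ

record IsWeighing (v n : ℕ) (W : Matrix v) : Set where
  field
    entries : ∀ i j → W i j ≡ 0ℤ ⊎ W i j ≡ 1ℤ ⊎ W i j ≡ -1ℤ
    WWᵀ≡nI  : ∀ i j → (W ⊗ transpose W) i j ≡ (+ n · I) i j

-- Row i′ directly follows row i and is row i moved cyclically one place to the
-- right.  This is the shift direction for which circulant matrices correspond to
-- elements of the group ring ℤ[C_v].
IsCirculant : ∀ {v} .{{_ : NonZero v}} → Matrix v → Set
IsCirculant {v} W =
  ∀ (i i′ j : Fin v) → toℕ i′ ≡ suc (toℕ i) → W i′ (suc (toℕ j) mod v) ≡ W i j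

record IsCW (v n : ℕ) .{{_ : NonZero v}} (W : Matrix v) : Set where
  field
    isWeighing  : IsWeighing v n W
    isCirculant : IsCirculant W

CWExists : (v n : ℕ) .{{_ : NonZero v}} → Set
CWExists v n = ∃[ W ] IsCW v n W

-- Let w divide v and let θ be a root of unity whose order divides v. The first row of a CW(v,n)
-- maps to an element B of ℤ[θ][C_w] with B B* = n whose coefficients are small, since each of
-- them collects only v/w entries.
--
-- Let t be, modulo w, a power q of the residue characteristic of each prime π of ℤ[θ] over n, with
-- x^q = x in the residue field. Modulo π the map ψ : g ↦ g^t is then the q-th power map. The product
-- of all ψ^i(B^ψ B*) is a power of n, and modulo π a product of the conjugates of an element is a
-- power of that element, which vanishes only if the element does. Hence n divides B^ψ B*, the
-- quotient E satisfies E E* = 1, so it is a unit times a group element, and comparing characters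
-- shows that B^ψ is a translate of B. A suitable translate of B is therefore constant on the orbits
-- of t.
--
-- Only few such B exist. They are found by lifting solutions of the same equation through a tower
-- of quotients of C_w, spending the budget n = Σ |b|² on the orbits, and none of them has
-- coefficients small enough. Only CW(140,36) needs two projections: those to C_35 for θ = 1 and
-- θ = -1 are both divisible by 3, which is incompatible with the size of the coefficients.

module Submission where

open import Algebra.Bundles using (CommutativeMonoid; CommutativeRing)
open import Algebra.Core using (Op₁; Op₂)
open import Algebra.Structures using (IsCommutativeRing)
import Algebra.Properties.CommutativeMonoid.Sum as Sum
import Algebra.Properties.CommutativeSemiring.Binomial as Binomial
import Algebra.Properties.CommutativeSemiring.Exp as CommutativeExp
import Algebra.Properties.Monoid.Mult as MonoidMult
import Algebra.Properties.Ring as RingProperties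
import Algebra.Properties.Semiring.Exp as Exp
import Algebra.Properties.Semiring.Mult as Mult
import Algebra.Properties.Semiring.Sum as SemiringSum
open import Data.Bool.ListAction using (all)
open import Data.Bool.Base using (Bool; true; false; if_then_else_; _∧_; not; T)
open import Data.Empty using (⊥; ⊥-elim)
open import Data.Fin.Base as Fin using (Fin; toℕ; fromℕ<)
import Data.Fin.Properties as Fin
open import Data.Integer.Base as ℤ using (ℤ; +_; -[1+_]; ∣_∣; 0ℤ; 1ℤ; -1ℤ)
import Data.Integer.Properties as ℤ
import Data.Integer.Tactic.RingSolver as ℤ-Solver
open import Data.List.Base using (List; []; _∷_; _++_; map; concatMap; applyUpTo; upTo; null; foldr; filterᵇ; deduplicateᵇ; take; drop; cartesianProduct)
open import Data.List.Membership.Propositional using (_∈_; lose)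
open import Data.List.Membership.Propositional.Properties using (∈-concatMap⁺; ∈-map⁺; ∈-++⁺ˡ; ∈-++⁺ʳ; ∈-++⁻; ∈-filter⁺; ∈-cartesianProduct⁺; ∈-applyUpTo⁺)
open import Data.List.Relation.Unary.All as All using (All; []; _∷_)
open import Data.List.Properties using (map-applyUpTo)
import Data.List.Relation.Unary.All.Properties as All
open import Data.List.Relation.Unary.Any using (here; there)
open import Data.Nat.Base as ℕ using (ℕ; _!; zero; suc; NonZero; _<_; _≤_; z≤n; s≤s; _%_; _/_)
open import Data.Nat.Combinatorics using (_C_; nCn≡1; k![n∸k]!∣n!)
open import Data.Nat.Combinatorics.Specification using (nCk≡n!/k![n-k]!)
import Data.Nat.DivMod as ℕ
open import Data.Nat.Divisibility using (_∣_; divides; ∣n⇒∣m*n; m∣m*n; ∣1⇒≡1; ∣⇒≤)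
open import Data.Nat.Primality using (Prime; prime?; euclidsLemma; prime⇒nonZero; prime⇒nonTrivial; prime[2]; ¬prime[0]; ¬prime[1])
import Data.Nat.Properties as ℕ
import Data.Nat.Tactic.RingSolver as ℕ-Solver
open import Data.Product.Base using (_×_; _,_; proj₁; proj₂; ∃-syntax)
open import Data.Sum.Base using (_⊎_; inj₁; inj₂; [_,_]′)
open import Function.Base using (_∘_; id; _$_)
open import Level using (0ℓ; _⊔_)
open import Relation.Binary.PropositionalEquality using (isEquivalence; _≡_; _≢_; refl; sym; trans; cong; cong₂; subst; module ≡-Reasoning)
open import Relation.Nullary using (¬_; Dec; yes; no; does; contradiction)
open import Relation.Nullary.Decidable using (T?; dec-true; dec-false; toWitness)
open import Data.Vec.Functional using (transpose)
open import Defs hiding (_·_)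
open import Defs using () renaming (_·_ to _·ᴹ_)

-- Sums and periodic functions

-- The equation B B* = n alone is never contradictory: B = √n solves it, and if 7 divides w and n is
-- even, so does B = (√n / 2)(-1 + x + x² + x⁴) with x of order 7, because -1 + x + x² + x⁴ is a
-- CW(7,4). For n = 36 and n = 64 its coefficients are ±3 and ±4, and plain sums of three or four
-- entries can be as large. This is the use of θ: with θ = i, four entries contribute two to the
-- real and two to the imaginary part, so both parts are at most 2 in absolute value, and θ = ω has
-- a similar effect on three entries. For CW(140,36) the solution 3(-1 + x + x² + x⁴) is admissible
-- for θ = 1 and for θ = -1; only the two projections together are contradictory. A second obstacle
-- lies between "B^ψ is a translate of B" and "some translate of B is fixed": translating B by h
-- alters the translation by (t - 1)h, so the translation found must be a multiple of t - 1 modulo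
-- w. For t = 7 and even w this reaches only even translations, and odd ones have to be excluded by
-- a character.

module RangeSum {c ℓ} (M : CommutativeMonoid c ℓ) where

  open CommutativeMonoid M
    using (Carrier; _≈_; setoid; reflexive)
    renaming (_∙_ to _+_; ε to 0#; ∙-cong to +-cong; ∙-congˡ to +-congˡ; ∙-congʳ to +-congʳ;
              assoc to +-assoc; comm to +-comm; identityˡ to +-identityˡ; identityʳ to +-identityʳ;
              refl to ≈-refl; sym to ≈-sym; trans to ≈-trans)
  open Sum M
  open import Relation.Binary.Reasoning.Setoid setoid

  ∑ : ℕ → (ℕ → Carrier) → Carrier
  ∑ n f = sum {n} (f ∘ toℕ)

  ∑-cong : ∀ n {f g : ℕ → Carrier} → (∀ i → f i ≈ g i) → ∑ n f ≈ ∑ n g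
  ∑-cong n f≈g = sum-cong-≋ {n} (f≈g ∘ toℕ)

  ∑-zero : ∀ n {f : ℕ → Carrier} → (∀ i → i < n → f i ≈ 0#) → ∑ n f ≈ 0#
  ∑-zero n f≈0 = ≈-trans (sum-cong-≋ {n} (λ i → f≈0 (toℕ i) (Fin.toℕ<n i))) (sum-replicate-zero n)

  ∑-distrib : ∀ n (f g : ℕ → Carrier) → ∑ n (λ i → f i + g i) ≈ ∑ n f + ∑ n g
  ∑-distrib n f g = ∑-distrib-+ {n} (f ∘ toℕ) (g ∘ toℕ)

  ∑-swap : ∀ m n (f : ℕ → ℕ → Carrier) → ∑ m (λ i → ∑ n (f i)) ≈ ∑ n (λ j → ∑ m (λ i → f i j))
  ∑-swap m n f = ∑-comm {m} {n} (λ i j → f (toℕ i) (toℕ j))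

  ∑-split : ∀ m n (f : ℕ → Carrier) → ∑ (m ℕ.+ n) f ≈ ∑ m f + ∑ n (λ i → f (m ℕ.+ i))
  ∑-split zero    n f = ≈-sym (+-identityˡ _)
  ∑-split (suc m) n f = begin
    f 0 + ∑ (m ℕ.+ n) (f ∘ suc)                            ≈⟨ +-congˡ (∑-split m n (f ∘ suc)) ⟩
    f 0 + (∑ m (f ∘ suc) + ∑ n (λ i → f (suc m ℕ.+ i)))  ≈⟨ +-assoc _ _ _ ⟨
    ∑ (suc m) f + ∑ n (λ i → f (suc m ℕ.+ i))            ∎

  ∑-last : ∀ n (f : ℕ → Carrier) → ∑ (suc n) f ≈ ∑ n f + f n
  ∑-last zero    f = +-comm _ _
  ∑-last (suc n) f = begin
    f 0 + ∑ (suc n) (f ∘ suc)           ≈⟨ +-congˡ (∑-last n (f ∘ suc)) ⟩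
    f 0 + (∑ n (f ∘ suc) + f (suc n))   ≈⟨ +-assoc _ _ _ ⟨
    ∑ (suc n) f + f (suc n)             ∎

  -- Division with remainder by m: each index below l m is x + m j for one x < m and one j < l. It
  -- rewrites a sum over C_lm as a sum over the fibres above C_m.
  ∑-blocks : ∀ l m (f : ℕ → Carrier) → ∑ m (λ x → ∑ l (λ j → f (x ℕ.+ m ℕ.* j))) ≈ ∑ (l ℕ.* m) f
  ∑-blocks zero    m f = ∑-zero m (λ _ _ → ≈-refl)
  ∑-blocks (suc l) m f = begin
    ∑ m (λ x → f (x ℕ.+ m ℕ.* 0) + ∑ l (λ j → f (x ℕ.+ m ℕ.* suc j)))
      ≈⟨ ∑-distrib m (λ x → f (x ℕ.+ m ℕ.* 0)) (λ x → ∑ l (λ j → f (x ℕ.+ m ℕ.* suc j))) ⟩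
    ∑ m (λ x → f (x ℕ.+ m ℕ.* 0)) + ∑ m (λ x → ∑ l (λ j → f (x ℕ.+ m ℕ.* suc j)))
      ≈⟨ +-cong (∑-cong m (λ x → reflexive (cong f (x+m*0≡x x m))))
                (∑-cong m (λ x → ∑-cong l (λ j → reflexive (cong f (shift x m j))))) ⟩
    ∑ m f + ∑ m (λ x → ∑ l (λ j → f (m ℕ.+ (x ℕ.+ m ℕ.* j))))
      ≈⟨ +-congˡ (∑-blocks l m (λ x → f (m ℕ.+ x))) ⟩
    ∑ m f + ∑ (l ℕ.* m) (λ x → f (m ℕ.+ x))
      ≈⟨ ∑-split m (l ℕ.* m) f ⟨
    ∑ (m ℕ.+ l ℕ.* m) f ∎
    where
    x+m*0≡x : ∀ x m → x ℕ.+ m ℕ.* 0 ≡ x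
    x+m*0≡x = ℕ-Solver.solve-∀
    shift : ∀ x m j → x ℕ.+ m ℕ.* suc j ≡ m ℕ.+ (x ℕ.+ m ℕ.* j)
    shift = ℕ-Solver.solve-∀

  ∑-pick : ∀ n {r} (f : ℕ → Carrier) → r < n → (∀ i → i < n → i ≢ r → f i ≈ 0#) → ∑ n f ≈ f r
  ∑-pick (suc n) {zero} f _ f≈0 =
    ≈-trans (+-congˡ (∑-zero n (λ i i<n → f≈0 (suc i) (s≤s i<n) λ ()))) (+-identityʳ _)
  ∑-pick (suc n) {suc r} f (s≤s r<n) f≈0 =
    ≈-trans (+-cong (f≈0 0 (s≤s z≤n) λ ()) (∑-pick n (f ∘ suc) r<n λ i i<n i≢r → f≈0 (suc i) (s≤s i<n) (i≢r ∘ ℕ.suc-injective)))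
            (+-identityˡ _)

  ∑-shift : ∀ n {f : ℕ → Carrier} → (∀ x → f (n ℕ.+ x) ≈ f x) → ∀ c → ∑ n (λ i → f (c ℕ.+ i)) ≈ ∑ n f
  ∑-shift zero    per c       = ≈-refl
  ∑-shift (suc n) per zero    = ≈-refl
  ∑-shift (suc n) {f} per (suc c) = begin
    ∑ (suc n) (λ i → f (suc c ℕ.+ i))                     ≈⟨ ∑-last n (λ i → f (suc c ℕ.+ i)) ⟩
    ∑ n (λ i → f (suc c ℕ.+ i)) + f (suc c ℕ.+ n)         ≈⟨ +-comm _ _ ⟩
    f (suc c ℕ.+ n) + ∑ n (λ i → f (suc c ℕ.+ i))
      ≈⟨ +-congʳ (≈-trans (reflexive (cong (f ∘ suc) (ℕ.+-comm c n))) (per c)) ⟩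
    f c + ∑ n (λ i → f (suc c ℕ.+ i))
      ≈⟨ +-cong (reflexive (cong f (sym (ℕ.+-identityʳ c)))) (∑-cong n (λ i → reflexive (cong f (sym (ℕ.+-suc c i))))) ⟩
    ∑ (suc n) (λ i → f (c ℕ.+ i))                         ≈⟨ ∑-shift (suc n) per c ⟩
    ∑ (suc n) f                                           ∎

-- Functions on a cyclic group are kept as periodic functions on ℕ. With -x written as (n - 1)x no
-- subtraction occurs, and every change of index is an identity in the semiring ℕ.
Periodic : {A : Set} → ℕ → (ℕ → A) → Set
Periodic n f = ∀ x → f (n ℕ.+ x) ≡ f x

module _ {A : Set} {n : ℕ} {f : ℕ → A} (per : Periodic n f) where

  periodic-* : ∀ k x → f (k ℕ.* n ℕ.+ x) ≡ f x
  periodic-* zero    x = refl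
  periodic-* (suc k) x = trans (cong f (ℕ.+-assoc n (k ℕ.* n) x)) (trans (per _) (periodic-* k x))

  periodic-cong : ∀ a b {x y} → a ℕ.* n ℕ.+ x ≡ b ℕ.* n ℕ.+ y → f x ≡ f y
  periodic-cong a b {x} {y} eq = trans (sym (periodic-* a x)) (trans (cong f eq) (periodic-* b y))

  periodic-% : .{{_ : NonZero n}} → ∀ x → f (x % n) ≡ f x
  periodic-% x = periodic-cong (x / n) 0 (trans (ℕ.+-comm _ (x % n)) (sym (ℕ.m≡m%n+[m/n]*n x n)))

  periodic-≡% : .{{_ : NonZero n}} → ∀ {x y} → x % n ≡ y % n → f x ≡ f y
  periodic-≡% {x} {y} eq = trans (sym (periodic-% x)) (trans (cong f eq) (periodic-% y))

module _ (n : ℕ) .{{_ : NonZero n}} where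

  %-congʳ-+ : ∀ a b c → b % n ≡ c % n → (a ℕ.+ b) % n ≡ (a ℕ.+ c) % n
  %-congʳ-+ a b c eq = trans (ℕ.%-distribˡ-+ a b n) (trans (cong (λ z → (a % n ℕ.+ z) % n) eq) (sym (ℕ.%-distribˡ-+ a c n)))

  %-congʳ-* : ∀ a b c → b % n ≡ c % n → (a ℕ.* b) % n ≡ (a ℕ.* c) % n
  %-congʳ-* a b c eq = trans (ℕ.%-distribˡ-* a b n) (trans (cong (λ z → (a % n ℕ.* z) % n) eq) (sym (ℕ.%-distribˡ-* a c n)))

-- A ring with a conjugation and a positive definite norm: ℤ and the imaginary
-- quadratic orders.
record Coefficients : Set₁ where
  infixl 7 _*_
  infixl 6 _+_
  infix  8 -_
  field
    Carrier           : Set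
    _+_ _*_           : Op₂ Carrier
    -_                : Op₁ Carrier
    0# 1#             : Carrier
    isCommutativeRing : IsCommutativeRing _≡_ _+_ _*_ -_ 0# 1#
    conj              : Op₁ Carrier
    conj-+            : ∀ x y → conj (x + y) ≡ conj x + conj y
    conj-*            : ∀ x y → conj (x * y) ≡ conj x * conj y
    conj-1            : conj 1# ≡ 1#
    conj-involutive   : ∀ x → conj (conj x) ≡ x
    re                : Carrier → ℤ
    re-+              : ∀ x y → re (x + y) ≡ re x ℤ.+ re y
    re-0              : re 0# ≡ 0ℤ
    re-1              : re 1# ≡ 1ℤ
    norm              : Carrier → ℕ
    norm≡0            : ∀ {x} → norm x ≡ 0 → x ≡ 0#

  commutativeRing : CommutativeRing 0ℓ 0ℓ
  commutativeRing = record { isCommutativeRing = isCommutativeRing }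

  open CommutativeRing commutativeRing public
    using (_-_; ring; semiring; +-commutativeMonoid; +-assoc; +-comm; +-identityˡ; +-identityʳ; -‿inverseˡ; -‿inverseʳ;
           *-assoc; *-comm; *-identityˡ; *-identityʳ; distribˡ; distribʳ; zeroˡ; zeroʳ)
  open Mult semiring public using () renaming (_×_ to _·_)
  open Exp semiring public using (_^_)

  field
    *-conj       : ∀ x → x * conj x ≡ norm x · 1#
    torsion-free : ∀ m {x} → suc m · x ≡ 0# → x ≡ 0#

  re-· : ∀ m → re (m · 1#) ≡ + m
  re-· zero    = re-0
  re-· (suc m) = trans (re-+ 1# (m · 1#)) (cong₂ ℤ._+_ re-1 (re-· m))

  norm-0 : norm 0# ≡ 0
  norm-0 = ℤ.+-injective (trans (sym (re-· (norm 0#))) (trans (cong re (trans (sym (*-conj 0#)) (zeroˡ _))) re-0))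

  conj-0 : conj 0# ≡ 0#
  conj-0 = begin
    conj 0#              ≡⟨ cong conj (zeroˡ (conj 0#)) ⟨
    conj (0# * conj 0#)  ≡⟨ conj-* 0# (conj 0#) ⟩
    conj 0# * conj (conj 0#) ≡⟨ cong (conj 0# *_) (conj-involutive 0#) ⟩
    conj 0# * 0#         ≡⟨ zeroʳ _ ⟩
    0#                   ∎
    where open ≡-Reasoning

  conj-· : ∀ m → conj (m · 1#) ≡ m · 1#
  conj-· zero    = conj-0
  conj-· (suc m) = trans (conj-+ 1# (m · 1#)) (cong₂ _+_ conj-1 (conj-· m))

  ·-* : ∀ m x → m · 1# * x ≡ m · x
  ·-* m x = trans (Mult.×-assoc-* semiring m 1# x) (cong (m ·_) (*-identityˡ x))

  -- Multiplication by `conj x` replaces the factor x by the natural number `norm x`, which can be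
  -- cancelled as the ring is torsion-free.
  cancelˡ : ∀ x {y z} → norm x ≢ 0 → x * y ≡ x * z → y ≡ z
  cancelˡ x {y} {z} nonzero eq = begin
    y              ≡⟨ +-identityˡ y ⟨
    0# + y         ≡⟨ cong (_+ y) (-‿inverseʳ z) ⟨
    z - z + y      ≡⟨ +-assoc z (- z) y ⟩
    z + (- z + y)  ≡⟨ cong (λ w → z + w) (trans (+-comm (- z) y) (scaled (norm x) refl)) ⟩
    z + 0#         ≡⟨ +-identityʳ z ⟩
    z              ∎
    where
    open ≡-Reasoning
    open RingProperties ring using (x[y-z]≈xy-xz)
    x[y-z]≡0 : x * (y - z) ≡ 0#
    x[y-z]≡0 = trans (x[y-z]≈xy-xz x y z) (trans (cong (_- x * z) eq) (-‿inverseʳ (x * z)))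
    norm-kills : norm x · (y - z) ≡ 0#
    norm-kills = begin
      norm x · (y - z)         ≡⟨ ·-* (norm x) (y - z) ⟨
      norm x · 1# * (y - z)    ≡⟨ cong (_* (y - z)) (trans (sym (*-conj x)) (*-comm x (conj x))) ⟩
      conj x * x * (y - z)     ≡⟨ *-assoc (conj x) x (y - z) ⟩
      conj x * (x * (y - z))   ≡⟨ cong (conj x *_) x[y-z]≡0 ⟩
      conj x * 0#              ≡⟨ zeroʳ (conj x) ⟩
      0#                       ∎
    scaled : ∀ m → norm x ≡ m → y - z ≡ 0#
    scaled zero    eq = contradiction eq nonzero
    scaled (suc m) eq = torsion-free m (trans (cong (_· (y - z)) (sym eq)) norm-kills)

-- The group ring of a cyclic group

module GroupRing (K : Coefficients) (N : ℕ) where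

  open Coefficients K
  open RangeSum +-commutativeMonoid public
  open ≡-Reasoning

  n : ℕ
  n = suc N

  record Element : Set where
    constructor element
    field
      at       : ℕ → Carrier
      periodic : Periodic n at

  open Element public

  infix 4 _≈_
  record _≈_ (f g : Element) : Set where
    constructor ext
    field eq : ∀ x → at f x ≡ at g x

  open _≈_ public

  scale-∑ˡ : ∀ m c (f : ℕ → Carrier) → c * ∑ m f ≡ ∑ m (λ i → c * f i)
  scale-∑ˡ m c f = SemiringSum.*-distribˡ-sum semiring {m} c (f ∘ toℕ)

  scale-∑ʳ : ∀ m c (f : ℕ → Carrier) → ∑ m f * c ≡ ∑ m (λ i → f i * c)
  scale-∑ʳ m c f = SemiringSum.*-distribʳ-sum semiring {m} c (f ∘ toℕ)

  δ : ℕ → ℕ → Carrier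
  δ c x = if does (x % n ℕ.≟ c % n) then 1# else 0#

  δ-periodic : ∀ c → Periodic n (δ c)
  δ-periodic c x = cong (λ y → if does (y ℕ.≟ c % n) then 1# else 0#)
    (trans (cong (_% n) (ℕ.+-comm n x)) (ℕ.[m+n]%n≡m%n x n))

  δ-≡ : ∀ c x → x % n ≡ c % n → δ c x ≡ 1#
  δ-≡ c x eq = cong (if_then 1# else 0#) (dec-true (_ ℕ.≟ _) eq)

  δ-≢ : ∀ c x → x % n ≢ c % n → δ c x ≡ 0#
  δ-≢ c x neq = cong (if_then 1# else 0#) (dec-false (_ ℕ.≟ _) neq)

  δ-⇔ : ∀ c x d y → (x % n ≡ c % n → y % n ≡ d % n) → (y % n ≡ d % n → x % n ≡ c % n) → δ c x ≡ δ d y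
  δ-⇔ c x d y to from with x % n ℕ.≟ c % n
  ... | yes eq = trans (δ-≡ c x eq) (sym (δ-≡ d y (to eq)))
  ... | no neq = trans (δ-≢ c x neq) (sym (δ-≢ d y (neq ∘ from)))

  ∑-δ : ∀ c {f : ℕ → Carrier} → Periodic n f → ∑ n (λ i → f i * δ c i) ≡ f c
  ∑-δ c {f} per = begin
    ∑ n (λ i → f i * δ c i)   ≡⟨ ∑-pick n (λ i → f i * δ c i) (ℕ.m%n<n c n) other ⟩
    f (c % n) * δ c (c % n)   ≡⟨ cong (f (c % n) *_) (δ-≡ c (c % n) (ℕ.m%n%n≡m%n c n)) ⟩
    f (c % n) * 1#            ≡⟨ *-identityʳ _ ⟩
    f (c % n)                 ≡⟨ periodic-% per c ⟩
    f c                       ∎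
    where
    other : ∀ i → i < n → i ≢ c % n → f i * δ c i ≡ 0#
    other i i<n i≢ = trans (cong (f i *_) (δ-≢ c i (λ eq → i≢ (trans (sym (ℕ.m<n⇒m%n≡m i<n)) eq)))) (zeroʳ _)

  ∑-δ₁ : ∀ c → ∑ n (δ c) ≡ 1#
  ∑-δ₁ c = trans (∑-cong n (λ i → sym (*-identityˡ (δ c i)))) (∑-δ c {λ _ → 1#} (λ _ → refl))

  Inverse : ℕ → ℕ → Set
  Inverse s t = (s ℕ.* t) % n ≡ 1 % n

  *-cancel-% : ∀ s t → Inverse s t → ∀ x y → x % n ≡ (s ℕ.* y) % n → y % n ≡ (t ℕ.* x) % n
  *-cancel-% s t st x y eq = sym $ begin
    (t ℕ.* x) % n                              ≡⟨ ℕ.%-distribˡ-* t x n ⟩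
    ((t % n) ℕ.* (x % n)) % n                  ≡⟨ cong (λ z → ((t % n) ℕ.* z) % n) eq ⟩
    ((t % n) ℕ.* ((s ℕ.* y) % n)) % n          ≡⟨ ℕ.%-distribˡ-* t (s ℕ.* y) n ⟨
    (t ℕ.* (s ℕ.* y)) % n                      ≡⟨ cong (_% n) (rearrange s t y) ⟩
    (s ℕ.* t ℕ.* y) % n                        ≡⟨ ℕ.%-distribˡ-* (s ℕ.* t) y n ⟩
    (((s ℕ.* t) % n) ℕ.* (y % n)) % n          ≡⟨ cong (λ z → (z ℕ.* (y % n)) % n) st ⟩
    ((1 % n) ℕ.* (y % n)) % n                  ≡⟨ ℕ.%-distribˡ-* 1 y n ⟨
    (1 ℕ.* y) % n                              ≡⟨ cong (_% n) (ℕ.*-identityˡ y) ⟩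
    y % n                                      ∎
    where
    rearrange : ∀ s t y → t ℕ.* (s ℕ.* y) ≡ s ℕ.* t ℕ.* y
    rearrange = ℕ-Solver.solve-∀

  Inverse-sym : ∀ s t → Inverse s t → Inverse t s
  Inverse-sym s t = trans (cong (_% n) (ℕ.*-comm t s))

  -- The substitution i ↦ s i, done by double counting: after expansion against δ the condition y =
  -- s i is read as i = t y, and each y is met once.
  ∑-unit : ∀ s t → Inverse s t → ∀ {f} → Periodic n f → ∑ n (λ i → f (s ℕ.* i)) ≡ ∑ n f
  ∑-unit s t st {f} per = begin
    ∑ n (λ i → f (s ℕ.* i))                          ≡⟨ ∑-cong n (λ i → sym (∑-δ (s ℕ.* i) per)) ⟩
    ∑ n (λ i → ∑ n (λ y → f y * δ (s ℕ.* i) y))      ≡⟨ ∑-swap n n (λ i y → f y * δ (s ℕ.* i) y) ⟩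
    ∑ n (λ y → ∑ n (λ i → f y * δ (s ℕ.* i) y))      ≡⟨ ∑-cong n (λ y → sym (scale-∑ˡ n (f y) (λ i → δ (s ℕ.* i) y))) ⟩
    ∑ n (λ y → f y * ∑ n (λ i → δ (s ℕ.* i) y))
      ≡⟨ ∑-cong n (λ y → cong (f y *_) (trans (∑-cong n (flip y)) (∑-δ₁ (t ℕ.* y)))) ⟩
    ∑ n (λ y → f y * 1#)                             ≡⟨ ∑-cong n (λ y → *-identityʳ (f y)) ⟩
    ∑ n f                                            ∎
    where
    flip : ∀ y i → δ (s ℕ.* i) y ≡ δ (t ℕ.* y) i
    flip y i = δ-⇔ (s ℕ.* i) y (t ℕ.* y) i (*-cancel-% s t st y i) (*-cancel-% t s (Inverse-sym s t st) i y)

  -- N is the residue −1.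
  N-inverse : Inverse N N
  N-inverse = trans (sym (ℕ.[m+kn]%n≡m%n (N ℕ.* N) 1 n))
    (trans (cong (_% n) (square N)) (ℕ.[m+kn]%n≡m%n 1 N n))
    where
    square : ∀ m → m ℕ.* m ℕ.+ 1 ℕ.* suc m ≡ 1 ℕ.+ m ℕ.* suc m
    square = ℕ-Solver.solve-∀

  infixl 7 _⋆_
  infixl 6 _⊕_

  _⊕_ _⋆_ : Op₂ Element
  at (f ⊕ g) x = at f x + at g x
  periodic (f ⊕ g) x = cong₂ _+_ (periodic f x) (periodic g x)
  at (f ⋆ g) k = ∑ n (λ i → at f i * at g (k ℕ.+ N ℕ.* i))
  periodic (f ⋆ g) k = ∑-cong n λ i → cong (at f i *_)
    (trans (cong (at g) (ℕ.+-assoc n k (N ℕ.* i))) (periodic g (k ℕ.+ N ℕ.* i)))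

  ⊖_ : Op₁ Element
  at (⊖ f) x = - at f x
  periodic (⊖ f) x = cong -_ (periodic f x)

  monomial : Carrier → ℕ → Element
  at (monomial c x) y = c * δ x y
  periodic (monomial c x) y = cong (c *_) (δ-periodic x y)

  ι : Carrier → Element
  ι c = monomial c 0

  𝟘 𝟙 : Element
  𝟘 = element (λ _ → 0#) (λ _ → refl)
  𝟙 = ι 1#

  ⋆-cong : ∀ {f f′ g g′} → f ≈ f′ → g ≈ g′ → f ⋆ g ≈ f′ ⋆ g′
  eq (⋆-cong ff gg) x = ∑-cong n (λ i → cong₂ _*_ (eq ff i) (eq gg (x ℕ.+ N ℕ.* i)))

  monomial-⋆ : ∀ c x f k → at (monomial c x ⋆ f) k ≡ c * at f (k ℕ.+ N ℕ.* x)
  monomial-⋆ c x f k = begin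
    ∑ n (λ i → c * δ x i * at f (k ℕ.+ N ℕ.* i))
      ≡⟨ ∑-cong n (λ i → trans (cong (_* at f (k ℕ.+ N ℕ.* i)) (*-comm c (δ x i))) (trans (*-assoc _ _ _) (*-comm _ _))) ⟩
    ∑ n (λ i → c * at f (k ℕ.+ N ℕ.* i) * δ x i)   ≡⟨ ∑-δ x per ⟩
    c * at f (k ℕ.+ N ℕ.* x)                       ∎
    where
    rearrange : ∀ m k i → 0 ℕ.* suc m ℕ.+ (k ℕ.+ m ℕ.* (suc m ℕ.+ i)) ≡ m ℕ.* suc m ℕ.+ (k ℕ.+ m ℕ.* i)
    rearrange = ℕ-Solver.solve-∀
    per : Periodic n (λ i → c * at f (k ℕ.+ N ℕ.* i))
    per i = cong (c *_) (periodic-cong (periodic f) 0 N (rearrange N k i))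

  ι-⋆ : ∀ c f k → at (ι c ⋆ f) k ≡ c * at f k
  ι-⋆ c f k = trans (monomial-⋆ c 0 f k) (cong (λ x → c * at f x) (trans (cong (k ℕ.+_) (ℕ.*-zeroʳ N)) (ℕ.+-identityʳ k)))

  ⋆-comm : ∀ f g → f ⋆ g ≈ g ⋆ f
  eq (⋆-comm f g) k = begin
    ∑ n (λ i → at f i * at g (k ℕ.+ N ℕ.* i))                                     ≡⟨ ∑-unit N N N-inverse per ⟨
    ∑ n (λ i → at f (N ℕ.* i) * at g (k ℕ.+ N ℕ.* (N ℕ.* i)))                     ≡⟨ ∑-shift n per′ (N ℕ.* k) ⟨
    ∑ n (λ i → at f (N ℕ.* (N ℕ.* k ℕ.+ i)) * at g (k ℕ.+ N ℕ.* (N ℕ.* (N ℕ.* k ℕ.+ i))))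
      ≡⟨ ∑-cong n (λ i → trans (*-comm _ _) (cong₂ _*_
           (periodic-cong (periodic g) (N ℕ.* k ℕ.+ 2 ℕ.* i) (suc (N ℕ.* N) ℕ.* k ℕ.+ n ℕ.* i) (index₁ N k i))
           (periodic-cong (periodic f) (2 ℕ.* k) (n ℕ.* k) (index₂ N k i)))) ⟩
    ∑ n (λ i → at g i * at f (k ℕ.+ N ℕ.* i))                                     ∎
    where
    index₁ : ∀ m k i → (m ℕ.* k ℕ.+ 2 ℕ.* i) ℕ.* suc m ℕ.+ (k ℕ.+ m ℕ.* (m ℕ.* (m ℕ.* k ℕ.+ i)))
                     ≡ (suc (m ℕ.* m) ℕ.* k ℕ.+ suc m ℕ.* i) ℕ.* suc m ℕ.+ i
    index₁ = ℕ-Solver.solve-∀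
    index₂ : ∀ m k i → 2 ℕ.* k ℕ.* suc m ℕ.+ m ℕ.* (m ℕ.* k ℕ.+ i) ≡ (suc m ℕ.* k) ℕ.* suc m ℕ.+ (k ℕ.+ m ℕ.* i)
    index₂ = ℕ-Solver.solve-∀
    per : Periodic n (λ i → at f i * at g (k ℕ.+ N ℕ.* i))
    per i = cong₂ _*_ (periodic f i) (periodic-cong (periodic g) 0 N (rearrange N k i))
      where
      rearrange : ∀ m k i → 0 ℕ.* suc m ℕ.+ (k ℕ.+ m ℕ.* (suc m ℕ.+ i)) ≡ m ℕ.* suc m ℕ.+ (k ℕ.+ m ℕ.* i)
      rearrange = ℕ-Solver.solve-∀
    per′ : Periodic n (λ i → at f (N ℕ.* i) * at g (k ℕ.+ N ℕ.* (N ℕ.* i)))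
    per′ i = cong₂ _*_ (periodic-cong (periodic f) 0 N (rearrange₁ N i)) (periodic-cong (periodic g) 0 (N ℕ.* N) (rearrange₂ N k i))
      where
      rearrange₁ : ∀ m i → 0 ℕ.* suc m ℕ.+ m ℕ.* (suc m ℕ.+ i) ≡ m ℕ.* suc m ℕ.+ m ℕ.* i
      rearrange₁ = ℕ-Solver.solve-∀
      rearrange₂ : ∀ m k i → 0 ℕ.* suc m ℕ.+ (k ℕ.+ m ℕ.* (m ℕ.* (suc m ℕ.+ i))) ≡ m ℕ.* m ℕ.* suc m ℕ.+ (k ℕ.+ m ℕ.* (m ℕ.* i))
      rearrange₂ = ℕ-Solver.solve-∀

  ⋆-assoc : ∀ f g h → (f ⋆ g) ⋆ h ≈ f ⋆ (g ⋆ h)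
  eq (⋆-assoc f g h) k = begin
    ∑ n (λ j → ∑ n (λ i → at f i * at g (j ℕ.+ N ℕ.* i)) * at h (k ℕ.+ N ℕ.* j))
      ≡⟨ ∑-cong n (λ j → scale-∑ʳ n (at h (k ℕ.+ N ℕ.* j)) (λ i → at f i * at g (j ℕ.+ N ℕ.* i))) ⟩
    ∑ n (λ j → ∑ n (λ i → F i j))
      ≡⟨ ∑-swap n n (λ j i → F i j) ⟩
    ∑ n (λ i → ∑ n (F i))
      ≡⟨ ∑-cong n (λ i → sym (∑-shift n (per i) i)) ⟩
    ∑ n (λ i → ∑ n (λ j → F i (i ℕ.+ j)))
      ≡⟨ ∑-cong n (λ i → ∑-cong n (λ j → trans (*-assoc _ _ _) (cong (at f i *_) (cong₂ _*_
           (periodic-cong (periodic g) 0 i (index₁ N i j)) (cong (at h) (index₂ N i j k)))))) ⟩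
    ∑ n (λ i → ∑ n (λ j → at f i * (at g j * at h (k ℕ.+ N ℕ.* i ℕ.+ N ℕ.* j))))
      ≡⟨ ∑-cong n (λ i → sym (scale-∑ˡ n (at f i) (λ j → at g j * at h (k ℕ.+ N ℕ.* i ℕ.+ N ℕ.* j)))) ⟩
    ∑ n (λ i → at f i * ∑ n (λ j → at g j * at h (k ℕ.+ N ℕ.* i ℕ.+ N ℕ.* j)))
      ∎
    where
    F : ℕ → ℕ → Carrier
    F i j = at f i * at g (j ℕ.+ N ℕ.* i) * at h (k ℕ.+ N ℕ.* j)
    index₁ : ∀ m i j → 0 ℕ.* suc m ℕ.+ (i ℕ.+ j ℕ.+ m ℕ.* i) ≡ i ℕ.* suc m ℕ.+ j
    index₁ = ℕ-Solver.solve-∀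
    index₂ : ∀ m i j k → k ℕ.+ m ℕ.* (i ℕ.+ j) ≡ k ℕ.+ m ℕ.* i ℕ.+ m ℕ.* j
    index₂ = ℕ-Solver.solve-∀
    index₃ : ∀ m k j → 0 ℕ.* suc m ℕ.+ (k ℕ.+ m ℕ.* (suc m ℕ.+ j)) ≡ m ℕ.* suc m ℕ.+ (k ℕ.+ m ℕ.* j)
    index₃ = ℕ-Solver.solve-∀
    per : ∀ i → Periodic n (F i)
    per i j = cong₂ (λ x y → at f i * x * y)
      (trans (cong (at g) (ℕ.+-assoc n j _)) (periodic g _))
      (periodic-cong (periodic h) 0 N (index₃ N k j))

  𝟙-identityˡ : ∀ f → 𝟙 ⋆ f ≈ f
  eq (𝟙-identityˡ f) k = trans (ι-⋆ 1# f k) (*-identityˡ _)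

  ⋆-distribˡ : ∀ f g h → f ⋆ (g ⊕ h) ≈ f ⋆ g ⊕ f ⋆ h
  eq (⋆-distribˡ f g h) k = trans (∑-cong n (λ i → distribˡ (at f i) (at g (k ℕ.+ N ℕ.* i)) (at h (k ℕ.+ N ℕ.* i))))
    (∑-distrib n (λ i → at f i * at g (k ℕ.+ N ℕ.* i)) (λ i → at f i * at h (k ℕ.+ N ℕ.* i)))

  ≈-refl : ∀ {f} → f ≈ f
  ≈-refl = ext λ _ → refl

  ≈-sym : ∀ {f g} → f ≈ g → g ≈ f
  ≈-sym p = ext λ x → sym (eq p x)

  ≈-trans : ∀ {f g h} → f ≈ g → g ≈ h → f ≈ h
  ≈-trans p q = ext λ x → trans (eq p x) (eq q x)

  groupRing : CommutativeRing 0ℓ 0ℓ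
  groupRing = record
    { Carrier = Element ; _≈_ = _≈_ ; _+_ = _⊕_ ; _*_ = _⋆_ ; -_ = ⊖_ ; 0# = 𝟘 ; 1# = 𝟙
    ; isCommutativeRing = record
      { isRing = record
        { +-isAbelianGroup = record
          { isGroup = record
            { isMonoid = record
              { isSemigroup = record
                { isMagma = record
                  { isEquivalence = record { refl = ≈-refl ; sym = ≈-sym ; trans = ≈-trans }
                  ; ∙-cong = λ p q → ext λ x → cong₂ _+_ (eq p x) (eq q x) }
                ; assoc = λ f g h → ext λ x → +-assoc _ _ _ }
              ; identity = (λ f → ext λ x → +-identityˡ _) , (λ f → ext λ x → +-identityʳ _) }
            ; inverse = (λ f → ext λ x → -‿inverseˡ _) , (λ f → ext λ x → -‿inverseʳ _)
            ; ⁻¹-cong = λ p → ext λ x → cong -_ (eq p x) }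
          ; comm = λ f g → ext λ x → +-comm _ _ }
        ; *-cong = ⋆-cong
        ; *-assoc = ⋆-assoc
        ; *-identity = 𝟙-identityˡ , λ f → ≈-trans (⋆-comm f 𝟙) (𝟙-identityˡ f)
        ; distrib = ⋆-distribˡ , λ f g h → ≈-trans (⋆-comm (g ⊕ h) f) (≈-trans (⋆-distribˡ f g h)
            (ext λ x → cong₂ _+_ (eq (⋆-comm f g) x) (eq (⋆-comm f h) x)))
        }
      ; *-comm = ⋆-comm
      }
    }

-- The Frobenius map

-- The prime p divides p! = C(p,k) k! (p - k)!, but it divides neither k! nor (p - k)!, whose
-- factors are all smaller than p.
prime∣binomial : ∀ {p k} → Prime p → 0 < k → k < p → p ∣ p C k
prime∣binomial {p} {k} p-prime 0<k k<p
  with euclidsLemma (p C k) (k ! ℕ.* (p ℕ.∸ k) !) p-prime (subst (p ∣_) (sym factorial) (p∣m! ℕ.≤-refl (ℕ.<-trans 0<k k<p)))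
  where
  p∣m! : ∀ {m} → p ≤ m → 0 < p → p ∣ m !
  p∣m! {zero}  p≤0 0<p = contradiction (ℕ.<-≤-trans 0<p p≤0) λ ()
  p∣m! {suc m} p≤m 0<p with ℕ.m≤n⇒m<n∨m≡n p≤m
  ... | inj₁ (s≤s p≤m′) = ∣n⇒∣m*n (suc m) (p∣m! p≤m′ 0<p)
  ... | inj₂ refl       = m∣m*n (m !)
  factorial : (p C k) ℕ.* (k ! ℕ.* (p ℕ.∸ k) !) ≡ p !
  factorial = trans (cong (ℕ._* (k ! ℕ.* (p ℕ.∸ k) !)) (nCk≡n!/k![n-k]! (ℕ.<⇒≤ k<p)))
    (ℕ.m/n*n≡m {{k ℕ.!* (p ℕ.∸ k) !≢0}} (k![n∸k]!∣n! (ℕ.<⇒≤ k<p)))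
... | inj₁ p∣C = p∣C
... | inj₂ p∣  = [ (λ d → ⊥-elim (prime∤! k<p d)) , (λ d → ⊥-elim (prime∤! (ℕ.∸-monoʳ-< 0<k (ℕ.<⇒≤ k<p)) d)) ]′ (euclidsLemma (k !) ((p ℕ.∸ k) !) p-prime p∣)
  where
  prime∤! : ∀ {m} → m < p → p ∣ m ! → ⊥
  prime∤! {zero}  0<p p∣1 = contradiction (subst Prime (∣1⇒≡1 p∣1) p-prime) ¬prime[1]
  prime∤! {suc m} m<p p∣  with euclidsLemma (suc m) (m !) p-prime p∣
  ... | inj₁ p∣m = contradiction m<p (ℕ.≤⇒≯ (∣⇒≤ p∣m))
  ... | inj₂ p∣! = prime∤! (ℕ.<-trans (ℕ.n<1+n m) m<p) p∣!

module Frobenius {c ℓ} (R : CommutativeRing c ℓ) {p : ℕ} (p-prime : Prime p) where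

  open CommutativeRing R
    renaming (refl to ≈-refl; sym to ≈-sym; trans to ≈-trans)
  open RangeSum +-commutativeMonoid
  open Exp semiring
  open Mult semiring renaming (_×_ to _·_)
  open import Relation.Binary.Reasoning.Setoid setoid

  module _ (char : p · 1# ≈ 0#) where

    p·x≈0 : ∀ x → p · x ≈ 0#
    p·x≈0 x = begin
      p · x          ≈⟨ ×-congʳ p (*-identityˡ x) ⟨
      p · (1# * x)   ≈⟨ ×-assoc-* p 1# x ⟨
      p · 1# * x     ≈⟨ *-congʳ char ⟩
      0# * x         ≈⟨ zeroˡ x ⟩
      0#             ∎

    ∣⇒·≈0 : ∀ {m} → p ∣ m → ∀ x → m · x ≈ 0#
    ∣⇒·≈0 (divides m refl) x = begin
      (m ℕ.* p) · x   ≈⟨ reflexive (cong (_· x) (ℕ.*-comm m p)) ⟩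
      (p ℕ.* m) · x   ≈⟨ ×-assocˡ x p m ⟨
      p · (m · x)     ≈⟨ p·x≈0 (m · x) ⟩
      0#              ∎

    ^p-+ : ∀ x y → (x + y) ^ p ≈ x ^ p + y ^ p
    ^p-+ x y = go p refl
      where
      term : ℕ → Carrier
      term k = (p C k) · (x ^ k * y ^ (p ℕ.∸ k))
      go : ∀ q → p ≡ q → (x + y) ^ p ≈ x ^ p + y ^ p
      go zero    refl = contradiction p-prime ¬prime[0]
      go (suc q) refl = begin
        (x + y) ^ p                       ≈⟨ Binomial.theorem commutativeSemiring p x y ⟩
        term 0 + ∑ (suc q) (term ∘ suc)   ≈⟨ +-cong first (≈-trans (∑-last q (term ∘ suc)) (+-cong (∑-zero q middle) last)) ⟩
        y ^ p + (0# + x ^ p)              ≈⟨ +-congˡ (+-identityˡ _) ⟩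
        y ^ p + x ^ p                     ≈⟨ +-comm _ _ ⟩
        x ^ p + y ^ p                     ∎
        where
        first : term 0 ≈ y ^ p
        first = ≈-trans (×-homo-1 _) (*-identityˡ _)
        last : term p ≈ x ^ p
        last = ≈-trans (reflexive (cong₂ (λ a b → a · (x ^ p * y ^ b)) (nCn≡1 p) (ℕ.n∸n≡0 p))) (≈-trans (×-homo-1 _) (*-identityʳ _))
        middle : ∀ i → i < q → term (suc i) ≈ 0#
        middle i i<q = ∣⇒·≈0 (prime∣binomial p-prime (s≤s z≤n) (s≤s i<q)) _

    frobenius-+ : ∀ k x y → (x + y) ^ (p ℕ.^ k) ≈ x ^ (p ℕ.^ k) + y ^ (p ℕ.^ k)
    frobenius-+ zero    x y = ≈-trans (*-identityʳ _) (≈-sym (+-cong (*-identityʳ _) (*-identityʳ _)))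
    frobenius-+ (suc k) x y = begin
      (x + y) ^ (p ℕ.* q)             ≈⟨ ^-assocʳ (x + y) p q ⟨
      ((x + y) ^ p) ^ q               ≈⟨ ^-congˡ q (^p-+ x y) ⟩
      (x ^ p + y ^ p) ^ q             ≈⟨ frobenius-+ k (x ^ p) (y ^ p) ⟩
      (x ^ p) ^ q + (y ^ p) ^ q       ≈⟨ +-cong (^-assocʳ x p q) (^-assocʳ y p q) ⟩
      x ^ (p ℕ.* q) + y ^ (p ℕ.* q)   ∎
      where q = p ℕ.^ k

    0^q≈0 : ∀ k → 0# ^ (p ℕ.^ k) ≈ 0#
    0^q≈0 k = go (p ℕ.^ k) {{ℕ.m^n≢0 p k {{prime⇒nonZero p-prime}}}}
      where
      go : ∀ q → .{{NonZero q}} → 0# ^ q ≈ 0#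
      go (suc q) = zeroˡ _

    frobenius-∑ : ∀ k m (f : ℕ → Carrier) → ∑ m f ^ (p ℕ.^ k) ≈ ∑ m (λ i → f i ^ (p ℕ.^ k))
    frobenius-∑ k zero    f = 0^q≈0 k
    frobenius-∑ k (suc m) f = ≈-trans (frobenius-+ k _ _) (+-congˡ (frobenius-∑ k m (f ∘ suc)))

    Fixed : ℕ → Carrier → Set ℓ
    Fixed k x = x ^ (p ℕ.^ k) ≈ x

    fixed-+ : ∀ k {x y} → Fixed k x → Fixed k y → Fixed k (x + y)
    fixed-+ k fx fy = ≈-trans (frobenius-+ k _ _) (+-cong fx fy)

    fixed-* : ∀ k {x y} → Fixed k x → Fixed k y → Fixed k (x * y)
    fixed-* k {x} {y} fx fy = ≈-trans (CommutativeExp.^-distrib-* commutativeSemiring x y (p ℕ.^ k)) (*-cong fx fy)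

    1^ : ∀ q → 1# ^ q ≈ 1#
    1^ zero    = ≈-refl
    1^ (suc q) = ≈-trans (*-identityˡ _) (1^ q)

    fixed-· : ∀ k m → Fixed k (m · 1#)
    fixed-· k zero    = 0^q≈0 k
    fixed-· k (suc m) = fixed-+ k (1^ (p ℕ.^ k)) (fixed-· k m)

    -- Additivity applied to - x + x = 0 treats p = 2 and odd p alike, with no sign (-1)^q to
    -- evaluate.
    fixed-neg : ∀ k {x} → Fixed k x → Fixed k (- x)
    fixed-neg k {x} fx = begin
      (- x) ^ q                  ≈⟨ +-identityʳ _ ⟨
      (- x) ^ q + 0#             ≈⟨ +-congˡ (-‿inverseʳ x) ⟨
      (- x) ^ q + (x + - x)      ≈⟨ +-assoc _ _ _ ⟨
      (- x) ^ q + x + - x        ≈⟨ +-congʳ (+-congˡ fx) ⟨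
      (- x) ^ q + x ^ q + - x    ≈⟨ +-congʳ (frobenius-+ k (- x) x) ⟨
      (- x + x) ^ q + - x        ≈⟨ +-congʳ (≈-trans (^-congˡ q (-‿inverseˡ x)) (0^q≈0 k)) ⟩
      0# + - x                   ≈⟨ +-identityˡ _ ⟩
      - x                        ∎
      where q = p ℕ.^ k

-- Residues modulo a principal ideal

module Quotient {c ℓ} (R : CommutativeRing c ℓ) (π : CommutativeRing.Carrier R) where

  open CommutativeRing R
    renaming (refl to ≈-refl; sym to ≈-sym; trans to ≈-trans)
  open import Relation.Binary.Reasoning.Setoid setoid
  open RingProperties ring
  open import Algebra.Properties.CommutativeSemigroup (CommutativeRing.+-commutativeSemigroup R) using () renaming (interchange to +-interchange)

  infix 4 _≡π_
  _≡π_ : Carrier → Carrier → Set (c ⊔ ℓ)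
  x ≡π y = ∃[ c ] x ≈ y + π * c

  ≈⇒≡π : ∀ {x y} → x ≈ y → x ≡π y
  ≈⇒≡π x≈y = 0# , ≈-trans x≈y (≈-sym (≈-trans (+-congˡ (zeroʳ π)) (+-identityʳ _)))

  ≡π-sym : ∀ {x y} → x ≡π y → y ≡π x
  ≡π-sym {x} {y} (c , eq) = - c , (begin
    y                          ≈⟨ +-identityʳ y ⟨
    y + 0#                     ≈⟨ +-congˡ (-‿inverseʳ (π * c)) ⟨
    y + (π * c + - (π * c))    ≈⟨ +-assoc _ _ _ ⟨
    y + π * c + - (π * c)      ≈⟨ +-cong (≈-sym eq) (-‿distribʳ-* π c) ⟩
    x + π * - c                ∎)

  ≡π-trans : ∀ {x y z} → x ≡π y → y ≡π z → x ≡π z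
  ≡π-trans {x} {y} {z} (c , eq) (d , eq′) = d + c , (begin
    x                      ≈⟨ eq ⟩
    y + π * c              ≈⟨ +-congʳ eq′ ⟩
    z + π * d + π * c      ≈⟨ +-assoc _ _ _ ⟩
    z + (π * d + π * c)    ≈⟨ +-congˡ (distribˡ π d c) ⟨
    z + π * (d + c)        ∎)

  ≡π-+ : ∀ {x y u v} → x ≡π y → u ≡π v → x + u ≡π y + v
  ≡π-+ {x} {y} {u} {v} (c , eq) (d , eq′) = c + d , (begin
    x + u                          ≈⟨ +-cong eq eq′ ⟩
    (y + π * c) + (v + π * d)      ≈⟨ +-interchange y (π * c) v (π * d) ⟩
    (y + v) + (π * c + π * d)      ≈⟨ +-congˡ (distribˡ π c d) ⟨
    (y + v) + π * (c + d)          ∎)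

  ≡π-neg : ∀ {x y} → x ≡π y → - x ≡π - y
  ≡π-neg {x} {y} (c , eq) = - c , (begin
    - x                ≈⟨ -‿cong eq ⟩
    - (y + π * c)      ≈⟨ -‿+-comm y (π * c) ⟨
    - y + - (π * c)    ≈⟨ +-congˡ (-‿distribʳ-* π c) ⟩
    - y + π * - c      ∎)

  ≡π-*ʳ : ∀ {x y} z → x ≡π y → x * z ≡π y * z
  ≡π-*ʳ {x} {y} z (c , eq) = c * z , (begin
    x * z              ≈⟨ *-congʳ eq ⟩
    (y + π * c) * z    ≈⟨ distribʳ z y (π * c) ⟩
    y * z + π * c * z  ≈⟨ +-congˡ (*-assoc π c z) ⟩
    y * z + π * (c * z) ∎)

  ≡π-* : ∀ {x y u v} → x ≡π y → u ≡π v → x * u ≡π y * v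
  ≡π-* {x} {y} {u} {v} p q = ≡π-trans (≡π-*ʳ u p)
    (≡π-trans (≈⇒≡π (*-comm y u)) (≡π-trans (≡π-*ʳ y q) (≈⇒≡π (*-comm v y))))

  -- The carrier stays the same and only equality is coarsened to congruence, so the Frobenius
  -- lemmas, stated for an arbitrary commutative ring, speak about elements of R itself.
  quotientRing : CommutativeRing c (c ⊔ ℓ)
  quotientRing = record
    { Carrier = Carrier ; _≈_ = _≡π_ ; _+_ = _+_ ; _*_ = _*_ ; -_ = -_ ; 0# = 0# ; 1# = 1#
    ; isCommutativeRing = record
      { isRing = record
        { +-isAbelianGroup = record
          { isGroup = record
            { isMonoid = record
              { isSemigroup = record
                { isMagma = record
                  { isEquivalence = record { refl = ≈⇒≡π ≈-refl ; sym = ≡π-sym ; trans = ≡π-trans }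
                  ; ∙-cong = ≡π-+ }
                ; assoc = λ x y z → ≈⇒≡π (+-assoc x y z) }
              ; identity = (λ x → ≈⇒≡π (+-identityˡ x)) , (λ x → ≈⇒≡π (+-identityʳ x)) }
            ; inverse = (λ x → ≈⇒≡π (-‿inverseˡ x)) , (λ x → ≈⇒≡π (-‿inverseʳ x))
            ; ⁻¹-cong = ≡π-neg }
          ; comm = λ x y → ≈⇒≡π (+-comm x y) }
        ; *-cong = ≡π-*
        ; *-assoc = λ x y z → ≈⇒≡π (*-assoc x y z)
        ; *-identity = (λ x → ≈⇒≡π (*-identityˡ x)) , (λ x → ≈⇒≡π (*-identityʳ x))
        ; distrib = (λ x y z → ≈⇒≡π (distribˡ x y z)) , (λ x y z → ≈⇒≡π (distribʳ x y z)) }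
      ; *-comm = λ x y → ≈⇒≡π (*-comm x y) } }

  private
    module Q  = CommutativeRing quotientRing
    module ^Q = Exp Q.semiring
    module ·Q = Mult Q.semiring
  open Exp semiring using (_^_)
  open Mult semiring using () renaming (_×_ to _·_)

  ^-quotient : ∀ x k → x ^Q.^ k ≡ x ^ k
  ^-quotient x zero    = refl
  ^-quotient x (suc k) = cong (x *_) (^-quotient x k)

  ·-quotient : ∀ k x → k ·Q.× x ≡ k · x
  ·-quotient zero    x = refl
  ·-quotient (suc k) x = cong (λ y → x + y) (·-quotient k x)

  ≡π-^ : ∀ k {x y} → x ≡π y → x ^ k ≡π y ^ k
  ≡π-^ zero    x≡y = Q.refl
  ≡π-^ (suc k) x≡y = ≡π-* x≡y (≡π-^ k x≡y)

-- The multiplier theorem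

module OrbitProduct {c ℓ} (S : CommutativeRing c ℓ) where

  open CommutativeRing S
    renaming (refl to ≈-refl; sym to ≈-sym; trans to ≈-trans)
  open Exp semiring
  open import Algebra.Properties.CommutativeSemigroup *-commutativeSemigroup using (x∙yz≈y∙xz) renaming (interchange to *-interchange)
  open import Relation.Binary.Reasoning.Setoid setoid

  module _ (ψ : Op₁ Carrier) (ψ-cong : ∀ {x y} → x ≈ y → ψ x ≈ ψ y) (ψ-* : ∀ x y → ψ (x * y) ≈ ψ x * ψ y) where

    iterate : ℕ → Op₁ Carrier
    iterate zero    x = x
    iterate (suc k) x = iterate k (ψ x)

    ∏ : ℕ → Op₁ Carrier
    ∏ zero    x = 1#
    ∏ (suc k) x = x * ∏ k (ψ x)

    ∏-cong : ∀ k {x y} → x ≈ y → ∏ k x ≈ ∏ k y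
    ∏-cong zero    x≈y = ≈-refl
    ∏-cong (suc k) x≈y = *-cong x≈y (∏-cong k (ψ-cong x≈y))

    ∏-* : ∀ k x y → ∏ k (x * y) ≈ ∏ k x * ∏ k y
    ∏-* zero    x y = ≈-sym (*-identityˡ _)
    ∏-* (suc k) x y = begin
      x * y * ∏ k (ψ (x * y))           ≈⟨ *-congˡ (≈-trans (∏-cong k (ψ-* x y)) (∏-* k (ψ x) (ψ y))) ⟩
      x * y * (∏ k (ψ x) * ∏ k (ψ y))   ≈⟨ *-interchange x y _ _ ⟩
      x * ∏ k (ψ x) * (y * ∏ k (ψ y))   ∎

    ∏-last : ∀ k x → ∏ (suc k) x ≈ ∏ k x * iterate k x
    ∏-last zero    x = *-comm x 1#
    ∏-last (suc k) x = ≈-trans (*-congˡ (∏-last k (ψ x))) (≈-sym (*-assoc _ _ _))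

    -- Applying ψ along a closed orbit only moves the first factor to the end.
    ∏-ψ : ∀ k {x} → iterate (suc k) x ≈ x → ∏ (suc k) (ψ x) ≈ ∏ (suc k) x
    ∏-ψ k {x} cycle = ≈-trans (∏-last k (ψ x)) (≈-trans (*-congˡ cycle) (*-comm _ _))

    ∏-fixed : ∀ k {x} → ψ x ≈ x → ∏ k x ≈ x ^ k
    ∏-fixed zero    ψx≈x = ≈-refl
    ∏-fixed (suc k) ψx≈x = *-congˡ (≈-trans (∏-cong k ψx≈x) (∏-fixed k ψx≈x))

    module _ (π : Carrier) where

      open Quotient S π
      private module Q = CommutativeRing quotientRing

      -- Modulo π the product over a ψ-orbit of length f is x^e with e < q^f, while x = x^(q^f).
      module _ (q : ℕ) (2≤q : 2 ≤ q) (frobenius : ∀ x → x ^ q ≡π ψ x) where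

        private
          -- Horner form of 1 + q + ⋯ + q^(k-1), which stays below q^k because q ≥ 2.
          exponent : ℕ → ℕ
          exponent zero    = 0
          exponent (suc k) = 1 ℕ.+ q ℕ.* exponent k

          exponent< : ∀ k → exponent k < q ℕ.^ k
          exponent< zero    = s≤s z≤n
          exponent< (suc k) = ℕ.≤-trans
            (ℕ.+-monoˡ-≤ (q ℕ.* exponent k) 2≤q)
            (ℕ.≤-trans (ℕ.≤-reflexive (sym (ℕ.*-suc q (exponent k)))) (ℕ.*-monoʳ-≤ q (exponent< k)))

          iterate-^ : ∀ k x → x ^ (q ℕ.^ k) ≡π iterate k x
          iterate-^ zero    x = ≈⇒≡π (*-identityʳ x)
          iterate-^ (suc k) x = Q.trans (≈⇒≡π (≈-sym (^-assocʳ x q (q ℕ.^ k))))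
            (Q.trans (≡π-^ (q ℕ.^ k) (frobenius x)) (iterate-^ k (ψ x)))

          ∏-^ : ∀ k x → x ^ exponent k ≡π ∏ k x
          ∏-^ zero    x = Q.refl
          ∏-^ (suc k) x = Q.*-cong (Q.refl {x}) (Q.trans (≈⇒≡π (≈-sym (^-assocʳ x q (exponent k))))
            (Q.trans (≡π-^ (exponent k) (frobenius x)) (∏-^ k (ψ x))))

        ∏≡0⇒≡0 : ∀ k {x} → iterate k x ≈ x → ∏ k x ≡π 0# → x ≡π 0#
        ∏≡0⇒≡0 k {x} cycle zero-product = Q.trans (Q.sym (Q.trans (iterate-^ k x) (≈⇒≡π cycle)))
          (Q.trans (≈⇒≡π (≈-trans (^-congʳ x (sym (ℕ.m+[n∸m]≡n (ℕ.<⇒≤ (exponent< k))))) (^-homo-* x (exponent k) (q ℕ.^ k ℕ.∸ exponent k))))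
            (Q.trans (Q.*-cong (Q.trans (∏-^ k x) zero-product) (Q.refl {x ^ (q ℕ.^ k ℕ.∸ exponent k)})) (≈⇒≡π (zeroˡ _))))

        module _ (f : ℕ) (cycle : ∀ x → iterate (suc f) x ≈ x)
                 (ψπ≈π : ψ π ≈ π) (cancel : ∀ {x y} → π * x ≈ π * y → x ≈ y) where

          private
            cancel-^ : ∀ k {x y} → π ^ k * x ≈ π ^ k * y → x ≈ y
            cancel-^ zero    eq = ≈-trans (≈-sym (*-identityˡ _)) (≈-trans eq (*-identityˡ _))
            cancel-^ (suc k) eq = cancel-^ k (cancel (≈-trans (≈-sym (*-assoc _ _ _)) (≈-trans eq (*-assoc _ _ _))))

            ψ1≈1 : ψ 1# ≈ 1#
            ψ1≈1 = cancel (begin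
              π * ψ 1#     ≈⟨ *-congʳ ψπ≈π ⟨
              ψ π * ψ 1#   ≈⟨ ψ-* π 1# ⟨
              ψ (π * 1#)   ≈⟨ ψ-cong (*-identityʳ π) ⟩
              ψ π          ≈⟨ ψπ≈π ⟩
              π            ≈⟨ *-identityʳ π ⟨
              π * 1#       ∎)

            ψπ^ : ∀ k → ψ (π ^ k) ≈ π ^ k
            ψπ^ zero    = ψ1≈1
            ψπ^ (suc k) = ≈-trans (ψ-* π (π ^ k)) (*-cong ψπ≈π (ψπ^ k))

          -- The Frobenius congruence holds modulo π only, so the M factors π are removed one at a
          -- time. If ψA · B = π^j D with j < M, the orbit product of the left side is ν^(f+1), and
          -- ψ fixes π, so cancelling π^(j(f+1)) leaves the orbit product of D as a multiple of π.
          -- Then D itself is a multiple of π.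
          multiplier-divides : ∀ {A B ν u M} → A * B ≈ ν → ψ ν ≈ ν → ν ≈ π ^ M * u → ∃[ D ] ψ A * B ≈ π ^ M * D
          multiplier-divides {A} {B} {ν} {u} {M} AB≈ν ψν≈ν ν≈ = go M ℕ.≤-refl
            where
            total : ∏ (suc f) (ψ A * B) ≈ ν ^ suc f
            total = begin
              ∏ (suc f) (ψ A * B)                ≈⟨ ∏-* (suc f) (ψ A) B ⟩
              ∏ (suc f) (ψ A) * ∏ (suc f) B      ≈⟨ *-congʳ (∏-ψ f (cycle A)) ⟩
              ∏ (suc f) A * ∏ (suc f) B          ≈⟨ ∏-* (suc f) A B ⟨
              ∏ (suc f) (A * B)                  ≈⟨ ∏-cong (suc f) AB≈ν ⟩
              ∏ (suc f) ν                        ≈⟨ ∏-fixed (suc f) ψν≈ν ⟩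
              ν ^ suc f                          ∎

            step : ∀ j D d → M ≡ suc j ℕ.+ d → ψ A * B ≈ π ^ j * D → ∃[ D′ ] ψ A * B ≈ π ^ suc j * D′
            step j D d M≡ eq = let (D′ , D≈) = D≡0 in D′ , (begin
              ψ A * B               ≈⟨ eq ⟩
              π ^ j * D             ≈⟨ *-congˡ (≈-trans D≈ (+-identityˡ _)) ⟩
              π ^ j * (π * D′)      ≈⟨ x∙yz≈y∙xz (π ^ j) π D′ ⟩
              π * (π ^ j * D′)      ≈⟨ *-assoc π (π ^ j) D′ ⟨
              π ^ suc j * D′        ∎)
              where
              w = π ^ d * u
              ν≈′ : ν ≈ π ^ j * (π * w)
              ν≈′ = begin
                ν                             ≈⟨ ν≈ ⟩
                π ^ M * u                     ≈⟨ *-congʳ (^-congʳ π (trans M≡ (sym (ℕ.+-suc j d)))) ⟩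
                π ^ (j ℕ.+ suc d) * u         ≈⟨ *-congʳ (^-homo-* π j (suc d)) ⟩
                π ^ j * (π * π ^ d) * u       ≈⟨ *-assoc _ _ _ ⟩
                π ^ j * (π * π ^ d * u)       ≈⟨ *-congˡ (*-assoc _ _ _) ⟩
                π ^ j * (π * w)               ∎
              ∏D≈ : ∏ (suc f) D ≈ (π * w) ^ suc f
              ∏D≈ = cancel-^ (j ℕ.* suc f) (begin
                π ^ (j ℕ.* suc f) * ∏ (suc f) D           ≈⟨ *-congʳ (^-assocʳ π j (suc f)) ⟨
                (π ^ j) ^ suc f * ∏ (suc f) D             ≈⟨ *-congʳ (∏-fixed (suc f) (ψπ^ j)) ⟨
                ∏ (suc f) (π ^ j) * ∏ (suc f) D           ≈⟨ ∏-* (suc f) (π ^ j) D ⟨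
                ∏ (suc f) (π ^ j * D)                     ≈⟨ ∏-cong (suc f) eq ⟨
                ∏ (suc f) (ψ A * B)                       ≈⟨ total ⟩
                ν ^ suc f                                 ≈⟨ ^-congˡ (suc f) ν≈′ ⟩
                (π ^ j * (π * w)) ^ suc f
                  ≈⟨ CommutativeExp.^-distrib-* commutativeSemiring (π ^ j) (π * w) (suc f) ⟩
                (π ^ j) ^ suc f * (π * w) ^ suc f         ≈⟨ *-congʳ (^-assocʳ π j (suc f)) ⟩
                π ^ (j ℕ.* suc f) * (π * w) ^ suc f       ∎)
              D≡0 : D ≡π 0#
              D≡0 = ∏≡0⇒≡0 (suc f) (cycle D) (w * (π * w) ^ f ,
                ≈-trans ∏D≈ (≈-trans (*-assoc _ _ _) (≈-sym (+-identityˡ _))))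

            go : ∀ j → j ≤ M → ∃[ D ] ψ A * B ≈ π ^ j * D
            go zero    _   = ψ A * B , ≈-sym (*-identityˡ _)
            go (suc j) j<M = let (D , eq) = go j (ℕ.<⇒≤ j<M) in step j D (M ℕ.∸ suc j) (sym (ℕ.m+[n∸m]≡n j<M)) eq

-- A prime π over p whose residue field lies in the field with p ^ k elements.
record PrimeAbove (K : Coefficients) (p k : ℕ) : Set where
  open Coefficients K
  field
    p-prime : Prime p
    1≤k     : 1 ≤ k
    π       : Carrier
    norm≢0  : norm π ≢ 0
    over    : ∃[ c ] p · 1# ≡ π * c
    fixed   : ∀ x → ∃[ d ] x ^ (p ℕ.^ k) ≡ x + π * d

module Twist (K : Coefficients) (N : ℕ) where

  open Coefficients K
  open GroupRing K N public

  module S where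
    open CommutativeRing groupRing public
    open Exp (CommutativeRing.semiring groupRing) public
    open Mult (CommutativeRing.semiring groupRing) public using () renaming (_×_ to _·_)

  module _ (κ : Op₁ Carrier) (κ-+ : ∀ x y → κ (x + y) ≡ κ x + κ y) (κ-0 : κ 0# ≡ 0#)
           (κ-* : ∀ x y → κ (x * y) ≡ κ x * κ y) where

    κ-∑ : ∀ m f → κ (∑ m f) ≡ ∑ m (κ ∘ f)
    κ-∑ zero    f = κ-0
    κ-∑ (suc m) f = trans (κ-+ _ _) (cong (λ z → κ (f 0) + z) (κ-∑ m (f ∘ suc)))

    -- Common form of the multiplier map `ψ` (κ the identity) and of the involution `_*′` (κ the
    -- conjugation and s = N, that is -1), so that one proof of multiplicativity serves both.
    twist : ℕ → Op₁ Element
    at (twist s f) x = κ (at f (s ℕ.* x))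
    periodic (twist s f) x = cong κ (periodic-cong (periodic f) 0 s (index N s x))
      where
      index : ∀ m s x → 0 ℕ.* suc m ℕ.+ s ℕ.* (suc m ℕ.+ x) ≡ s ℕ.* suc m ℕ.+ s ℕ.* x
      index = ℕ-Solver.solve-∀

    twist-⋆ : ∀ s t → Inverse s t → ∀ f g → twist s (f ⋆ g) ≈ twist s f ⋆ twist s g
    eq (twist-⋆ s t st f g) x = begin
      κ (∑ n (λ i → at f i * at g (s ℕ.* x ℕ.+ N ℕ.* i)))
        ≡⟨ κ-∑ n (λ i → at f i * at g (s ℕ.* x ℕ.+ N ℕ.* i)) ⟩
      ∑ n (λ i → κ (at f i * at g (s ℕ.* x ℕ.+ N ℕ.* i)))                    ≡⟨ ∑-unit s t st per ⟨
      ∑ n (λ i → κ (at f (s ℕ.* i) * at g (s ℕ.* x ℕ.+ N ℕ.* (s ℕ.* i))))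
        ≡⟨ ∑-cong n (λ i → trans (κ-* _ _) (cong (λ y → κ (at f (s ℕ.* i)) * κ (at g y)) (index N s x i))) ⟩
      ∑ n (λ i → κ (at f (s ℕ.* i)) * κ (at g (s ℕ.* (x ℕ.+ N ℕ.* i))))     ∎
      where
      open ≡-Reasoning
      index : ∀ m s x i → s ℕ.* x ℕ.+ m ℕ.* (s ℕ.* i) ≡ s ℕ.* (x ℕ.+ m ℕ.* i)
      index = ℕ-Solver.solve-∀
      index₂ : ∀ m k i → 0 ℕ.* suc m ℕ.+ (k ℕ.+ m ℕ.* (suc m ℕ.+ i)) ≡ m ℕ.* suc m ℕ.+ (k ℕ.+ m ℕ.* i)
      index₂ = ℕ-Solver.solve-∀
      per : Periodic n (λ i → κ (at f i * at g (s ℕ.* x ℕ.+ N ℕ.* i)))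
      per i = cong κ (cong₂ _*_ (periodic f i) (periodic-cong (periodic g) 0 N (index₂ N (s ℕ.* x) i)))

  ψ : ℕ → Op₁ Element
  ψ = twist id (λ _ _ → refl) refl (λ _ _ → refl)

  infix 9 _*′
  _*′ : Op₁ Element
  _*′ = twist conj conj-+ conj-0 conj-* N

  ψ-⋆ : ∀ s t → Inverse s t → ∀ f g → ψ s (f ⋆ g) ≈ ψ s f ⋆ ψ s g
  ψ-⋆ = twist-⋆ id (λ _ _ → refl) refl (λ _ _ → refl)

  *′-⋆ : ∀ f g → (f ⋆ g) *′ ≈ f *′ ⋆ g *′
  *′-⋆ = twist-⋆ conj conj-+ conj-0 conj-* N N N-inverse

  *′-involutive : ∀ f → f *′ *′ ≈ f
  eq (*′-involutive f) x = trans (conj-involutive _) (periodic-cong (periodic f) (2 ℕ.* x) (suc N ℕ.* x) (index N x))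
    where
    index : ∀ m x → 2 ℕ.* x ℕ.* suc m ℕ.+ m ℕ.* (m ℕ.* x) ≡ suc m ℕ.* x ℕ.* suc m ℕ.+ x
    index = ℕ-Solver.solve-∀

  ψ-*′ : ∀ s f → ψ s (f *′) ≈ (ψ s f) *′
  eq (ψ-*′ s f) x = cong (conj ∘ at f) (index N s x)
    where
    index : ∀ m s x → m ℕ.* (s ℕ.* x) ≡ s ℕ.* (m ℕ.* x)
    index = ℕ-Solver.solve-∀

  δ-twist : ∀ s t → Inverse s t → ∀ c x → δ c (s ℕ.* x) ≡ δ (t ℕ.* c) x
  δ-twist s t st c x = δ-⇔ c (s ℕ.* x) (t ℕ.* c) x
    (λ eq → *-cancel-% s t st c x (sym eq))
    (λ eq → sym (*-cancel-% t s (Inverse-sym s t st) x c eq))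

  δ0-unit : ∀ s t → Inverse s t → ∀ x → δ 0 (s ℕ.* x) ≡ δ 0 x
  δ0-unit s t st x = trans (δ-twist s t st 0 x) (cong (λ c → δ c x) (ℕ.*-zeroʳ t))

  ψ-ι : ∀ s t → Inverse s t → ∀ c → ψ s (ι c) ≈ ι c
  eq (ψ-ι s t st c) x = cong (c *_) (δ0-unit s t st x)

  *′-ι : ∀ c → (ι c) *′ ≈ ι (conj c)
  eq (*′-ι c) x = trans (conj-* c _) (cong (conj c *_) (trans (conj-δ (N ℕ.* x)) (δ0-unit N N N-inverse x)))
    where
    conj-δ : ∀ y → conj (δ 0 y) ≡ δ 0 y
    conj-δ y with does (y % n ℕ.≟ 0 % n)
    ... | true  = conj-1
    ... | false = conj-0

  ι-* : ∀ c d → ι (c * d) ≈ ι c ⋆ ι d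
  eq (ι-* c d) x = trans (*-assoc c d (δ 0 x)) (sym (ι-⋆ c (ι d) x))

  ι-^ : ∀ c k → ι (c ^ k) ≈ ι c S.^ k
  ι-^ c zero    = ≈-refl
  ι-^ c (suc k) = ≈-trans (ι-* c (c ^ k)) (S.*-congˡ {ι c} (ι-^ c k))

  ι-· : ∀ m → ι (m · 1#) ≈ m S.· 𝟙
  eq (ι-· zero)    x = zeroˡ _
  eq (ι-· (suc m)) x = trans (distribʳ _ _ _) (cong (λ z → 1# * δ 0 x + z) (eq (ι-· m) x))

  concentrated : ∀ f g → g < n → (∀ i → i < n → i ≢ g → at f i ≡ 0#) → f ≈ monomial (at f g) g
  concentrated f g g<n vanishes = ext λ x → trans (sym (periodic-% (periodic f) x)) (go x (x % n ℕ.≟ g))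
    where
    g%n : g % n ≡ g
    g%n = ℕ.m<n⇒m%n≡m g<n
    go : ∀ x → Dec (x % n ≡ g) → at f (x % n) ≡ at f g * δ g x
    go x (yes x≡g) = trans (cong (at f) x≡g) (trans (sym (*-identityʳ _)) (cong (at f g *_) (sym (δ-≡ g x (trans x≡g (sym g%n))))))
    go x (no  x≢g) = trans (vanishes (x % n) (ℕ.m%n<n x n) x≢g)
      (trans (sym (zeroʳ _)) (cong (at f g *_) (sym (δ-≢ g x (λ x≡g → x≢g (trans x≡g g%n))))))

  monomial-1-^ : ∀ x k → monomial 1# x S.^ k ≈ monomial 1# (k ℕ.* x)
  monomial-1-^ x zero    = ≈-refl
  eq (monomial-1-^ x (suc k)) y = begin
    at (monomial 1# x ⋆ monomial 1# x S.^ k) y                 ≡⟨ monomial-⋆ 1# x (monomial 1# x S.^ k) y ⟩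
    1# * at (monomial 1# x S.^ k) (y ℕ.+ N ℕ.* x)              ≡⟨ *-identityˡ _ ⟩
    at (monomial 1# x S.^ k) (y ℕ.+ N ℕ.* x)                   ≡⟨ eq (monomial-1-^ x k) (y ℕ.+ N ℕ.* x) ⟩
    1# * δ (k ℕ.* x) (y ℕ.+ N ℕ.* x)
      ≡⟨ cong (1# *_) (δ-⇔ (k ℕ.* x) (y ℕ.+ N ℕ.* x) (x ℕ.+ k ℕ.* x) y to from) ⟩
    1# * δ (x ℕ.+ k ℕ.* x) y                                   ∎
    where
    open ≡-Reasoning
    index : ∀ m y x → y ℕ.+ m ℕ.* x ℕ.+ x ≡ y ℕ.+ x ℕ.* suc m
    index = ℕ-Solver.solve-∀
    index₂ : ∀ m k x → m ℕ.* x ℕ.+ (x ℕ.+ k ℕ.* x) ≡ k ℕ.* x ℕ.+ x ℕ.* suc m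
    index₂ = ℕ-Solver.solve-∀
    to : (y ℕ.+ N ℕ.* x) % n ≡ (k ℕ.* x) % n → y % n ≡ (x ℕ.+ k ℕ.* x) % n
    to eq = begin
      y % n                              ≡⟨ ℕ.[m+kn]%n≡m%n y x n ⟨
      (y ℕ.+ x ℕ.* n) % n                ≡⟨ cong (_% n) (index N y x) ⟨
      (y ℕ.+ N ℕ.* x ℕ.+ x) % n          ≡⟨ cong (_% n) (ℕ.+-comm _ x) ⟩
      (x ℕ.+ (y ℕ.+ N ℕ.* x)) % n        ≡⟨ %-congʳ-+ n x (y ℕ.+ N ℕ.* x) (k ℕ.* x) eq ⟩
      (x ℕ.+ k ℕ.* x) % n                ∎
    from : y % n ≡ (x ℕ.+ k ℕ.* x) % n → (y ℕ.+ N ℕ.* x) % n ≡ (k ℕ.* x) % n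
    from eq = begin
      (y ℕ.+ N ℕ.* x) % n                  ≡⟨ cong (_% n) (ℕ.+-comm y _) ⟩
      (N ℕ.* x ℕ.+ y) % n                  ≡⟨ %-congʳ-+ n (N ℕ.* x) y (x ℕ.+ k ℕ.* x) eq ⟩
      (N ℕ.* x ℕ.+ (x ℕ.+ k ℕ.* x)) % n    ≡⟨ cong (_% n) (index₂ N k x) ⟩
      (k ℕ.* x ℕ.+ x ℕ.* n) % n            ≡⟨ ℕ.[m+kn]%n≡m%n (k ℕ.* x) x n ⟩
      (k ℕ.* x) % n                        ∎

  module _ {p k : ℕ} (above : PrimeAbove K p k) where

    open PrimeAbove above

    private
      q = p ℕ.^ k

    open Quotient groupRing (ι π)

    private
      module Q where
        open CommutativeRing quotientRing public
        open Mult (CommutativeRing.semiring quotientRing) public using () renaming (_×_ to _·_)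
        open Exp (CommutativeRing.semiring quotientRing) public
        open RangeSum (CommutativeRing.+-commutativeMonoid quotientRing) public
      module F = Frobenius quotientRing p-prime

      ι-multiple : ∀ c d → ι (c + π * d) ≡π ι c
      ι-multiple c d = ι d , ext λ x → trans (distribʳ (δ 0 x) c (π * d)) (cong (λ z → c * δ 0 x + z) (eq (ι-* π d) x))

      ι-cong : ∀ {c d} → c ≡ d → ι c ≈ ι d
      ι-cong refl = ≈-refl

      open import Relation.Binary.Reasoning.Setoid Q.setoid

      char : p Q.· 𝟙 ≡π 𝟘
      char = begin
        p Q.· 𝟙                      ≡⟨ ·-quotient p 𝟙 ⟩
        p S.· 𝟙                      ≈⟨ ≈⇒≡π (ι-· p) ⟨
        ι (p · 1#)                   ≈⟨ ≈⇒≡π (ι-cong (trans (proj₂ over) (sym (+-identityˡ _)))) ⟩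
        ι (0# + π * proj₁ over)      ≈⟨ ι-multiple 0# (proj₁ over) ⟩
        ι 0#                         ≈⟨ ≈⇒≡π (ext λ x → zeroˡ _) ⟩
        𝟘                            ∎

      at-∑ : ∀ m F x → at (Q.∑ m F) x ≡ ∑ m (λ i → at (F i) x)
      at-∑ zero    F x = refl
      at-∑ (suc m) F x = cong (λ z → at (F 0) x + z) (at-∑ m (F ∘ suc) x)

      expand : ∀ f → f ≈ Q.∑ n (λ x → monomial (at f x) x)
      expand f = ext λ y → sym (trans (at-∑ n (λ x → monomial (at f x) x) y)
        (trans (∑-cong n (λ x → cong (at f x *_) (δ-⇔ x y y x sym sym))) (∑-δ y (periodic f))))

      monomial-split : ∀ c x → monomial c x ≈ ι c ⋆ monomial 1# x
      monomial-split c x = ext λ y → trans (cong (c *_) (sym (*-identityˡ _))) (sym (ι-⋆ c (monomial 1# x) y))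

      ι-frobenius : ∀ c → ι c S.^ q ≡π ι c
      ι-frobenius c = begin
        ι c S.^ q                     ≈⟨ ≈⇒≡π (ι-^ c q) ⟨
        ι (c ^ q)                     ≈⟨ ≈⇒≡π (ι-cong (proj₂ (fixed c))) ⟩
        ι (c + π * proj₁ (fixed c))   ≈⟨ ι-multiple c (proj₁ (fixed c)) ⟩
        ι c                           ∎

      monomial-frobenius : ∀ c x → monomial c x S.^ q ≡π monomial c (q ℕ.* x)
      monomial-frobenius c x = begin
        monomial c x S.^ q                     ≈⟨ ≡π-^ q (≈⇒≡π (monomial-split c x)) ⟩
        (ι c ⋆ monomial 1# x) S.^ q
          ≈⟨ ≈⇒≡π (CommutativeExp.^-distrib-* S.commutativeSemiring (ι c) (monomial 1# x) q) ⟩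
        ι c S.^ q ⋆ monomial 1# x S.^ q        ≈⟨ Q.*-cong (ι-frobenius c) (≈⇒≡π (monomial-1-^ x q)) ⟩
        ι c ⋆ monomial 1# (q ℕ.* x)            ≈⟨ ≈⇒≡π (monomial-split c (q ℕ.* x)) ⟨
        monomial c (q ℕ.* x)                   ∎

    -- Modulo π the q-th power is additive, fixes the coefficients and sends the group element x to
    -- q x. Since s inverts q, the coefficient that arrives at y is the one that stood at s y.
    frobenius : ∀ s → Inverse s q → ∀ f → f S.^ q ≡π ψ s f
    frobenius s sq f = begin
      f S.^ q                                              ≈⟨ ≡π-^ q (≈⇒≡π (expand f)) ⟩
      Q.∑ n (λ x → monomial (at f x) x) S.^ q              ≡⟨ ^-quotient (Q.∑ n (λ x → monomial (at f x) x)) q ⟨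
      Q.∑ n (λ x → monomial (at f x) x) Q.^ q              ≈⟨ F.frobenius-∑ char k n (λ x → monomial (at f x) x) ⟩
      Q.∑ n (λ x → monomial (at f x) x Q.^ q)
        ≈⟨ Q.∑-cong n (λ x → Q.trans (Q.reflexive (^-quotient (monomial (at f x) x) q)) (monomial-frobenius (at f x) x)) ⟩
      Q.∑ n (λ x → monomial (at f x) (q ℕ.* x))            ≈⟨ ≈⇒≡π image ⟩
      ψ s f                                                ∎
      where
      image : Q.∑ n (λ x → monomial (at f x) (q ℕ.* x)) ≈ ψ s f
      image = ext λ y → trans (at-∑ n (λ x → monomial (at f x) (q ℕ.* x)) y)
        (trans (∑-cong n (λ x → cong (at f x *_) (δ-⇔ (q ℕ.* x) y (s ℕ.* y) x
          (*-cancel-% q s (Inverse-sym s q sq) y x) (*-cancel-% s q sq x y))))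
        (∑-δ (s ℕ.* y) (periodic f)))

ℕ-∑ : ℕ → (ℕ → ℕ) → ℕ
ℕ-∑ = RangeSum.∑ ℕ.+-0-commutativeMonoid

ℕ-∑≡0 : ∀ m {f} → ℕ-∑ m f ≡ 0 → ∀ i → i < m → f i ≡ 0
ℕ-∑≡0 (suc m) {f} eq zero    _         = ℕ.m+n≡0⇒m≡0 (f 0) eq
ℕ-∑≡0 (suc m) {f} eq (suc i) (s≤s i<m) = ℕ-∑≡0 m (ℕ.m+n≡0⇒n≡0 (f 0) eq) i i<m

ℕ-∑≡1 : ∀ m {f} → ℕ-∑ m f ≡ 1 → ∃[ g ] g < m × (∀ i → i < m → i ≢ g → f i ≡ 0)
ℕ-∑≡1 (suc m) {f} eq with f 0 in f0
... | zero  = let (g , g<m , rest) = ℕ-∑≡1 m eq in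
              suc g , s≤s g<m , λ { zero _ _ → f0 ; (suc i) (s≤s i<m) i≢g → rest i i<m (i≢g ∘ cong suc) }
... | suc k = 0 , s≤s z≤n , λ { zero _ 0≢0 → contradiction refl 0≢0
                              ; (suc i) (s≤s i<m) _ → ℕ-∑≡0 m (ℕ.m+n≡0⇒n≡0 k (ℕ.suc-injective eq)) i i<m }

-- Sequences with perfect periodic autocorrelation

module _ (K : Coefficients) where

  open Coefficients K
  open RangeSum +-commutativeMonoid

  ∑-norm : ∀ m (f : ℕ → ℕ) → ∑ m (λ i → f i · 1#) ≡ ℕ-∑ m f · 1#
  ∑-norm zero    f = refl
  ∑-norm (suc m) f = trans (cong (λ z → f 0 · 1# + z) (∑-norm m (f ∘ suc)))
    (sym (Mult.×-homo-+ semiring 1# (f 0) (ℕ-∑ m (f ∘ suc))))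

  correlation : ℕ → (ℕ → Carrier) → ℕ → Carrier
  correlation n f d = ∑ n (λ i → f (d ℕ.+ i) * conj (f i))

  -- The equation A A* = ν coefficient by coefficient, for bare functions: in this form it passes
  -- directly to translates, twists by θ and projections.
  record Perfect (n ν : ℕ) (f : ℕ → Carrier) : Set where
    field
      periodic-f : Periodic n f
      peak       : correlation n f 0 ≡ ν · 1#
      off-peak   : ∀ d → 0 < d → d < n → correlation n f d ≡ 0#

  correlation-periodic : ∀ {n f} → Periodic n f → Periodic n (correlation n f)
  correlation-periodic {n} {f} per d = ∑-cong n λ i → cong (_* conj (f i)) (trans (cong f (ℕ.+-assoc n d i)) (per (d ℕ.+ i)))

  perfect-shift : ∀ {n ν f} h → Perfect n ν f → Perfect n ν (λ x → f (h ℕ.+ x))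
  perfect-shift {n} {ν} {f} h perfect = record
    { periodic-f = λ x → trans (cong f (swap h n x)) (periodic-f _)
    ; peak       = trans (shifted 0) peak
    ; off-peak   = λ d 0<d d<n → trans (shifted d) (off-peak d 0<d d<n) }
    where
    open Perfect perfect
    swap : ∀ h n x → h ℕ.+ (n ℕ.+ x) ≡ n ℕ.+ (h ℕ.+ x)
    swap = ℕ-Solver.solve-∀
    shifted : ∀ d → ∑ n (λ i → f (h ℕ.+ (d ℕ.+ i)) * conj (f (h ℕ.+ i))) ≡ correlation n f d
    shifted d = trans (∑-cong n (λ i → cong (λ x → f x * conj (f (h ℕ.+ i))) (swap h d i)))
      (∑-shift n (λ i → cong₂ (λ x y → x * conj y) (trans (cong f (swap d n i)) (periodic-f _)) (periodic-f i)) h)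

module Multiplier (K : Coefficients) (N ν : ℕ) (ν≢0 : ν ≢ 0)
                  (a : ℕ → Coefficients.Carrier K) (perfect : Perfect K (suc N) ν a) where

  open Coefficients K
  open Twist K N
  open Perfect perfect

  A : Element
  A = element a periodic-f

  ν# : Carrier
  ν# = ν · 1#

  ν#≢0 : norm ν# ≢ 0
  ν#≢0 eq = ν≢0 (ℤ.+-injective (trans (sym (re-· ν)) (trans (cong re (norm≡0 eq)) re-0)))

  A⋆A* : A ⋆ A *′ ≈ ι ν#
  A⋆A* = ext λ d → begin
    ∑ n (λ i → a i * conj (a (N ℕ.* (d ℕ.+ N ℕ.* i))))                       ≡⟨ ∑-shift n (per d) d ⟨
    ∑ n (λ i → a (d ℕ.+ i) * conj (a (N ℕ.* (d ℕ.+ N ℕ.* (d ℕ.+ i)))))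
      ≡⟨ ∑-cong n (λ i → cong (λ x → a (d ℕ.+ i) * conj x)
                                                                                  (periodic-cong periodic-f (2 ℕ.* i ℕ.+ d) (d ℕ.* n ℕ.+ n ℕ.* i) (index N d i))) ⟩
    correlation K n a d                                                      ≡⟨ value d ⟩
    ν# * δ 0 d                                                               ∎
    where
    open ≡-Reasoning
    index : ∀ m d i → (2 ℕ.* i ℕ.+ d) ℕ.* suc m ℕ.+ m ℕ.* (d ℕ.+ m ℕ.* (d ℕ.+ i))
                    ≡ (d ℕ.* suc m ℕ.+ suc m ℕ.* i) ℕ.* suc m ℕ.+ i
    index = ℕ-Solver.solve-∀
    index₂ : ∀ m d i → 0 ℕ.* suc m ℕ.+ m ℕ.* (d ℕ.+ m ℕ.* (suc m ℕ.+ i)) ≡ m ℕ.* m ℕ.* suc m ℕ.+ m ℕ.* (d ℕ.+ m ℕ.* i)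
    index₂ = ℕ-Solver.solve-∀
    per : ∀ d → Periodic n (λ i → a i * conj (a (N ℕ.* (d ℕ.+ N ℕ.* i))))
    per d i = cong₂ (λ x y → x * conj y) (periodic-f i) (periodic-cong periodic-f 0 (N ℕ.* N) (index₂ N d i))
    value : ∀ d → correlation K n a d ≡ ν# * δ 0 d
    value d with d % n in d%n
    ... | zero  = begin
      correlation K n a d         ≡⟨ periodic-% (correlation-periodic K {n} {a} periodic-f) d ⟨
      correlation K n a (d % n)   ≡⟨ cong (correlation K n a) d%n ⟩
      correlation K n a 0         ≡⟨ peak ⟩
      ν#                          ≡⟨ *-identityʳ ν# ⟨
      ν# * 1#                     ∎
    ... | suc r = begin
      correlation K n a d         ≡⟨ periodic-% (correlation-periodic K {n} {a} periodic-f) d ⟨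
      correlation K n a (d % n)   ≡⟨ cong (correlation K n a) d%n ⟩
      correlation K n a (suc r)   ≡⟨ off-peak (suc r) (s≤s z≤n) (subst (_< n) d%n (ℕ.m%n<n d n)) ⟩
      0#                          ≡⟨ zeroʳ ν# ⟨
      ν# * 0#                     ∎

  -- The values lie in the coefficient ring, so evaluation does not leave it. The instances are the
  -- trivial character and, over ℤ, x ↦ (-1)^x.
  record Character : Set where
    field
      χ          : ℕ → Carrier
      χ-periodic : Periodic n χ
      χ-+        : ∀ x y → χ (x ℕ.+ y) ≡ χ x * χ y
      χ-0        : χ 0 ≡ 1#
      χ-conj     : ∀ x → χ x ≡ conj (χ (N ℕ.* x))

  module Evaluation (character : Character) where

    open Character character
    open ≡-Reasoning

    eval : Element → Carrier
    eval f = ∑ n (λ x → χ x * at f x)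

    eval-cong : ∀ {f g} → f ≈ g → eval f ≡ eval g
    eval-cong p = ∑-cong n (λ x → cong (χ x *_) (eq p x))

    eval-shift : ∀ f g → ∑ n (λ x → χ x * at f (x ℕ.+ N ℕ.* g)) ≡ χ g * eval f
    eval-shift f g = begin
      ∑ n (λ x → χ x * at f (x ℕ.+ N ℕ.* g))                       ≡⟨ ∑-shift n per g ⟨
      ∑ n (λ x → χ (g ℕ.+ x) * at f (g ℕ.+ x ℕ.+ N ℕ.* g))
        ≡⟨ ∑-cong n (λ x → trans (cong₂ _*_ (χ-+ g x) (periodic-cong (periodic f) 0 g (index N g x))) (*-assoc _ _ _)) ⟩
      ∑ n (λ x → χ g * (χ x * at f x))                             ≡⟨ scale-∑ˡ n (χ g) (λ x → χ x * at f x) ⟨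
      χ g * eval f                                                 ∎
      where
      index : ∀ m g x → 0 ℕ.* suc m ℕ.+ (g ℕ.+ x ℕ.+ m ℕ.* g) ≡ g ℕ.* suc m ℕ.+ x
      index = ℕ-Solver.solve-∀
      per : Periodic n (λ x → χ x * at f (x ℕ.+ N ℕ.* g))
      per x = cong₂ _*_ (χ-periodic x) (trans (cong (at f) (ℕ.+-assoc n x (N ℕ.* g))) (periodic f _))

    eval-⋆ : ∀ f g → eval (f ⋆ g) ≡ eval f * eval g
    eval-⋆ f g = begin
      ∑ n (λ k → χ k * ∑ n (λ i → at f i * at g (k ℕ.+ N ℕ.* i)))
        ≡⟨ ∑-cong n (λ k → scale-∑ˡ n (χ k) (λ i → at f i * at g (k ℕ.+ N ℕ.* i))) ⟩
      ∑ n (λ k → ∑ n (λ i → χ k * (at f i * at g (k ℕ.+ N ℕ.* i))))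
        ≡⟨ ∑-swap n n (λ k i → χ k * (at f i * at g (k ℕ.+ N ℕ.* i))) ⟩
      ∑ n (λ i → ∑ n (λ k → χ k * (at f i * at g (k ℕ.+ N ℕ.* i))))
        ≡⟨ ∑-cong n (λ i → ∑-cong n (λ k → x*yz≡y*xz (χ k) (at f i) (at g (k ℕ.+ N ℕ.* i)))) ⟩
      ∑ n (λ i → ∑ n (λ k → at f i * (χ k * at g (k ℕ.+ N ℕ.* i))))
        ≡⟨ ∑-cong n (λ i → sym (scale-∑ˡ n (at f i) (λ k → χ k * at g (k ℕ.+ N ℕ.* i)))) ⟩
      ∑ n (λ i → at f i * ∑ n (λ k → χ k * at g (k ℕ.+ N ℕ.* i)))
        ≡⟨ ∑-cong n (λ i → trans (cong (at f i *_) (eval-shift g i)) (trans (x*yz≡y*xz (at f i) (χ i) (eval g)) (sym (*-assoc _ _ _)))) ⟩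
      ∑ n (λ i → χ i * at f i * eval g)                                 ≡⟨ scale-∑ʳ n (eval g) (λ i → χ i * at f i) ⟨
      eval f * eval g                                                   ∎
      where
      x*yz≡y*xz : ∀ x y z → x * (y * z) ≡ y * (x * z)
      x*yz≡y*xz x y z = trans (sym (*-assoc x y z)) (trans (cong (_* z) (*-comm x y)) (*-assoc y x z))

    eval-*′ : ∀ f → eval (f *′) ≡ conj (eval f)
    eval-*′ f = begin
      ∑ n (λ x → χ x * conj (at f (N ℕ.* x)))
        ≡⟨ ∑-cong n (λ x → trans (cong (_* conj (at f (N ℕ.* x))) (χ-conj x)) (sym (conj-* _ _))) ⟩
      ∑ n (λ x → conj (χ (N ℕ.* x) * at f (N ℕ.* x)))
        ≡⟨ ∑-unit N N N-inverse (λ x → cong conj (cong₂ _*_ (χ-periodic x) (periodic f x))) ⟩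
      ∑ n (λ x → conj (χ x * at f x))                           ≡⟨ κ-∑ conj conj-+ conj-0 conj-* n (λ x → χ x * at f x) ⟨
      conj (eval f)                                             ∎

    eval-ι : ∀ c → eval (ι c) ≡ c
    eval-ι c = begin
      ∑ n (λ x → χ x * (c * δ 0 x))     ≡⟨ ∑-cong n (λ x → sym (*-assoc (χ x) c (δ 0 x))) ⟩
      ∑ n (λ x → χ x * c * δ 0 x)       ≡⟨ ∑-δ 0 {λ x → χ x * c} (λ x → cong (_* c) (χ-periodic x)) ⟩
      χ 0 * c                           ≡⟨ cong (_* c) χ-0 ⟩
      1# * c                            ≡⟨ *-identityˡ c ⟩
      c                                 ∎

    eval-ψ : ∀ s t → Inverse s t → (∀ x → χ (s ℕ.* x) ≡ χ x) → ∀ f → eval (ψ s f) ≡ eval f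
    eval-ψ s t st fixed f = trans (∑-cong n (λ x → cong (_* at f (s ℕ.* x)) (sym (fixed x))))
      (∑-unit s t st (λ x → cong₂ _*_ (χ-periodic x) (periodic f x)))

    -- Evaluating A A* = ν gives `eval A * conj (eval A)` = ν ≠ 0, so a character value of A can
    -- always be cancelled.
    norm-eval : norm (eval A) ≢ 0
    norm-eval zero-norm = ν≢0 (ℤ.+-injective (begin
      + ν                          ≡⟨ re-· ν ⟨
      re ν#                        ≡⟨ cong re (trans (eval-cong A⋆A*) (eval-ι ν#)) ⟨
      re (eval (A ⋆ A *′))         ≡⟨ cong re (trans (eval-⋆ A (A *′)) (cong (eval A *_) (eval-*′ A))) ⟩
      re (eval A * conj (eval A))  ≡⟨ cong re (trans (*-conj (eval A)) (cong (_· 1#) zero-norm)) ⟩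
      re 0#                        ≡⟨ re-0 ⟩
      0ℤ                           ∎))

  trivial : Character
  trivial = record
    { χ = λ _ → 1# ; χ-periodic = λ _ → refl ; χ-+ = λ _ _ → sym (*-identityˡ 1#) ; χ-0 = refl ; χ-conj = λ _ → sym conj-1 }

  module _ (s t : ℕ) (st : Inverse s t) where

    F : Element
    F = ψ s A ⋆ A *′

    at-iterate : ∀ k f x → at (OrbitProduct.iterate groupRing (ψ s) (λ p → ext λ x → eq p (s ℕ.* x)) (ψ-⋆ s t st) k f) x ≡ at f (s ℕ.^ k ℕ.* x)
    at-iterate zero    f x = cong (at f) (sym (ℕ.+-identityʳ x))
    at-iterate (suc k) f x = trans (at-iterate k (ψ s f) x) (cong (at f) (sym (ℕ.*-assoc s (s ℕ.^ k) x)))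

    prime-power-divides : ∀ {p k} (above : PrimeAbove K p k) → Inverse s (p ℕ.^ k) → ∀ f → (s ℕ.^ suc f) % n ≡ 1 % n →
                          ∀ M u → ν# ≡ PrimeAbove.π above ^ M * u → ∀ x → ∃[ c ] at F x ≡ PrimeAbove.π above ^ M * c
    prime-power-divides {p} {k} above sq f order M u ν≡ x =
      let (D , F≈) = divides′ in at D x , trans (eq F≈ x) (trans (eq (S.*-congʳ {D} (≈-sym (ι-^ π M))) x) (ι-⋆ (π ^ M) D x))
      where
      open PrimeAbove above
      divides′ : ∃[ D ] F ≈ ι π S.^ M ⋆ D
      divides′ = OrbitProduct.multiplier-divides groupRing (ψ s) (λ p → ext λ x → eq p (s ℕ.* x)) (ψ-⋆ s t st)
        (ι π) (p ℕ.^ k) 2≤q (frobenius above s sq) f cycle (ψ-ι s t st π) cancel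
        {A} {A *′} {ι ν#} {ι u} {M} A⋆A* (ψ-ι s t st ν#)
        (≈-trans (ext λ y → cong (_* δ 0 y) ν≡) (≈-trans (ι-* (π ^ M) u) (S.*-congʳ {ι u} (ι-^ π M))))
        where
        2≤q : 2 ≤ p ℕ.^ k
        2≤q = go k 1≤k
          where
          go : ∀ k → 1 ≤ k → 2 ≤ p ℕ.^ k
          go (suc k) _ = ℕ.*-mono-≤ (ℕ.nonTrivial⇒n>1 p {{prime⇒nonTrivial p-prime}}) (ℕ.m^n>0 p {{prime⇒nonZero p-prime}} k)
        cycle : ∀ f′ → OrbitProduct.iterate groupRing (ψ s) (λ p → ext λ x → eq p (s ℕ.* x)) (ψ-⋆ s t st) (suc f) f′ ≈ f′
        cycle f′ = ext λ y → trans (at-iterate (suc f) f′ y) (periodic-≡% (periodic f′) (begin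
          (s ℕ.^ suc f ℕ.* y) % n                         ≡⟨ ℕ.%-distribˡ-* (s ℕ.^ suc f) y n ⟩
          ((s ℕ.^ suc f) % n ℕ.* (y % n)) % n             ≡⟨ cong (λ z → (z ℕ.* (y % n)) % n) order ⟩
          (1 % n ℕ.* (y % n)) % n                         ≡⟨ ℕ.%-distribˡ-* 1 y n ⟨
          (1 ℕ.* y) % n                                   ≡⟨ cong (_% n) (ℕ.*-identityˡ y) ⟩
          y % n                                           ∎))
          where open ≡-Reasoning
        cancel : ∀ {f g} → ι π ⋆ f ≈ ι π ⋆ g → f ≈ g
        cancel {f} {g} p = ext λ x → cancelˡ π norm≢0 (trans (sym (ι-⋆ π f x)) (trans (eq p x) (ι-⋆ π g x)))

    module _ (divisible : ∀ x → ∃[ c ] at F x ≡ ν# * c) where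

      E : Element
      at E x = proj₁ (divisible x)
      -- The quotients were chosen pointwise; cancelling ν shows that the choices agree along a
      -- period.
      periodic E x = cancelˡ ν# ν#≢0 (trans (sym (proj₂ (divisible (n ℕ.+ x)))) (trans (periodic F x) (proj₂ (divisible x))))

      F≈νE : F ≈ ι ν# ⋆ E
      F≈νE = ext λ x → trans (proj₂ (divisible x)) (sym (ι-⋆ ν# E x))

      cancel-ν : ∀ {f g} → ι ν# ⋆ f ≈ ι ν# ⋆ g → f ≈ g
      cancel-ν {f} {g} p = ext λ x → cancelˡ ν# ν#≢0 (trans (sym (ι-⋆ ν# f x)) (trans (eq p x) (ι-⋆ ν# g x)))

      open import Algebra.Properties.CommutativeSemigroup (CommutativeRing.*-commutativeSemigroup groupRing)
        using (x∙yz≈xz∙y) renaming (interchange to ⋆-interchange)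
      open import Relation.Binary.Reasoning.Setoid (CommutativeRing.setoid groupRing)

      F* : F *′ ≈ ψ s (A *′) ⋆ A
      F* = ≈-trans (*′-⋆ (ψ s A) (A *′)) (S.*-cong (≈-sym (ψ-*′ s A)) (*′-involutive A))

      -- Regrouping gives F F* = ψ(A A*) · A* A = ν², while F = ν E.
      νν*EE* : ι ν# ⋆ (ι ν# ⋆ (E ⋆ E *′)) ≈ ι ν# ⋆ (ι ν# ⋆ 𝟙)
      νν*EE* = begin
        ι ν# ⋆ (ι ν# ⋆ (E ⋆ E *′))             ≈⟨ ⋆-assoc (ι ν#) (ι ν#) (E ⋆ E *′) ⟨
        (ι ν# ⋆ ι ν#) ⋆ (E ⋆ E *′)             ≈⟨ ⋆-interchange (ι ν#) (ι ν#) E (E *′) ⟩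
        (ι ν# ⋆ E) ⋆ (ι ν# ⋆ E *′)             ≈⟨ S.*-congˡ {ι ν# ⋆ E} (S.*-congʳ {E *′} ν-self-conjugate) ⟩
        (ι ν# ⋆ E) ⋆ (ι ν# *′ ⋆ E *′)          ≈⟨ S.*-congˡ {ι ν# ⋆ E} (*′-⋆ (ι ν#) E) ⟨
        (ι ν# ⋆ E) ⋆ (ι ν# ⋆ E) *′             ≈⟨ S.*-cong F≈νE (*′-cong F≈νE) ⟨
        F ⋆ F *′                               ≈⟨ S.*-congˡ {F} F* ⟩
        (ψ s A ⋆ A *′) ⋆ (ψ s (A *′) ⋆ A)      ≈⟨ ⋆-interchange (ψ s A) (A *′) (ψ s (A *′)) A ⟩
        (ψ s A ⋆ ψ s (A *′)) ⋆ (A *′ ⋆ A)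
          ≈⟨ S.*-cong (≈-trans (≈-sym (ψ-⋆ s t st A (A *′))) (≈-trans (ext λ x → eq A⋆A* (s ℕ.* x)) (ψ-ι s t st ν#))) (≈-trans (⋆-comm (A *′) A) A⋆A*) ⟩
        ι ν# ⋆ ι ν#                            ≈⟨ S.*-congˡ {ι ν#} (S.*-identityʳ (ι ν#)) ⟨
        ι ν# ⋆ (ι ν# ⋆ 𝟙)                      ∎
        where
        ν-self-conjugate : ι ν# ≈ ι ν# *′
        ν-self-conjugate = ext λ x → trans (cong (_* δ 0 x) (sym (conj-· ν))) (sym (eq (*′-ι ν#) x))
        *′-cong : ∀ {f g} → f ≈ g → f *′ ≈ g *′
        *′-cong p = ext λ x → cong conj (eq p (N ℕ.* x))

      E⋆E* : E ⋆ E *′ ≈ 𝟙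
      E⋆E* = cancel-ν (cancel-ν νν*EE*)

      -- This is the coefficient of the identity in E E* = 1. Norms are natural numbers vanishing
      -- only at 0, so exactly one coefficient of E survives and E is a unit times a group element.
      norms : ℕ-∑ n (λ i → norm (at E i)) ≡ 1
      norms = ℤ.+-injective (trans (sym (re-· _)) (trans (cong re total) re-1))
        where
        index : ∀ m i → 2 ℕ.* i ℕ.* suc m ℕ.+ m ℕ.* (m ℕ.* i) ≡ suc m ℕ.* i ℕ.* suc m ℕ.+ i
        index = ℕ-Solver.solve-∀
        total : ℕ-∑ n (λ i → norm (at E i)) · 1# ≡ 1#
        total = trans (sym (∑-norm K n (λ i → norm (at E i))))
          (trans (∑-cong n (λ i → trans (sym (*-conj (at E i))) (cong (λ x → at E i * conj x) (sym (periodic-cong (periodic E) (2 ℕ.* i) (suc N ℕ.* i) (index N i))))))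
          (trans (eq E⋆E* 0) (trans (*-identityˡ _) (δ-≡ 0 0 refl))))

      private
        peak-at = ℕ-∑≡1 n {λ i → norm (at E i)} norms

      g : ℕ
      g = proj₁ peak-at

      E-monomial : E ≈ monomial (at E g) g
      E-monomial = concentrated E g (proj₁ (proj₂ peak-at)) (λ i i<n i≢g → norm≡0 (proj₂ (proj₂ peak-at) i i<n i≢g))

      -- In ψA · (A A*) = ν ψA the left side regroups to F A = ν E A; cancel ν and insert the
      -- monomial E.
      ψA : ∀ x → at A (s ℕ.* x) ≡ at E g * at A (x ℕ.+ N ℕ.* g)
      ψA x = trans (eq (cancel-ν {ψ s A} {E ⋆ A} (begin
        ι ν# ⋆ ψ s A              ≈⟨ ⋆-comm (ι ν#) (ψ s A) ⟩
        ψ s A ⋆ ι ν#              ≈⟨ S.*-congˡ {ψ s A} A⋆A* ⟨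
        ψ s A ⋆ (A ⋆ A *′)        ≈⟨ x∙yz≈xz∙y (ψ s A) A (A *′) ⟩
        F ⋆ A                     ≈⟨ S.*-congʳ {A} F≈νE ⟩
        (ι ν# ⋆ E) ⋆ A            ≈⟨ ⋆-assoc (ι ν#) E A ⟩
        ι ν# ⋆ (E ⋆ A)            ∎)) x) (trans (eq (S.*-congʳ {A} E-monomial) x) (monomial-⋆ (at E g) g A x))

      -- A character with χ(s x) = χ(x) takes the same value on ψA and on A, whereas ψA = E A
      -- multiplies that value by E(g) χ(g). The trivial character thus makes the unit E(g) equal to
      -- 1, and any further character restricts g.
      character-value : ∀ (character : Character) → let open Character character in
                        (∀ x → χ (s ℕ.* x) ≡ χ x) → at E g * χ g ≡ 1#
      character-value character fixed = sym (cancelˡ (eval A) norm-eval (trans (*-identityʳ (eval A))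
        (trans (sym (eval-ψ s t st fixed A)) (trans (∑-cong n (λ x → trans (cong (χ x *_) (ψA x)) (shuffle (χ x) (at E g) _)))
        (trans (sym (scale-∑ˡ n (at E g) (λ x → χ x * at A (x ℕ.+ N ℕ.* g))))
        (trans (cong (at E g *_) (eval-shift A g)) (trans (sym (*-assoc _ _ _)) (*-comm _ _))))))))
        where
        open Character character
        open Evaluation character
        shuffle : ∀ x y z → x * (y * z) ≡ y * (x * z)
        shuffle x y z = trans (sym (*-assoc x y z)) (trans (cong (_* z) (*-comm x y)) (*-assoc y x z))

      unit≡1 : at E g ≡ 1#
      unit≡1 = trans (sym (*-identityʳ _)) (character-value trivial (λ _ → refl))

      multiplier : ∀ x → a (s ℕ.* x) ≡ a (x ℕ.+ N ℕ.* g)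
      multiplier x = trans (ψA x) (trans (cong (_* a (x ℕ.+ N ℕ.* g)) unit≡1) (*-identityˡ _))

      character-trivial : ∀ (character : Character) → let open Character character in
                          (∀ x → χ (s ℕ.* x) ≡ χ x) → χ g ≡ 1#
      character-trivial character fixed = trans (sym (trans (cong (_* χ g) unit≡1) (*-identityˡ _))) (character-value character fixed)
        where open Character character

      -- As N stands for -1, the hypothesis says g = (t - 1) h. Since h + s x = s (x + t h), the
      -- multiplier identity moves the argument to x + t h - g, which is h + x.
      fixed-translate : ∀ h → ((t ℕ.+ N) ℕ.* h) % n ≡ g % n → ∀ x → a (h ℕ.+ s ℕ.* x) ≡ a (h ℕ.+ x)
      fixed-translate h th≡g x = trans (periodic-≡% periodic-f first)
        (trans (multiplier (x ℕ.+ t ℕ.* h)) (trans (periodic-≡% periodic-f second)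
          (periodic-cong periodic-f (2 ℕ.* h) (t ℕ.* h ℕ.+ n ℕ.* h) (index N t h x))))
        where
        expand : ∀ s t h x → s ℕ.* (x ℕ.+ t ℕ.* h) ≡ s ℕ.* x ℕ.+ h ℕ.* (s ℕ.* t)
        expand = ℕ-Solver.solve-∀
        first : (h ℕ.+ s ℕ.* x) % n ≡ (s ℕ.* (x ℕ.+ t ℕ.* h)) % n
        first = trans (cong (_% n) (trans (ℕ.+-comm h (s ℕ.* x)) (cong (s ℕ.* x ℕ.+_) (sym (ℕ.*-identityʳ h)))))
          (trans (%-congʳ-+ n (s ℕ.* x) (h ℕ.* 1) (h ℕ.* (s ℕ.* t)) (%-congʳ-* n h 1 (s ℕ.* t) (sym st)))
                 (cong (_% n) (sym (expand s t h x))))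
        second : (x ℕ.+ t ℕ.* h ℕ.+ N ℕ.* g) % n ≡ (x ℕ.+ t ℕ.* h ℕ.+ N ℕ.* ((t ℕ.+ N) ℕ.* h)) % n
        second = %-congʳ-+ n (x ℕ.+ t ℕ.* h) (N ℕ.* g) (N ℕ.* ((t ℕ.+ N) ℕ.* h)) (%-congʳ-* n N g ((t ℕ.+ N) ℕ.* h) (sym th≡g))
        index : ∀ m t h x → 2 ℕ.* h ℕ.* suc m ℕ.+ (x ℕ.+ t ℕ.* h ℕ.+ m ℕ.* ((t ℕ.+ m) ℕ.* h))
              ≡ (t ℕ.* h ℕ.+ suc m ℕ.* h) ℕ.* suc m ℕ.+ (h ℕ.+ x)
        index = ℕ-Solver.solve-∀

-- Lifting solutions through quotients

module _ {A B : Set} where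

  ∈-concatMap : ∀ {f : A → List B} {x y xs} → x ∈ xs → y ∈ f x → y ∈ concatMap f xs
  ∈-concatMap {f} x∈xs y∈fx = ∈-concatMap⁺ f (lose x∈xs y∈fx)

T-∧ : ∀ {a b} → T a → T b → T (a ∧ b)
T-∧ {true} _ tb = tb

T-∧ˡ : ∀ a {b} → T (a ∧ b) → T a
T-∧ˡ true _ = _

T-∧ʳ : ∀ a {b} → T (a ∧ b) → T b
T-∧ʳ true tb = tb

all-∈ : ∀ {A : Set} (p : A → Bool) {x xs} → T (all p xs) → x ∈ xs → T (p x)
all-∈ p {xs = xs} ok = All.lookup (All.all⁺ p xs ok)

if-true : ∀ {A : Set} b {x y : A} → T b → (if b then x else y) ≡ x
if-true true _ = refl

occurrences : ℕ → List ℕ → ℕ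
occurrences x []       = 0
occurrences x (y ∷ ys) = if x ℕ.≡ᵇ y then suc (occurrences x ys) else occurrences x ys

covers : List ℕ → List ℕ → Bool
covers ys xs = all (λ x → occurrences x ys ℕ.≡ᵇ 1) xs

occurrences-++ : ∀ x ys zs → occurrences x (ys ++ zs) ≡ occurrences x ys ℕ.+ occurrences x zs
occurrences-++ x []       zs = refl
occurrences-++ x (y ∷ ys) zs with x ℕ.≡ᵇ y
... | true  = cong suc (occurrences-++ x ys zs)
... | false = occurrences-++ x ys zs

-- Regroups a sum over points by orbit representatives with multiplicities. It is needed in two
-- monoids: for the values of a solution, giving the fibre sums, and for their norms in ℕ, giving
-- the budget.
module Tally (M : CommutativeMonoid 0ℓ 0ℓ) (g : ℕ → CommutativeMonoid.Carrier M) where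

  open CommutativeMonoid M using (Carrier; _≈_; _∙_; ε; setoid; ∙-cong; ∙-congˡ; assoc; identityˡ; identityʳ; commutativeSemigroup)
    renaming (refl to ≈-refl; sym to ≈-sym; trans to ≈-trans)
  open MonoidMult (CommutativeMonoid.monoid M) using () renaming (_×_ to _·_)
  open import Algebra.Properties.CommutativeSemigroup commutativeSemigroup using (interchange; x∙yz≈y∙xz)
  open import Relation.Binary.Reasoning.Setoid setoid
  open RangeSum M

  total : List ℕ → Carrier
  total []       = ε
  total (x ∷ xs) = g x ∙ total xs

  weighted : (ℕ → ℕ) → List ℕ → Carrier
  weighted w []       = ε
  weighted w (y ∷ ys) = w y · g y ∙ weighted w ys

  weighted-0 : ∀ ys → weighted (λ _ → 0) ys ≈ ε
  weighted-0 []       = ≈-refl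
  weighted-0 (y ∷ ys) = ≈-trans (identityˡ _) (weighted-0 ys)

  weighted-++ : ∀ w ys zs → weighted w (ys ++ zs) ≈ weighted w ys ∙ weighted w zs
  weighted-++ w []       zs = ≈-sym (identityˡ _)
  weighted-++ w (y ∷ ys) zs = ≈-trans (∙-congˡ (weighted-++ w ys zs)) (≈-sym (assoc _ _ _))

  weighted-∷ : ∀ x xs ys → weighted (λ y → occurrences y (x ∷ xs)) ys ≈ occurrences x ys · g x ∙ weighted (λ y → occurrences y xs) ys
  weighted-∷ x xs []       = ≈-sym (identityˡ _)
  -- The two occurrence counts test the equality of x and y in opposite orders, hence two tests and
  -- two contradictory cases.
  weighted-∷ x xs (y ∷ ys) with y ℕ.≡ᵇ x in y≡ᵇx | x ℕ.≡ᵇ y in x≡ᵇy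
  ... | true  | true  rewrite ℕ.≡ᵇ⇒≡ x y (subst T (sym x≡ᵇy) _) = begin
    (g y ∙ k · g y) ∙ weighted (λ z → occurrences z (y ∷ xs)) ys        ≈⟨ ∙-congˡ (weighted-∷ y xs ys) ⟩
    (g y ∙ k · g y) ∙ (occurrences y ys · g y ∙ rest)
      ≈⟨ interchange (g y) (k · g y) (occurrences y ys · g y) rest ⟩
    (g y ∙ occurrences y ys · g y) ∙ (k · g y ∙ rest)                   ∎
    where
    k    = occurrences y xs
    rest = weighted (λ z → occurrences z xs) ys
  ... | false | false = ≈-trans (∙-congˡ (weighted-∷ x xs ys)) (x∙yz≈y∙xz _ _ _)
  ... | true  | false = ⊥-elim (subst T x≡ᵇy (ℕ.≡⇒≡ᵇ x y (sym (ℕ.≡ᵇ⇒≡ y x (subst T (sym y≡ᵇx) _)))))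
  ... | false | true  = ⊥-elim (subst T y≡ᵇx (ℕ.≡⇒≡ᵇ y x (sym (ℕ.≡ᵇ⇒≡ x y (subst T (sym x≡ᵇy) _)))))

  total≈weighted : ∀ xs ys → T (covers ys xs) → total xs ≈ weighted (λ y → occurrences y xs) ys
  total≈weighted []       ys _      = ≈-sym (weighted-0 ys)
  total≈weighted (x ∷ xs) ys covered = begin
    g x ∙ total xs
      ≈⟨ ∙-cong (≈-sym once) (total≈weighted xs ys (T-∧ʳ (occurrences x ys ℕ.≡ᵇ 1) covered)) ⟩
    occurrences x ys · g x ∙ weighted (λ y → occurrences y xs) ys              ≈⟨ weighted-∷ x xs ys ⟨
    weighted (λ y → occurrences y (x ∷ xs)) ys                                 ∎
    where
    once : occurrences x ys · g x ≈ g x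
    once rewrite ℕ.≡ᵇ⇒≡ (occurrences x ys) 1 (T-∧ˡ (occurrences x ys ℕ.≡ᵇ 1) covered) = identityʳ (g x)

  total-applyUpTo : ∀ n f → total (applyUpTo f n) ≈ ∑ n (g ∘ f)
  total-applyUpTo zero    f = ≈-refl
  total-applyUpTo (suc n) f = ∙-congˡ (total-applyUpTo n (f ∘ suc))

orbit : (k s M : ℕ) .{{_ : NonZero M}} → ℕ → List ℕ
orbit zero    s M x = []
orbit (suc k) s M x = x ∷ orbit k s M ((s ℕ.* x) % M)

-- M steps go round the whole orbit, so its members share this least element. The proof relies on
-- `representative-value`, that a function constant along orbits takes the same value there; that
-- the lists of representatives fit together is left to `consistent`.
representative : (s M : ℕ) .{{_ : NonZero M}} → ℕ → ℕ
representative s M x = foldr ℕ._⊓_ x (orbit M s M x)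

module _ {A : Set} {P : ℕ → A} {s M : ℕ} .{{_ : NonZero M}} (periodic : Periodic M P) (fixed : ∀ x → P (s ℕ.* x) ≡ P x) where

  representative-value : ∀ x → P (representative s M x) ≡ P x
  representative-value x = go x (orbit M s M x) refl (orbit-value M x)
    where
    orbit-value : ∀ k x → All (λ y → P y ≡ P x) (orbit k s M x)
    orbit-value zero    x = []
    orbit-value (suc k) x = refl ∷ All.map (λ eq → trans eq (trans (periodic-% periodic _) (fixed x))) (orbit-value k _)
    go : ∀ z ys → P z ≡ P x → All (λ y → P y ≡ P x) ys → P (foldr ℕ._⊓_ z ys) ≡ P x
    go z []       Pz []         = Pz
    go z (y ∷ ys) Pz (Py ∷ Pys) = [ (λ eq → trans (cong P eq) Py) , (λ eq → trans (cong P eq) (go z ys Pz Pys)) ]′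
      (ℕ.⊓-sel y (foldr ℕ._⊓_ z ys))

fibre : (s l m : ℕ) .{{_ : NonZero (l ℕ.* m)}} → ℕ → List ℕ
fibre s l m x = applyUpTo (λ j → representative s (l ℕ.* m) ((x ℕ.+ m ℕ.* j) % (l ℕ.* m))) l

Blocks : Set
Blocks = List (ℕ × List ℕ)

-- One block for each orbit on C_m: multiplication by s carries the fibre above x to the fibre above
-- s x, so all fibres above one orbit pose the same equation.
blocks : (s l m : ℕ) .{{_ : NonZero m}} .{{_ : NonZero (l ℕ.* m)}} → Blocks
blocks s l m = map (λ x → x , arrange (fibre s l m x)) (deduplicateᵇ ℕ._≡ᵇ_ (applyUpTo (representative s m) m))
  where
  -- Representatives of multiplicity one go last: their value is forced by the others.
  arrange : List ℕ → List ℕ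
  arrange L = filterᵇ (not ∘ single) (deduplicateᵇ ℕ._≡ᵇ_ L) ++ filterᵇ single (deduplicateᵇ ℕ._≡ᵇ_ L)
    where
    single : ℕ → Bool
    single y = occurrences y L ℕ.≡ᵇ 1

representatives : (s M : ℕ) .{{_ : NonZero M}} → List ℕ
representatives s M = applyUpTo (representative s M) M

-- The orbit combinatorics is verified by evaluation for the few moduli that occur. Since `covers`
-- asks for exactly one occurrence, no orbit is left out and none is charged to the budget twice.
consistent : (s l m : ℕ) .{{_ : NonZero (l ℕ.* m)}} → Blocks → Bool
consistent s l m bs = all (λ (x , ys) → (x ℕ.<ᵇ m) ∧ covers ys (fibre s l m x)) bs
                    ∧ covers (concatMap proj₂ bs) (representatives s (l ℕ.* m))

-- The exhaustive search

module Search (K : Coefficients) where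

  open Coefficients K

  Assignment : Set
  Assignment = List (ℕ × Carrier)

  isZero : Carrier → Bool
  isZero z = norm z ℕ.≡ᵇ 0

  value : ℕ → Assignment → Carrier
  value x []            = 0#
  value x ((y , z) ∷ e) = if x ℕ.≡ᵇ y then z else value x e

  nth : List Carrier → ℕ → Carrier
  nth []       _       = 0#
  nth (z ∷ zs) zero    = z
  nth (z ∷ zs) (suc n) = nth zs n

  -- shells lists the admissible values by norm; a value of norm e taken on an orbit of
  -- size w uses e w of the budget.
  choices : List (List Carrier) → ℕ → ℕ → List (Carrier × ℕ)
  choices []               w budget = []
  choices (shell ∷ shells) w budget = map (_, budget) shell ++ (if w ℕ.≤ᵇ budget then choices shells w (budget ℕ.∸ w) else [])

  forced : (Carrier → Bool) → ℕ → ℕ → Carrier → List (Carrier × ℕ)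
  forced allowed w budget z = if allowed z ∧ (norm z ℕ.* w ℕ.≤ᵇ budget) then (z , budget ℕ.∸ norm z ℕ.* w) ∷ [] else []

  -- An orbit representative y with its multiplicity μ in the fibre and the size w of its orbit.
  Unknown : Set
  Unknown = ℕ × ℕ × ℕ

  module _ (allowed : Carrier → Bool) (shells : List (List Carrier)) where

    candidates : ℕ → ℕ → Bool → Carrier → ℕ → List (Carrier × ℕ)
    candidates μ w isLast target budget =
      if isLast ∧ (μ ℕ.≡ᵇ 1) then forced allowed w budget target else choices shells w budget

    assign : List Unknown → Carrier → Assignment → ℕ → List (Assignment × ℕ)
    assign []                 target e budget = if isZero target then (e , budget) ∷ [] else []
    assign ((y , μ , w) ∷ us) target e budget =
      concatMap (λ (z , rest) → assign us (target - (μ · z)) ((y , z) ∷ e) rest)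
                (candidates μ w (null us) target budget)

    fill : List (ℕ × List Unknown) → (ℕ → Carrier) → Assignment → ℕ → List Assignment
    -- The budget has to be used up exactly, because the norms of all coefficients sum to n.
    fill []              F e budget = if budget ℕ.≡ᵇ 0 then e ∷ [] else []
    fill ((x , us) ∷ bs) F e budget =
      concatMap (λ (e′ , rest) → fill bs F e′ rest) (assign us (F x) e budget)

  dot : List Carrier → List Carrier → Carrier
  dot (x ∷ xs) (y ∷ ys) = x * conj y + dot xs ys
  dot _        _        = 0#

  -- Shifts up to M / 2 are enough, as the correlations at d and M - d are conjugate; shift 0 is
  -- accounted for by the budget.
  orthogonal : ℕ → List Carrier → Bool
  orthogonal M zs = all (λ d → isZero (dot (drop (suc d) zs ++ take (suc d) zs) zs)) (upTo (M / 2))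

  module _ (n s : ℕ) (box : List Carrier) where

    shells : (Carrier → Bool) → List (List Carrier)
    shells allowed = applyUpTo (λ e → filterᵇ (λ z → allowed z ∧ (norm z ℕ.≡ᵇ e)) box) (suc n)

    unknowns : (l m : ℕ) .{{_ : NonZero (l ℕ.* m)}} → Blocks → List (ℕ × List Unknown)
    unknowns l m = map λ (x , ys) → x , map (λ y → y , occurrences y (fibre s l m x) , occurrences y (representatives s (l ℕ.* m))) ys

    lifts : (l m : ℕ) .{{_ : NonZero (l ℕ.* m)}} → Blocks → (Carrier → Bool) → List (List Carrier) → List (List Carrier)
    lifts l m bs allowed sols = go (shells allowed) (unknowns l m bs) (representatives s (l ℕ.* m))
      where
      go : List (List Carrier) → List (ℕ × List Unknown) → List ℕ → List (List Carrier)
      go shells us reps = filterᵇ (orthogonal (l ℕ.* m)) (concatMap (λ sol →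
        map (λ e → map (λ r → value r e) reps) (fill allowed shells us (nth sol) [] n)) sols)

    start : List (List Carrier)
    start = map (_∷ []) (filterᵇ (λ z → norm z ℕ.≡ᵇ n) box)

-- The integers and the imaginary quadratic orders

square-abs : ∀ i → i ℤ.* i ≡ + (∣ i ∣ ℕ.* ∣ i ∣)
square-abs (+ m)    = sym (ℤ.pos-* m m)
square-abs -[1+ m ] = refl

integers : Coefficients
integers = record
  { Carrier = ℤ ; _+_ = ℤ._+_ ; _*_ = ℤ._*_ ; -_ = ℤ.-_ ; 0# = 0ℤ ; 1# = 1ℤ
  ; isCommutativeRing = ℤ.+-*-isCommutativeRing
  ; conj = id ; conj-+ = λ _ _ → refl ; conj-* = λ _ _ → refl ; conj-1 = refl ; conj-involutive = λ _ → refl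
  ; re = id ; re-+ = λ _ _ → refl ; re-0 = refl ; re-1 = refl
  ; norm = λ i → ∣ i ∣ ℕ.* ∣ i ∣
  ; norm≡0 = λ {i} eq → ℤ.∣i∣≡0⇒i≡0 ([ id , id ]′ (ℕ.m*n≡0⇒m≡0∨n≡0 ∣ i ∣ eq))
  ; *-conj = λ i → trans (square-abs i) (sym (n·1 (∣ i ∣ ℕ.* ∣ i ∣)))
  ; torsion-free = λ m {i} eq → [ (λ ()) , id ]′ (ℤ.i*j≡0⇒i≡0∨j≡0 (+ suc m) (trans (sym (n·i (suc m) i)) eq))
  }
  where
  open Mult ℤ.+-*-semiring using () renaming (_×_ to _·_)
  n·1 : ∀ m → m · 1ℤ ≡ + m
  n·1 zero    = refl
  n·1 (suc m) = cong (λ z → 1ℤ ℤ.+ z) (n·1 m)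
  n·i : ∀ m i → m · i ≡ + m ℤ.* i
  n·i zero    i = refl
  n·i (suc m) i = trans (cong (λ z → i ℤ.+ z) (n·i m i)) (sym (ℤ.suc-* (+ m) i))

-- The order ℤ[θ] with θ² = pθ + q; the pair (a , b) stands for a + bθ.
module Quadratic (p q : ℤ) (d : ℕ) (discriminant : p ℤ.* p ℤ.+ + 4 ℤ.* q ≡ -[1+ d ]) where

  infixl 7 _*_
  infixl 6 _+_

  _+_ _*_ : Op₂ (ℤ × ℤ)
  (a , b) + (a′ , b′) = a ℤ.+ a′ , b ℤ.+ b′
  (a , b) * (a′ , b′) = a ℤ.* a′ ℤ.+ q ℤ.* (b ℤ.* b′) , a ℤ.* b′ ℤ.+ b ℤ.* a′ ℤ.+ p ℤ.* (b ℤ.* b′)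

  -_ conj : Op₁ (ℤ × ℤ)
  - (a , b) = ℤ.- a , ℤ.- b
  conj (a , b) = a ℤ.+ p ℤ.* b , ℤ.- b

  form : ℤ → ℤ → ℤ
  form a b = a ℤ.* a ℤ.+ p ℤ.* (a ℤ.* b) ℤ.- q ℤ.* (b ℤ.* b)

  norm : ℤ × ℤ → ℕ
  norm (a , b) = ∣ form a b ∣

  +-*-isCommutativeRing : IsCommutativeRing _≡_ _+_ _*_ -_ (0ℤ , 0ℤ) (1ℤ , 0ℤ)
  +-*-isCommutativeRing = record
    { isRing = record
      { +-isAbelianGroup = record
        { isGroup = record
          { isMonoid = record
            { isSemigroup = record
              { isMagma = record { isEquivalence = isEquivalence ; ∙-cong = cong₂ _+_ }
              ; assoc = λ (a , b) (c , e) (g , h) → cong₂ _,_ (ℤ.+-assoc a c g) (ℤ.+-assoc b e h) }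
            ; identity = (λ (a , b) → cong₂ _,_ (ℤ.+-identityˡ a) (ℤ.+-identityˡ b))
                       , (λ (a , b) → cong₂ _,_ (ℤ.+-identityʳ a) (ℤ.+-identityʳ b)) }
          ; inverse = (λ (a , b) → cong₂ _,_ (ℤ.+-inverseˡ a) (ℤ.+-inverseˡ b))
                    , (λ (a , b) → cong₂ _,_ (ℤ.+-inverseʳ a) (ℤ.+-inverseʳ b))
          ; ⁻¹-cong = cong -_ }
        ; comm = λ (a , b) (c , e) → cong₂ _,_ (ℤ.+-comm a c) (ℤ.+-comm b e) }
      ; *-cong = cong₂ _*_
      ; *-assoc = λ (a , b) (c , e) (g , h) → cong₂ _,_ (assoc₁ p q a b c e g h) (assoc₂ p q a b c e g h)
      ; *-identity = (λ (a , b) → cong₂ _,_ (idˡ₁ q a b) (idˡ₂ p a b)) , (λ (a , b) → cong₂ _,_ (idʳ₁ q a b) (idʳ₂ p a b))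
      ; distrib = (λ (a , b) (c , e) (g , h) → cong₂ _,_ (distribˡ₁ q a b c e g h) (distribˡ₂ p a b c e g h))
                , (λ (a , b) (c , e) (g , h) → cong₂ _,_ (distribʳ₁ q a b c e g h) (distribʳ₂ p a b c e g h)) }
    ; *-comm = λ (a , b) (c , e) → cong₂ _,_ (comm₁ q a b c e) (comm₂ p a b c e) }
    where
    open import Data.Integer.Base using () renaming (_+_ to _⊕_; _*_ to _⊛_)
    assoc₁ : ∀ p q a b c e g h → (a ⊛ c ⊕ q ⊛ (b ⊛ e)) ⊛ g ⊕ q ⊛ ((a ⊛ e ⊕ b ⊛ c ⊕ p ⊛ (b ⊛ e)) ⊛ h)
           ≡ a ⊛ (c ⊛ g ⊕ q ⊛ (e ⊛ h)) ⊕ q ⊛ (b ⊛ (c ⊛ h ⊕ e ⊛ g ⊕ p ⊛ (e ⊛ h)))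
    assoc₁ = ℤ-Solver.solve-∀
    assoc₂ : ∀ p q a b c e g h → (a ⊛ c ⊕ q ⊛ (b ⊛ e)) ⊛ h ⊕ (a ⊛ e ⊕ b ⊛ c ⊕ p ⊛ (b ⊛ e)) ⊛ g ⊕ p ⊛ ((a ⊛ e ⊕ b ⊛ c ⊕ p ⊛ (b ⊛ e)) ⊛ h)
           ≡ a ⊛ (c ⊛ h ⊕ e ⊛ g ⊕ p ⊛ (e ⊛ h)) ⊕ b ⊛ (c ⊛ g ⊕ q ⊛ (e ⊛ h)) ⊕ p ⊛ (b ⊛ (c ⊛ h ⊕ e ⊛ g ⊕ p ⊛ (e ⊛ h)))
    assoc₂ = ℤ-Solver.solve-∀
    idˡ₁ : ∀ q a b → 1ℤ ⊛ a ⊕ q ⊛ (0ℤ ⊛ b) ≡ a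
    idˡ₁ = ℤ-Solver.solve-∀
    idˡ₂ : ∀ p a b → 1ℤ ⊛ b ⊕ 0ℤ ⊛ a ⊕ p ⊛ (0ℤ ⊛ b) ≡ b
    idˡ₂ = ℤ-Solver.solve-∀
    idʳ₁ : ∀ q a b → a ⊛ 1ℤ ⊕ q ⊛ (b ⊛ 0ℤ) ≡ a
    idʳ₁ = ℤ-Solver.solve-∀
    idʳ₂ : ∀ p a b → a ⊛ 0ℤ ⊕ b ⊛ 1ℤ ⊕ p ⊛ (b ⊛ 0ℤ) ≡ b
    idʳ₂ = ℤ-Solver.solve-∀
    distribˡ₁ : ∀ q a b c e g h → a ⊛ (c ⊕ g) ⊕ q ⊛ (b ⊛ (e ⊕ h)) ≡ (a ⊛ c ⊕ q ⊛ (b ⊛ e)) ⊕ (a ⊛ g ⊕ q ⊛ (b ⊛ h))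
    distribˡ₁ = ℤ-Solver.solve-∀
    distribˡ₂ : ∀ p a b c e g h → a ⊛ (e ⊕ h) ⊕ b ⊛ (c ⊕ g) ⊕ p ⊛ (b ⊛ (e ⊕ h))
              ≡ (a ⊛ e ⊕ b ⊛ c ⊕ p ⊛ (b ⊛ e)) ⊕ (a ⊛ h ⊕ b ⊛ g ⊕ p ⊛ (b ⊛ h))
    distribˡ₂ = ℤ-Solver.solve-∀
    distribʳ₁ : ∀ q a b c e g h → (c ⊕ g) ⊛ a ⊕ q ⊛ ((e ⊕ h) ⊛ b) ≡ (c ⊛ a ⊕ q ⊛ (e ⊛ b)) ⊕ (g ⊛ a ⊕ q ⊛ (h ⊛ b))
    distribʳ₁ = ℤ-Solver.solve-∀
    distribʳ₂ : ∀ p a b c e g h → (c ⊕ g) ⊛ b ⊕ (e ⊕ h) ⊛ a ⊕ p ⊛ ((e ⊕ h) ⊛ b)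
              ≡ (c ⊛ b ⊕ e ⊛ a ⊕ p ⊛ (e ⊛ b)) ⊕ (g ⊛ b ⊕ h ⊛ a ⊕ p ⊛ (h ⊛ b))
    distribʳ₂ = ℤ-Solver.solve-∀
    comm₁ : ∀ q a b c e → a ⊛ c ⊕ q ⊛ (b ⊛ e) ≡ c ⊛ a ⊕ q ⊛ (e ⊛ b)
    comm₁ = ℤ-Solver.solve-∀
    comm₂ : ∀ p a b c e → a ⊛ e ⊕ b ⊛ c ⊕ p ⊛ (b ⊛ e) ≡ c ⊛ b ⊕ e ⊛ a ⊕ p ⊛ (e ⊛ b)
    comm₂ = ℤ-Solver.solve-∀

  private
    module +-* where
      commutativeRing : CommutativeRing 0ℓ 0ℓ
      commutativeRing = record { isCommutativeRing = +-*-isCommutativeRing }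
      open CommutativeRing commutativeRing public using (semiring)
      open Mult semiring public using () renaming (_×_ to _·_)

    n·1 : ∀ m → m +-*.· (1ℤ , 0ℤ) ≡ (+ m , 0ℤ)
    n·1 zero    = refl
    n·1 (suc m) = cong (λ z → (1ℤ , 0ℤ) + z) (n·1 m)

    n·x : ∀ m a b → m +-*.· (a , b) ≡ (+ m ℤ.* a , + m ℤ.* b)
    n·x zero    a b = refl
    n·x (suc m) a b = trans (cong (λ z → (a , b) + z) (n·x m a b))
      (cong₂ _,_ (sym (ℤ.suc-* (+ m) a)) (sym (ℤ.suc-* (+ m) b)))

    -- Completing the square with discriminant -(d + 1) shows that the form is positive definite. So
    -- the absolute value in `norm` changes nothing, and the b-term alone bounds b.
    4*form : ∀ a b → + 4 ℤ.* form a b ≡ + (∣ + 2 ℤ.* a ℤ.+ p ℤ.* b ∣ ℕ.* ∣ + 2 ℤ.* a ℤ.+ p ℤ.* b ∣ ℕ.+ suc d ℕ.* (∣ b ∣ ℕ.* ∣ b ∣))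
    4*form a b = begin
      + 4 ℤ.* form a b                                                     ≡⟨ complete-square p q a b ⟩
      c ℤ.* c ℤ.- (p ℤ.* p ℤ.+ + 4 ℤ.* q) ℤ.* (b ℤ.* b)
        ≡⟨ cong (λ D → c ℤ.* c ℤ.- D ℤ.* (b ℤ.* b)) discriminant ⟩
      c ℤ.* c ℤ.- -[1+ d ] ℤ.* (b ℤ.* b)
        ≡⟨ cong (λ z → c ℤ.* c ℤ.+ z) (ℤ.neg-distribˡ-* -[1+ d ] (b ℤ.* b)) ⟩
      c ℤ.* c ℤ.+ + suc d ℤ.* (b ℤ.* b)
        ≡⟨ cong₂ (λ x y → x ℤ.+ + suc d ℤ.* y) (square-abs c) (square-abs b) ⟩
      + (∣ c ∣ ℕ.* ∣ c ∣) ℤ.+ + suc d ℤ.* + (∣ b ∣ ℕ.* ∣ b ∣)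
        ≡⟨ cong (λ z → + (∣ c ∣ ℕ.* ∣ c ∣) ℤ.+ z) (sym (ℤ.pos-* (suc d) (∣ b ∣ ℕ.* ∣ b ∣))) ⟩
      + (∣ c ∣ ℕ.* ∣ c ∣ ℕ.+ suc d ℕ.* (∣ b ∣ ℕ.* ∣ b ∣))                  ∎
      where
      open ≡-Reasoning
      c = + 2 ℤ.* a ℤ.+ p ℤ.* b
      complete-square : ∀ p q a b → + 4 ℤ.* (a ℤ.* a ℤ.+ p ℤ.* (a ℤ.* b) ℤ.- q ℤ.* (b ℤ.* b))
        ≡ (+ 2 ℤ.* a ℤ.+ p ℤ.* b) ℤ.* (+ 2 ℤ.* a ℤ.+ p ℤ.* b) ℤ.- (p ℤ.* p ℤ.+ + 4 ℤ.* q) ℤ.* (b ℤ.* b)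
      complete-square = ℤ-Solver.solve-∀

    4*i≡+m⇒+∣i∣≡i : ∀ i {m} → + 4 ℤ.* i ≡ + m → + ∣ i ∣ ≡ i
    4*i≡+m⇒+∣i∣≡i (+ i)    _  = refl
    4*i≡+m⇒+∣i∣≡i -[1+ i ] ()

    +norm : ∀ a b → + norm (a , b) ≡ form a b
    +norm a b = 4*i≡+m⇒+∣i∣≡i (form a b) (4*form a b)

    norm≡0 : ∀ {x} → norm x ≡ 0 → x ≡ (0ℤ , 0ℤ)
    norm≡0 {a , b} eq = cong₂ _,_ a≡0 b≡0
      where
      sum≡0 : ∣ + 2 ℤ.* a ℤ.+ p ℤ.* b ∣ ℕ.* ∣ + 2 ℤ.* a ℤ.+ p ℤ.* b ∣ ℕ.+ suc d ℕ.* (∣ b ∣ ℕ.* ∣ b ∣) ≡ 0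
      sum≡0 = ℤ.+-injective (trans (sym (4*form a b)) (trans (cong (+ 4 ℤ.*_) (sym (+norm a b))) (cong (λ m → + 4 ℤ.* + m) eq)))
      b≡0 : b ≡ 0ℤ
      b≡0 = ℤ.∣i∣≡0⇒i≡0 ([ id , id ]′ (ℕ.m*n≡0⇒m≡0∨n≡0 ∣ b ∣
        ([ (λ ()) , id ]′ (ℕ.m*n≡0⇒m≡0∨n≡0 (suc d) (ℕ.m+n≡0⇒n≡0 (∣ + 2 ℤ.* a ℤ.+ p ℤ.* b ∣ ℕ.* _) sum≡0)))))
      2a≡0 : + 2 ℤ.* a ≡ 0ℤ
      2a≡0 = begin
        + 2 ℤ.* a                    ≡⟨ ℤ.+-identityʳ _ ⟨
        + 2 ℤ.* a ℤ.+ 0ℤ             ≡⟨ cong (λ z → + 2 ℤ.* a ℤ.+ z) (trans (cong (p ℤ.*_) b≡0) (ℤ.*-zeroʳ p)) ⟨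
        + 2 ℤ.* a ℤ.+ p ℤ.* b
          ≡⟨ ℤ.∣i∣≡0⇒i≡0 ([ id , id ]′ (ℕ.m*n≡0⇒m≡0∨n≡0 ∣ + 2 ℤ.* a ℤ.+ p ℤ.* b ∣ (ℕ.m+n≡0⇒m≡0 _ sum≡0))) ⟩
        0ℤ                           ∎
        where open ≡-Reasoning
      a≡0 : a ≡ 0ℤ
      a≡0 = [ (λ ()) , id ]′ (ℤ.i*j≡0⇒i≡0∨j≡0 (+ 2) 2a≡0)

  norm-bound : ∀ a b → suc d ℕ.* (∣ b ∣ ℕ.* ∣ b ∣) ≤ 4 ℕ.* norm (a , b)
  norm-bound a b = ℕ.≤-trans (ℕ.m≤n+m _ (∣ + 2 ℤ.* a ℤ.+ p ℤ.* b ∣ ℕ.* ∣ + 2 ℤ.* a ℤ.+ p ℤ.* b ∣)) (ℕ.≤-reflexive (sym (ℤ.+-injective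
    (trans (ℤ.pos-* 4 (norm (a , b))) (trans (cong (+ 4 ℤ.*_) (+norm a b)) (4*form a b))))))

  quadratic : Coefficients
  quadratic = record
    { Carrier = ℤ × ℤ ; _+_ = _+_ ; _*_ = _*_ ; -_ = -_ ; 0# = 0ℤ , 0ℤ ; 1# = 1ℤ , 0ℤ
    ; isCommutativeRing = +-*-isCommutativeRing
    ; conj = conj
    ; conj-+ = λ (a , b) (c , e) → cong₂ _,_ (conj-+₁ p a b c e) (ℤ.neg-distrib-+ b e)
    ; conj-* = λ (a , b) (c , e) → cong₂ _,_ (conj-*₁ p q a b c e) (conj-*₂ p a b c e)
    ; conj-1 = cong (_, 0ℤ) (trans (cong (λ z → 1ℤ ℤ.+ z) (ℤ.*-zeroʳ p)) refl)
    ; conj-involutive = λ (a , b) → cong₂ _,_ (involutive p a b) (ℤ.neg-involutive b)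
    ; re = proj₁ ; re-+ = λ _ _ → refl ; re-0 = refl ; re-1 = refl
    ; norm = norm ; norm≡0 = norm≡0
    ; *-conj = λ (a , b) → trans (cong₂ _,_ (trans (*-conj₁ p q a b) (sym (+norm a b))) (*-conj₂ p a b)) (sym (n·1 (norm (a , b))))
    ; torsion-free = λ m {(a , b)} eq → let eq′ = trans (sym (n·x (suc m) a b)) eq in
        cong₂ _,_ (cancel m a (cong proj₁ eq′)) (cancel m b (cong proj₂ eq′))
    }
    where
    cancel : ∀ m i → + suc m ℤ.* i ≡ 0ℤ → i ≡ 0ℤ
    cancel m i eq = [ (λ ()) , id ]′ (ℤ.i*j≡0⇒i≡0∨j≡0 (+ suc m) eq)
    conj-+₁ : ∀ p a b c e → a ℤ.+ c ℤ.+ p ℤ.* (b ℤ.+ e) ≡ a ℤ.+ p ℤ.* b ℤ.+ (c ℤ.+ p ℤ.* e)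
    conj-+₁ = ℤ-Solver.solve-∀
    conj-*₁ : ∀ p q a b c e → a ℤ.* c ℤ.+ q ℤ.* (b ℤ.* e) ℤ.+ p ℤ.* (a ℤ.* e ℤ.+ b ℤ.* c ℤ.+ p ℤ.* (b ℤ.* e))
            ≡ (a ℤ.+ p ℤ.* b) ℤ.* (c ℤ.+ p ℤ.* e) ℤ.+ q ℤ.* (ℤ.- b ℤ.* ℤ.- e)
    conj-*₁ = ℤ-Solver.solve-∀
    conj-*₂ : ∀ p a b c e → ℤ.- (a ℤ.* e ℤ.+ b ℤ.* c ℤ.+ p ℤ.* (b ℤ.* e))
            ≡ (a ℤ.+ p ℤ.* b) ℤ.* ℤ.- e ℤ.+ ℤ.- b ℤ.* (c ℤ.+ p ℤ.* e) ℤ.+ p ℤ.* (ℤ.- b ℤ.* ℤ.- e)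
    conj-*₂ = ℤ-Solver.solve-∀
    involutive : ∀ p a b → a ℤ.+ p ℤ.* b ℤ.+ p ℤ.* ℤ.- b ≡ a
    involutive = ℤ-Solver.solve-∀
    *-conj₁ : ∀ p q a b → a ℤ.* (a ℤ.+ p ℤ.* b) ℤ.+ q ℤ.* (b ℤ.* ℤ.- b) ≡ a ℤ.* a ℤ.+ p ℤ.* (a ℤ.* b) ℤ.- q ℤ.* (b ℤ.* b)
    *-conj₁ = ℤ-Solver.solve-∀
    *-conj₂ : ∀ p a b → a ℤ.* ℤ.- b ℤ.+ b ℤ.* (a ℤ.+ p ℤ.* b) ℤ.+ p ℤ.* (b ℤ.* ℤ.- b) ≡ 0ℤ
    *-conj₂ = ℤ-Solver.solve-∀

gaussian eisenstein : Coefficients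
gaussian   = Quadratic.quadratic 0ℤ -1ℤ 3 refl
eisenstein = Quadratic.quadratic -1ℤ -1ℤ 2 refl

-- Completeness of the search

ℕ-∑≥ : ∀ m {f} i → i < m → f i ≤ ℕ-∑ m f
ℕ-∑≥ (suc m) {f} zero    _         = ℕ.m≤m+n (f 0) _
ℕ-∑≥ (suc m) {f} (suc i) (s≤s i<m) = ℕ.≤-trans (ℕ-∑≥ m i i<m) (ℕ.m≤n+m _ (f 0))

applyUpTo-cong : ∀ {A : Set} n {f g : ℕ → A} → (∀ i → i < n → f i ≡ g i) → applyUpTo f n ≡ applyUpTo g n
applyUpTo-cong zero    _   = refl
applyUpTo-cong (suc n) f≗g = cong₂ _∷_ (f≗g 0 (s≤s z≤n)) (applyUpTo-cong n (λ i i<n → f≗g (suc i) (s≤s i<n)))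

applyUpTo-++ : ∀ {A : Set} m n (f : ℕ → A) → applyUpTo f m ++ applyUpTo (λ i → f (m ℕ.+ i)) n ≡ applyUpTo f (m ℕ.+ n)
applyUpTo-++ zero    n f = refl
applyUpTo-++ (suc m) n f = cong (f 0 ∷_) (applyUpTo-++ m n (f ∘ suc))

drop-applyUpTo : ∀ {A : Set} m n (f : ℕ → A) → drop m (applyUpTo f (m ℕ.+ n)) ≡ applyUpTo (λ i → f (m ℕ.+ i)) n
drop-applyUpTo zero    n f = refl
drop-applyUpTo (suc m) n f = drop-applyUpTo m n (f ∘ suc)

take-applyUpTo : ∀ {A : Set} m n (f : ℕ → A) → take m (applyUpTo f (m ℕ.+ n)) ≡ applyUpTo f m
take-applyUpTo zero    n f = refl
take-applyUpTo (suc m) n f = cong (f 0 ∷_) (take-applyUpTo m n (f ∘ suc))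

occurrences⇒∈ : ∀ x ys → T (occurrences x ys ℕ.≡ᵇ 1) → x ∈ ys
occurrences⇒∈ x (y ∷ ys) once with x ℕ.≡ᵇ y in x≡ᵇy
... | true  = here (ℕ.≡ᵇ⇒≡ x y (subst T (sym x≡ᵇy) _))
... | false = there (occurrences⇒∈ x ys once)

×≡* : ∀ m x → MonoidMult._×_ (CommutativeMonoid.monoid ℕ.+-0-commutativeMonoid) m x ≡ x ℕ.* m
×≡* zero    x = sym (ℕ.*-zeroʳ x)
×≡* (suc m) x = trans (cong (x ℕ.+_) (×≡* m x)) (sym (ℕ.*-suc x m))

-- The lemmas have one pattern: the choices made by an actual solution `P` occur in the list
-- produced at that stage of the search, so nothing is missed.
module Soundness (K : Coefficients) (n s : ℕ) (box : List (Coefficients.Carrier K))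
                 (box-complete : ∀ z → Coefficients.norm K z ≤ n → z ∈ box) where

  open Coefficients K
  open RangeSum +-commutativeMonoid
  open Search K

  choices-sound : ∀ (S : ℕ → List Carrier) N e w rest {z} → e < N → z ∈ S e →
                  (z , rest) ∈ choices (applyUpTo S N) w (e ℕ.* w ℕ.+ rest)
  choices-sound S (suc N) zero    w rest _         z∈ = ∈-++⁺ˡ (∈-map⁺ (_, rest) z∈)
  choices-sound S (suc N) (suc e) w rest {z} (s≤s e<N) z∈ = ∈-++⁺ʳ (map (_, budget) (S 0))
    (subst ((z , rest) ∈_) (sym (if-true (w ℕ.≤ᵇ budget) (ℕ.≤⇒≤ᵇ (ℕ.≤-trans (ℕ.m≤m+n w (e ℕ.* w)) (ℕ.m≤m+n _ rest)))))
      (subst (λ b → (z , rest) ∈ choices (applyUpTo (S ∘ suc) N) w b)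
        (sym (trans (cong (ℕ._∸ w) (ℕ.+-assoc w (e ℕ.* w) rest)) (ℕ.m+n∸m≡n w (e ℕ.* w ℕ.+ rest))))
        (choices-sound (S ∘ suc) N e w rest e<N z∈)))
    where budget = suc e ℕ.* w ℕ.+ rest

  module Lift (l m : ℕ) .{{_ : NonZero (l ℕ.* m)}} (allowed : Carrier → Bool)
              (P : ℕ → Carrier) (perfect : Perfect K (l ℕ.* m) n P)
              (fixed : ∀ x → P (s ℕ.* x) ≡ P x) (allowed-P : ∀ x → T (allowed (P x))) where

    private
      M = l ℕ.* m
      open Perfect perfect
      module TK = Tally +-commutativeMonoid P
      module Tℕ = Tally ℕ.+-0-commutativeMonoid (norm ∘ P)

      energy : ℕ-∑ M (norm ∘ P) ≡ n
      energy = ℤ.+-injective (trans (sym (re-· _)) (trans (cong re total) (re-· n)))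
        where
        total : ℕ-∑ M (norm ∘ P) · 1# ≡ n · 1#
        total = trans (sym (∑-norm K M (norm ∘ P))) (trans (∑-cong M (λ i → sym (*-conj (P i)))) peak)

      norm≤n : ∀ x → norm (P x) ≤ n
      norm≤n x = subst (_≤ n) (cong norm (periodic-% periodic-f x))
        (ℕ.≤-trans (ℕ-∑≥ M {norm ∘ P} (x % M) (ℕ.m%n<n x M)) (ℕ.≤-reflexive energy))

      shell∋ : ∀ x → P x ∈ filterᵇ (λ z → allowed z ∧ (norm z ℕ.≡ᵇ norm (P x))) box
      shell∋ x = ∈-filter⁺ (T? ∘ λ z → allowed z ∧ (norm z ℕ.≡ᵇ norm (P x))) (box-complete (P x) (norm≤n x))
        (T-∧ (allowed-P x) (ℕ.≡⇒≡ᵇ (norm (P x)) (norm (P x)) refl))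

      candidates-sound : ∀ {A : Set} μ w y (us : List A) rest target → (T (null us ∧ (μ ℕ.≡ᵇ 1)) → target ≡ P y) →
        (P y , rest) ∈ candidates allowed (shells n s box allowed) μ w (null us) target (norm (P y) ℕ.* w ℕ.+ rest)
      candidates-sound μ w y us rest target forced-value with null us ∧ (μ ℕ.≡ᵇ 1)
      ... | false = choices-sound (λ e → filterᵇ (λ z → allowed z ∧ (norm z ℕ.≡ᵇ e)) box) (suc n) (norm (P y)) w rest (s≤s (norm≤n y)) (shell∋ y)
      ... | true rewrite forced-value _ = subst ((P y , rest) ∈_)
        (sym (if-true (allowed (P y) ∧ (norm (P y) ℕ.* w ℕ.≤ᵇ budget)) (T-∧ (allowed-P y) (ℕ.≤⇒≤ᵇ (ℕ.m≤m+n (norm (P y) ℕ.* w) rest)))))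
        (here (cong (P y ,_) (sym (ℕ.m+n∸m≡n (norm (P y) ℕ.* w) rest))))
        where budget = norm (P y) ℕ.* w ℕ.+ rest

      extend : List ℕ → Assignment → Assignment
      extend []       e = e
      extend (y ∷ ys) e = extend ys ((y , P y) ∷ e)

      -- Target and budget are expressed by what `P` still contributes on ys, plus `rest`. Each
      -- choice then removes just the first summand, which is what the subtractions in `assign`
      -- compute.
      assign-sound : ∀ (μ w : ℕ → ℕ) ys e rest →
        (extend ys e , rest) ∈ assign allowed (shells n s box allowed) (map (λ y → y , μ y , w y) ys) (TK.weighted μ ys) e (Tℕ.weighted w ys ℕ.+ rest)
      assign-sound μ w []       e rest = subst ((e , rest) ∈_) (sym (if-true (isZero 0#) (ℕ.≡⇒≡ᵇ (norm 0#) 0 norm-0))) (here refl)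
      assign-sound μ w (y ∷ ys) e rest = ∈-concatMap {x = P y , Tℕ.weighted w ys ℕ.+ rest}
        (subst (λ b → (P y , Tℕ.weighted w ys ℕ.+ rest) ∈ candidates allowed (shells n s box allowed) (μ y) (w y) (null us) (TK.weighted μ (y ∷ ys)) b)
          (sym (trans (cong (λ z → z ℕ.+ Tℕ.weighted w ys ℕ.+ rest) (×≡* (w y) (norm (P y)))) (ℕ.+-assoc (norm (P y) ℕ.* w y) _ rest)))
          (candidates-sound (μ y) (w y) y us _ _ (forced-value ys)))
        (subst (λ target → (extend ys ((y , P y) ∷ e) , rest) ∈ assign allowed (shells n s box allowed) us target ((y , P y) ∷ e) (Tℕ.weighted w ys ℕ.+ rest))
          (sym remaining) (assign-sound μ w ys ((y , P y) ∷ e) rest))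
        where
        us = map (λ y → y , μ y , w y) ys
        remaining : TK.weighted μ (y ∷ ys) - (μ y · P y) ≡ TK.weighted μ ys
        remaining = trans (cong (_- (μ y · P y)) (+-comm (μ y · P y) _)) (trans (+-assoc _ _ _)
          (trans (cong (λ z → TK.weighted μ ys + z) (-‿inverseʳ (μ y · P y))) (+-identityʳ _)))
        forced-value : ∀ ys → T (null (map (λ y → y , μ y , w y) ys) ∧ (μ y ℕ.≡ᵇ 1)) → μ y · P y + TK.weighted μ ys ≡ P y
        forced-value [] μ≡1 rewrite ℕ.≡ᵇ⇒≡ (μ y) 1 μ≡1 = trans (+-identityʳ _) (+-identityʳ _)

      extendAll : Blocks → Assignment → Assignment
      extendAll []              e = e
      extendAll ((x , ys) ∷ bs) e = extendAll bs (extend ys e)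

      fill-sound : ∀ (μ : ℕ → ℕ → ℕ) (w : ℕ → ℕ) F bs e → All (λ (x , ys) → F x ≡ TK.weighted (μ x) ys) bs →
        extendAll bs e ∈ fill allowed (shells n s box allowed) (map (λ (x , ys) → x , map (λ y → y , μ x y , w y) ys) bs) F e (Tℕ.weighted w (concatMap proj₂ bs))
      fill-sound μ w F []              e []             = here refl
      fill-sound μ w F ((x , ys) ∷ bs) e (Fx≡ ∷ rest) rewrite Fx≡ | Tℕ.weighted-++ w ys (concatMap proj₂ bs) =
        ∈-concatMap (assign-sound (μ x) w ys e (Tℕ.weighted w (concatMap proj₂ bs))) (fill-sound μ w F bs (extend ys e) rest)

      Known : Assignment → ℕ → Set
      Known e r = value r e ≡ P r

      known-∷ : ∀ y {e r} → Known e r ⊎ r ≡ y → Known ((y , P y) ∷ e) r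
      known-∷ y {e} {r} known with r ℕ.≡ᵇ y in r≡ᵇy
      ... | true  = cong P (sym (ℕ.≡ᵇ⇒≡ r y (subst T (sym r≡ᵇy) _)))
      ... | false = [ id , (λ r≡y → ⊥-elim (subst T r≡ᵇy (ℕ.≡⇒≡ᵇ r y r≡y))) ]′ known

      known-extend : ∀ ys {e r} → Known e r ⊎ r ∈ ys → Known (extend ys e) r
      known-extend []       (inj₁ known)        = known
      known-extend (y ∷ ys) {e} (inj₁ known)     = known-extend ys (inj₁ (known-∷ y {e} (inj₁ known)))
      known-extend (y ∷ ys) {e} (inj₂ (here r≡y)) = known-extend ys (inj₁ (known-∷ y {e} (inj₂ r≡y)))
      known-extend (y ∷ ys) (inj₂ (there r∈ys)) = known-extend ys (inj₂ r∈ys)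

      known-extendAll : ∀ bs {e r} → Known e r ⊎ r ∈ concatMap proj₂ bs → Known (extendAll bs e) r
      known-extendAll []              (inj₁ known) = known
      known-extendAll ((x , ys) ∷ bs) (inj₁ known) = known-extendAll bs (inj₁ (known-extend ys (inj₁ known)))
      known-extendAll ((x , ys) ∷ bs) {e} (inj₂ r∈)   with ∈-++⁻ ys r∈
      ... | inj₁ r∈ys = known-extendAll bs (inj₁ (known-extend ys {e} (inj₂ r∈ys)))
      ... | inj₂ r∈bs = known-extendAll bs (inj₂ r∈bs)

      representative-P : ∀ x → P (representative s M x) ≡ P x
      representative-P = representative-value periodic-f fixed

      dot-∑ : ∀ k f g → dot (applyUpTo f k) (applyUpTo g k) ≡ ∑ k (λ i → f i * conj (g i))
      dot-∑ zero    f g = refl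
      dot-∑ (suc k) f g = cong (λ z → f 0 * conj (g 0) + z) (dot-∑ k (f ∘ suc) (g ∘ suc))

      rotate : ∀ d → d ≤ M → drop d (applyUpTo P M) ++ take d (applyUpTo P M) ≡ applyUpTo (λ i → P (d ℕ.+ i)) M
      rotate d d≤M = go (M ℕ.∸ d) (sym (ℕ.m+[n∸m]≡n d≤M))
        where
        go : ∀ c → M ≡ d ℕ.+ c → drop d (applyUpTo P M) ++ take d (applyUpTo P M) ≡ applyUpTo (λ i → P (d ℕ.+ i)) M
        go c M≡ = begin
          drop d (applyUpTo P M) ++ take d (applyUpTo P M)
            ≡⟨ cong (λ k → drop d (applyUpTo P k) ++ take d (applyUpTo P k)) M≡ ⟩
          drop d (applyUpTo P (d ℕ.+ c)) ++ take d (applyUpTo P (d ℕ.+ c))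
            ≡⟨ cong₂ _++_ (drop-applyUpTo d c P) (take-applyUpTo d c P) ⟩
          applyUpTo (λ i → P (d ℕ.+ i)) c ++ applyUpTo P d
            ≡⟨ cong (applyUpTo (λ i → P (d ℕ.+ i)) c ++_) (applyUpTo-cong d (λ i _ → wrap i)) ⟩
          applyUpTo (λ i → P (d ℕ.+ i)) c ++ applyUpTo (λ i → P (d ℕ.+ (c ℕ.+ i))) d
            ≡⟨ applyUpTo-++ c d (λ i → P (d ℕ.+ i)) ⟩
          applyUpTo (λ i → P (d ℕ.+ i)) (c ℕ.+ d)
            ≡⟨ cong (applyUpTo (λ i → P (d ℕ.+ i))) (trans (ℕ.+-comm c d) (sym M≡)) ⟩
          applyUpTo (λ i → P (d ℕ.+ i)) M                                            ∎
          where
          open ≡-Reasoning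
          wrap : ∀ i → P i ≡ P (d ℕ.+ (c ℕ.+ i))
          wrap i = trans (sym (periodic-f i)) (cong P (trans (cong (ℕ._+ i) M≡) (ℕ.+-assoc d c i)))

      orthogonal-P : T (orthogonal M (applyUpTo P M))
      orthogonal-P = All.all⁻ _ (All.applyUpTo⁺₁ id (M / 2) λ {d} d<M/2 →
        let 1+d<M = ℕ.≤-<-trans d<M/2 (ℕ.m/n<m M 2 (s≤s (s≤s z≤n))) in
        ℕ.≡⇒≡ᵇ _ 0 (trans (cong norm (trans (cong (λ zs → dot zs (applyUpTo P M)) (rotate (suc d) (ℕ.<⇒≤ 1+d<M)))
          (trans (dot-∑ M (λ i → P (suc d ℕ.+ i)) P) (off-peak (suc d) (s≤s z≤n) 1+d<M)))) norm-0))

    -- The projection Q supplies the targets, as a fibre sum of `P` depends only on the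
    -- representatives; the correlation at shift 0 supplies the budget n.
    lifts-sound : ∀ bs {sols Q} → T (consistent s l m bs) → (∀ x → Q x ≡ ∑ l (λ j → P (x ℕ.+ m ℕ.* j))) →
                  applyUpTo Q m ∈ sols → applyUpTo P M ∈ lifts n s box l m bs allowed sols
    lifts-sound bs {sols} {Q} ok Q≡ Q∈ = ∈-filter⁺ (T? ∘ orthogonal M) (∈-concatMap Q∈
      (subst (_∈ map (λ e → map (λ r → value r e) (representatives s M)) filled) image
        (∈-map⁺ (λ e → map (λ r → value r e) (representatives s M)) fill∋))) orthogonal-P
      where
      block-ok = T-∧ˡ (all (λ (x , ys) → (x ℕ.<ᵇ m) ∧ covers ys (fibre s l m x)) bs) ok
      covered  = T-∧ʳ (all (λ (x , ys) → (x ℕ.<ᵇ m) ∧ covers ys (fibre s l m x)) bs) ok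
      w = λ y → occurrences y (representatives s M)
      filled = fill allowed (shells n s box allowed) (unknowns n s box l m bs) (nth (applyUpTo Q m)) [] n
      nth-applyUpTo : ∀ m Q x → x < m → nth (applyUpTo Q m) x ≡ Q x
      nth-applyUpTo (suc m) Q zero    _         = refl
      nth-applyUpTo (suc m) Q (suc x) (s≤s x<m) = nth-applyUpTo m (Q ∘ suc) x x<m
      fibre-total : ∀ x → Q x ≡ TK.total (fibre s l m x)
      fibre-total x = trans (Q≡ x) (sym (trans (TK.total-applyUpTo l _)
        (∑-cong l (λ j → trans (representative-P ((x ℕ.+ m ℕ.* j) % M)) (periodic-% periodic-f (x ℕ.+ m ℕ.* j))))))
      targets : All (λ (x , ys) → nth (applyUpTo Q m) x ≡ TK.weighted (λ y → occurrences y (fibre s l m x)) ys) bs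
      targets = All.map (λ {(x , ys)} good → trans (nth-applyUpTo m Q x (ℕ.<ᵇ⇒< x m (T-∧ˡ (x ℕ.<ᵇ m) good)))
        (trans (fibre-total x) (TK.total≈weighted (fibre s l m x) ys (T-∧ʳ (x ℕ.<ᵇ m) good)))) (All.all⁺ _ bs block-ok)
      budget : Tℕ.weighted w (concatMap proj₂ bs) ≡ n
      budget = trans (sym (Tℕ.total≈weighted (representatives s M) (concatMap proj₂ bs) covered))
        (trans (Tℕ.total-applyUpTo M (representative s M))
        (trans (RangeSum.∑-cong ℕ.+-0-commutativeMonoid M (λ x → cong norm (representative-P x))) energy))
      fill∋ : extendAll bs [] ∈ filled
      fill∋ = subst (λ b → extendAll bs [] ∈ fill allowed (shells n s box allowed) (unknowns n s box l m bs) (nth (applyUpTo Q m)) [] b) budget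
        (fill-sound (λ x y → occurrences y (fibre s l m x)) w (nth (applyUpTo Q m)) bs [] targets)
      image : map (λ r → value r (extendAll bs [])) (representatives s M) ≡ applyUpTo P M
      image = trans (map-applyUpTo (representative s M) (λ r → value r (extendAll bs [])) M)
        (applyUpTo-cong M (λ i i<M → trans
          (known-extendAll bs {[]} (inj₂ (occurrences⇒∈ (representative s M i) (concatMap proj₂ bs)
            (all-∈ (λ y → occurrences y (concatMap proj₂ bs) ℕ.≡ᵇ 1) covered (∈-applyUpTo⁺ (representative s M) i<M)))))
          (representative-P i)))

-- Towers of quotients

module Projection (K : Coefficients) where

  open Coefficients K
  open RangeSum +-commutativeMonoid
  open ≡-Reasoning

  project : ℕ → ℕ → (ℕ → Carrier) → ℕ → Carrier
  project l m f x = ∑ l (λ j → f (x ℕ.+ m ℕ.* j))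

  module _ (l m : ℕ) {f : ℕ → Carrier} (per : Periodic (l ℕ.* m) f) where

    fibre-periodic : ∀ x → Periodic l (λ j → f (x ℕ.+ m ℕ.* j))
    fibre-periodic x j = trans (cong f (index l m x j)) (per _)
      where
      index : ∀ l m x j → x ℕ.+ m ℕ.* (l ℕ.+ j) ≡ l ℕ.* m ℕ.+ (x ℕ.+ m ℕ.* j)
      index = ℕ-Solver.solve-∀

    project-periodic : Periodic m (project l m f)
    project-periodic x = trans (∑-cong l (λ j → cong f (index m x j))) (∑-shift l (fibre-periodic x) 1)
      where
      index : ∀ m x j → m ℕ.+ x ℕ.+ m ℕ.* j ≡ x ℕ.+ m ℕ.* (1 ℕ.+ j)
      index = ℕ-Solver.solve-∀

    -- Summation over cosets is a homomorphism of group rings, so the correlation at d collects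
    -- those at all lifts d + m j.
    project-correlation : ∀ d → correlation K m (project l m f) d ≡ ∑ l (λ j → correlation K (l ℕ.* m) f (d ℕ.+ m ℕ.* j))
    project-correlation d = begin
      ∑ m (λ x → g (d ℕ.+ x) * conj (g x))
        ≡⟨ ∑-cong m (λ x → trans (cong (g (d ℕ.+ x) *_) (conj-∑ l (λ j → f (x ℕ.+ m ℕ.* j)))) (*-∑ l (g (d ℕ.+ x)) (λ j → conj (f (x ℕ.+ m ℕ.* j))))) ⟩
      ∑ m (λ x → ∑ l (λ j → g (d ℕ.+ x) * conj (f (x ℕ.+ m ℕ.* j))))
        ≡⟨ ∑-cong m (λ x → ∑-cong l (λ j → cong (_* conj (f (x ℕ.+ m ℕ.* j))) (sym (g-shift x j)))) ⟩
      ∑ m (λ x → ∑ l (λ j → h (x ℕ.+ m ℕ.* j)))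
        ≡⟨ ∑-blocks l m h ⟩
      ∑ (l ℕ.* m) (λ y → g (d ℕ.+ y) * conj (f y))
        ≡⟨ ∑-cong (l ℕ.* m) (λ y → ∑-* l (conj (f y)) (λ j → f (d ℕ.+ y ℕ.+ m ℕ.* j))) ⟩
      ∑ (l ℕ.* m) (λ y → ∑ l (λ j → f (d ℕ.+ y ℕ.+ m ℕ.* j) * conj (f y)))
        ≡⟨ ∑-swap (l ℕ.* m) l (λ y j → f (d ℕ.+ y ℕ.+ m ℕ.* j) * conj (f y)) ⟩
      ∑ l (λ j → ∑ (l ℕ.* m) (λ y → f (d ℕ.+ y ℕ.+ m ℕ.* j) * conj (f y)))
        ≡⟨ ∑-cong l (λ j → ∑-cong (l ℕ.* m) (λ y → cong (λ z → f z * conj (f y)) (swap d y (m ℕ.* j)))) ⟩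
      ∑ l (λ j → correlation K (l ℕ.* m) f (d ℕ.+ m ℕ.* j)) ∎
      where
      g = project l m f
      h = λ y → g (d ℕ.+ y) * conj (f y)
      swap : ∀ a b c → a ℕ.+ b ℕ.+ c ≡ a ℕ.+ c ℕ.+ b
      swap = ℕ-Solver.solve-∀
      *-∑ : ∀ k c f → c * ∑ k f ≡ ∑ k (λ i → c * f i)
      *-∑ k c f = SemiringSum.*-distribˡ-sum semiring {k} c (f ∘ toℕ)
      ∑-* : ∀ k c f → ∑ k f * c ≡ ∑ k (λ i → f i * c)
      ∑-* k c f = SemiringSum.*-distribʳ-sum semiring {k} c (f ∘ toℕ)
      conj-∑ : ∀ k f → conj (∑ k f) ≡ ∑ k (conj ∘ f)
      conj-∑ zero    f = conj-0
      conj-∑ (suc k) f = trans (conj-+ _ _) (cong (λ z → conj (f 0) + z) (conj-∑ k (f ∘ suc)))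
      g-shift : ∀ x j → g (d ℕ.+ (x ℕ.+ m ℕ.* j)) ≡ g (d ℕ.+ x)
      g-shift x j = periodic-cong project-periodic 0 j (index d m x j)
        where
        index : ∀ d m x j → 0 ℕ.* m ℕ.+ (d ℕ.+ (x ℕ.+ m ℕ.* j)) ≡ j ℕ.* m ℕ.+ (d ℕ.+ x)
        index = ℕ-Solver.solve-∀

    -- The points above s x are the s-multiples of the points above x: j ↦ s j permutes the residues
    -- modulo l, because s is a unit there.
    project-fixed : ∀ s t .{{_ : NonZero l}} → (s ℕ.* t) % l ≡ 1 % l → (∀ x → f (s ℕ.* x) ≡ f x) →
                    ∀ x → project l m f (s ℕ.* x) ≡ project l m f x
    project-fixed s t st fixed x = go l refl st
      where
      index : ∀ s m x j → s ℕ.* x ℕ.+ m ℕ.* (s ℕ.* j) ≡ s ℕ.* (x ℕ.+ m ℕ.* j)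
      index = ℕ-Solver.solve-∀
      go : ∀ k .{{_ : NonZero k}} → k ≡ l → (s ℕ.* t) % k ≡ 1 % k → ∑ k (λ j → f (s ℕ.* x ℕ.+ m ℕ.* j)) ≡ ∑ k (λ j → f (x ℕ.+ m ℕ.* j))
      go (suc k) refl st = trans (sym (GroupRing.∑-unit K k s t st (fibre-periodic (s ℕ.* x))))
        (∑-cong (suc k) (λ j → trans (cong f (index s m x j)) (fixed _)))

  -- Among the lifts d + m j with d < m and j < l only d = j = 0 gives the zero shift, so the sum of
  -- correlations is the old peak or zero.
  project-perfect : ∀ l m {ν f} .{{_ : NonZero l}} → Perfect K (l ℕ.* m) ν f → Perfect K m ν (project l m f)
  project-perfect l m {ν} {f} perfect = record
    { periodic-f = project-periodic l m periodic-f
    ; peak       = trans (project-correlation l m periodic-f 0) (peak-sum l refl)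
    ; off-peak   = λ d 0<d d<m → trans (project-correlation l m periodic-f d) (∑-zero l (λ j j<l →
        off-peak (d ℕ.+ m ℕ.* j) (ℕ.<-≤-trans 0<d (ℕ.m≤m+n d _)) (in-range d j d<m j<l))) }
    where
    open Perfect perfect
    in-range : ∀ d j → d < m → j < l → d ℕ.+ m ℕ.* j < l ℕ.* m
    in-range d j d<m j<l = ℕ.<-≤-trans (ℕ.+-monoˡ-< (m ℕ.* j) d<m)
      (ℕ.≤-trans (ℕ.≤-reflexive (sym (ℕ.*-suc m j))) (ℕ.≤-trans (ℕ.*-monoʳ-≤ m j<l) (ℕ.≤-reflexive (ℕ.*-comm m l))))
    peak-sum : ∀ k .{{_ : NonZero k}} → k ≡ l → ∑ k (λ j → correlation K (l ℕ.* m) f (m ℕ.* j)) ≡ ν · 1#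
    peak-sum (suc k) refl = trans (∑-pick (suc k) (λ j → correlation K (l ℕ.* m) f (m ℕ.* j)) (s≤s z≤n) other)
      (trans (cong (correlation K (l ℕ.* m) f) (ℕ.*-zeroʳ m)) peak)
      where
      other : ∀ j → j < suc k → j ≢ 0 → correlation K (l ℕ.* m) f (m ℕ.* j) ≡ 0#
      other j j<l j≢0 = case-m m refl
        where
        case-m : ∀ m′ → m′ ≡ m → correlation K (l ℕ.* m) f (m ℕ.* j) ≡ 0#
        -- For m = 0 the modulus l m is 0 and the correlation is an empty sum.
        case-m zero     refl = trans (cong (λ k → ∑ k (λ i → f (0 ℕ.+ i) * conj (f i))) (ℕ.*-zeroʳ l)) refl
        case-m (suc m′) refl = off-peak (m ℕ.* j) (ℕ.n≢0⇒n>0 (λ eq → j≢0 ([ (λ ()) , id ]′ (ℕ.m*n≡0⇒m≡0∨n≡0 m eq))))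
          (in-range 0 j (s≤s z≤n) j<l)

infixr 5 _◂_

-- A factorisation of the modulus, giving the tower of quotients through which solutions are lifted.
data Chain : ℕ → Set where
  []  : Chain 1
  _◂_ : ∀ l {m} .{{_ : NonZero l}} → Chain m → Chain (l ℕ.* m)

chain-nonZero : ∀ {m} → Chain m → NonZero m
chain-nonZero []           = _
chain-nonZero (_◂_ l {m} {{nonZero}} c) = ℕ.m*n≢0 l m {{nonZero}} {{chain-nonZero c}}

module Tower (K : Coefficients) (ν s t : ℕ) (box : List (Coefficients.Carrier K))
             (box-complete : ∀ z → Coefficients.norm K z ≤ ν → z ∈ box) where

  open Coefficients K
  open Search K
  open Projection K
  open RangeSum +-commutativeMonoid

  -- The bound `allowed` comes from the number of entries in a coset of the top quotient, so it is
  -- imposed on that level only; lower levels are limited by the budget.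
  solutions : (Carrier → Bool) → ∀ {m} → Chain m → List (List Carrier)
  solutions allowed []            = start ν s box
  solutions allowed (_◂_ l {m} c) = lifts ν s box l m (blocks s l m) allowed (solutions (λ _ → true) c)
    where instance
      _ = chain-nonZero c
      _ = chain-nonZero (l ◂ c)

  coherent : ∀ {m} → Chain m → Bool
  coherent []            = true
  coherent (_◂_ l {m} c) = (consistent s l m (blocks s l m) ∧ ((s ℕ.* t) % l ℕ.≡ᵇ 1 % l)) ∧ coherent c
    where instance
      _ = chain-nonZero c
      _ = chain-nonZero (l ◂ c)

  solutions-sound : ∀ {m} (c : Chain m) → T (coherent c) → ∀ allowed P → Perfect K m ν P →
                    (∀ x → P (s ℕ.* x) ≡ P x) → (∀ x → T (allowed (P x))) → applyUpTo P m ∈ solutions allowed c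
  solutions-sound [] _ allowed P perfect fixed allowed-P =
    ∈-map⁺ (_∷ []) (∈-filter⁺ (T? ∘ λ z → norm z ℕ.≡ᵇ ν) (box-complete (P 0) (ℕ.≤-reflexive norm≡ν)) (ℕ.≡⇒≡ᵇ _ ν norm≡ν))
    where
    norm≡ν : norm (P 0) ≡ ν
    norm≡ν = ℤ.+-injective (trans (sym (re-· _)) (trans (cong re (trans (sym (*-conj (P 0)))
      (trans (sym (+-identityʳ _)) (Perfect.peak perfect)))) (re-· ν)))
  solutions-sound (_◂_ l {m} c) ok allowed P perfect fixed allowed-P =
    Soundness.Lift.lifts-sound K ν s box box-complete l m allowed P perfect fixed allowed-P (blocks s l m)
      (T-∧ˡ (consistent s l m (blocks s l m)) level-ok) (λ _ → refl)
      (solutions-sound c (T-∧ʳ level ok) (λ _ → true) (project l m P) (project-perfect l m perfect)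
        (project-fixed l m (Perfect.periodic-f perfect) s t (ℕ.≡ᵇ⇒≡ ((s ℕ.* t) % l) (1 % l) (T-∧ʳ (consistent s l m (blocks s l m)) level-ok)) fixed)
        (λ _ → _))
    where
    instance
      _ = chain-nonZero c
      _ = chain-nonZero (l ◂ c)
    level = consistent s l m (blocks s l m) ∧ ((s ℕ.* t) % l ℕ.≡ᵇ 1 % l)
    level-ok = T-∧ˡ level ok

  -- The checks are Boolean equations so that `refl` can discharge them: evaluating the second one
  -- is the exhaustive search.
  property : ∀ {m} (c : Chain m) → coherent c ≡ true → ∀ allowed p → all (all p) (solutions allowed c) ≡ true →
             ∀ P → Perfect K m ν P → (∀ x → P (s ℕ.* x) ≡ P x) → (∀ x → T (allowed (P x))) → ∀ x → T (p (P x))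
  property {m} c ok allowed p checked P perfect fixed allowed-P x = subst (T ∘ p) (periodic-% periodic-f x)
    (all-∈ p (all-∈ (all p) (subst T (sym checked) _)
      (solutions-sound c (subst T (sym ok) _) allowed P perfect fixed allowed-P)) (∈-applyUpTo⁺ P (ℕ.m%n<n x m)))
    where
    open Perfect perfect
    instance _ = chain-nonZero c

-- Projections of circulant weighing matrices

interval : ℕ → List ℤ
interval r = map +_ (upTo (suc r)) ++ map -[1+_] (upTo r)

∈-interval : ∀ r i → ∣ i ∣ ≤ r → i ∈ interval r
∈-interval r (+ m)    m≤r = ∈-++⁺ˡ (∈-map⁺ +_ (∈-applyUpTo⁺ id (s≤s m≤r)))
∈-interval r -[1+ m ] m<r = ∈-++⁺ʳ (map +_ (upTo (suc r))) (∈-map⁺ -[1+_] (∈-applyUpTo⁺ id m<r))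

square-bound : ∀ c r n m → c ℕ.* (m ℕ.* m) ≤ n → n < c ℕ.* (suc r ℕ.* suc r) → m ≤ r
square-bound c r n m cm²≤n n<cr² = ℕ.≮⇒≥ λ r<m →
  ℕ.<⇒≱ n<cr² (ℕ.≤-trans (ℕ.*-monoʳ-≤ c (ℕ.*-mono-≤ r<m r<m)) cm²≤n)

integers-box : ∀ r n → n < suc r ℕ.* suc r → ∀ z → Coefficients.norm integers z ≤ n → z ∈ interval r
integers-box r n n<r² z norm≤n = ∈-interval r z (square-bound 1 r n ∣ z ∣
  (subst (_≤ n) (sym (ℕ.+-identityʳ _)) norm≤n) (subst (n <_) (sym (ℕ.+-identityʳ _)) n<r²))

-- ℤ[i] for p = 0 and ℤ[ω] for p = -1.
module Cyclotomic (p : ℤ) (d : ℕ) (discriminant : p ℤ.* p ℤ.+ + 4 ℤ.* -1ℤ ≡ -[1+ d ]) where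

  open Quadratic p -1ℤ d discriminant

  square : ℕ → List (ℤ × ℤ)
  square r = cartesianProduct (interval r) (interval r)

  -- For q = -1 the norm form is symmetric in a and b, so the bound on b obtained by completing the
  -- square holds for a as well.
  square-box : ∀ r n → 4 ℕ.* n < suc d ℕ.* (suc r ℕ.* suc r) → ∀ z → norm z ≤ n → z ∈ square r
  square-box r n n<r² (a , b) norm≤n = ∈-cartesianProduct⁺
    (∈-interval r a (bound b a (subst (_≤ n) (cong ∣_∣ (symmetric p a b)) norm≤n)))
    (∈-interval r b (bound a b norm≤n))
    where
    symmetric : ∀ p a b → a ℤ.* a ℤ.+ p ℤ.* (a ℤ.* b) ℤ.- -1ℤ ℤ.* (b ℤ.* b) ≡ b ℤ.* b ℤ.+ p ℤ.* (b ℤ.* a) ℤ.- -1ℤ ℤ.* (a ℤ.* a)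
    symmetric = ℤ-Solver.solve-∀
    bound : ∀ a b → norm (a , b) ≤ n → ∣ b ∣ ≤ r
    bound a b norm≤n = square-bound (suc d) r (4 ℕ.* n) ∣ b ∣ (ℕ.≤-trans (norm-bound a b) (ℕ.*-monoʳ-≤ 4 norm≤n)) n<r²

record Embedding (K : Coefficients) : Set where
  open Coefficients K
  field
    emb      : ℤ → Carrier
    emb-+    : ∀ a b → emb (a ℤ.+ b) ≡ emb a + emb b
    emb-*    : ∀ a b → emb (a ℤ.* b) ≡ emb a * emb b
    emb-0    : emb 0ℤ ≡ 0#
    emb-1    : emb 1ℤ ≡ 1#
    conj-emb : ∀ a → conj (emb a) ≡ emb a

  open RangeSum +-commutativeMonoid

  emb-pos : ∀ m → emb (+ m) ≡ m · 1#
  emb-pos zero    = emb-0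
  emb-pos (suc m) = trans (emb-+ 1ℤ (+ m)) (cong₂ _+_ emb-1 (emb-pos m))

  emb-neg : ∀ a → emb (ℤ.- a) ≡ - emb a
  emb-neg a = -‿unique (emb a) (emb (ℤ.- a)) (trans (sym (emb-+ a (ℤ.- a))) (trans (cong emb (ℤ.+-inverseʳ a)) emb-0))
    where open RingProperties ring using () renaming (+-inverseʳ-unique to -‿unique)

  emb-∑ : ∀ m f → emb (RangeSum.∑ (Coefficients.+-commutativeMonoid integers) m f) ≡ ∑ m (emb ∘ f)
  emb-∑ zero    f = emb-0
  emb-∑ (suc m) f = trans (emb-+ _ _) (cong (λ z → emb (f 0) + z) (emb-∑ m (f ∘ suc)))

integers-embedding : Embedding integers
integers-embedding = record
  { emb = id ; emb-+ = λ _ _ → refl ; emb-* = λ _ _ → refl ; emb-0 = refl ; emb-1 = refl ; conj-emb = λ _ → refl }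

quadratic-embedding : ∀ p q d discriminant → Embedding (Quadratic.quadratic p q d discriminant)
quadratic-embedding p q d discriminant = record
  { emb = _, 0ℤ ; emb-+ = λ _ _ → refl
  ; emb-* = λ a b → cong₂ _,_ (emb-*₁ q a b) (emb-*₂ p a b)
  ; emb-0 = refl ; emb-1 = refl
  ; conj-emb = λ a → cong (_, 0ℤ) (conj-emb p a) }
  where
  emb-*₁ : ∀ q a b → a ℤ.* b ≡ a ℤ.* b ℤ.+ q ℤ.* (0ℤ ℤ.* 0ℤ)
  emb-*₁ = ℤ-Solver.solve-∀
  emb-*₂ : ∀ p a b → 0ℤ ≡ a ℤ.* 0ℤ ℤ.+ 0ℤ ℤ.* b ℤ.+ p ℤ.* (0ℤ ℤ.* 0ℤ)
  emb-*₂ = ℤ-Solver.solve-∀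
  conj-emb : ∀ p a → a ℤ.+ p ℤ.* 0ℤ ≡ a
  conj-emb = ℤ-Solver.solve-∀

module _ (K : Coefficients) (embedding : Embedding K) {p k : ℕ} (p-prime : Prime p) (1≤k : 1 ≤ k) where

  open Coefficients K
  open Embedding embedding

  -- The q-th power map is additive modulo π, so it suffices that it fixes a generator θ.
  primeAbove : ∀ π → norm π ≢ 0 → (∃[ c ] p · 1# ≡ π * c) → ∀ θ → (∀ x → ∃[ a ] ∃[ b ] x ≡ emb a + emb b * θ) →
               (∃[ d ] θ ^ (p ℕ.^ k) ≡ θ + π * d) → PrimeAbove K p k
  primeAbove π norm≢0 over@(c , p≡πc) θ generated θ-fixed = record
    { p-prime = p-prime ; π = π ; norm≢0 = norm≢0 ; over = over ; 1≤k = 1≤k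
    ; fixed = λ x → subst (_≡π x) (^-quotient x q) (fixed x) }
    where
    open Quotient commutativeRing π
    module Φ = Frobenius quotientRing p-prime
    q = p ℕ.^ k
    char : Mult._×_ (CommutativeRing.semiring quotientRing) p 1# ≡π 0#
    char = subst (_≡π 0#) (sym (·-quotient p 1#)) (c , trans p≡πc (sym (+-identityˡ _)))
    Fixed = Φ.Fixed char k
    fixed-emb : ∀ a → Fixed (emb a)
    fixed-emb (+ m)    = subst (Fixed) (trans (·-quotient m 1#) (sym (emb-pos m))) (Φ.fixed-· char k m)
    fixed-emb -[1+ m ] = subst (Fixed) (sym (emb-neg (+ suc m))) (Φ.fixed-neg char k (fixed-emb (+ suc m)))
    fixed : ∀ x → Fixed x
    fixed x = let (a , b , x≡) = generated x in
      subst (Fixed) (sym x≡) (Φ.fixed-+ char k (fixed-emb a) (Φ.fixed-* char k (fixed-emb b)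
        (subst (_≡π θ) (sym (^-quotient θ q)) θ-fixed)))

trits : List ℤ
trits = 0ℤ ∷ 1ℤ ∷ -1ℤ ∷ []

tuples : ℕ → List (List ℤ)
tuples zero    = [] ∷ []
tuples (suc l) = concatMap (λ a → map (a ∷_) (tuples l)) trits

∈-tuples : ∀ l (f : ℕ → ℤ) → (∀ j → f j ∈ trits) → applyUpTo f l ∈ tuples l
∈-tuples zero    f trit = here refl
∈-tuples (suc l) f trit = ∈-concatMap {f = λ a → map (a ∷_) (tuples l)} (trit 0) (∈-map⁺ (f 0 ∷_) (∈-tuples l (f ∘ suc) (trit ∘ suc)))

record RootOfUnity (K : Coefficients) (e : ℕ) : Set where
  open Coefficients K
  field
    θ       : Carrier
    θ^e≡1   : θ ^ e ≡ 1#
    θ*conjθ : θ * conj θ ≡ 1#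

module TwistedProjection (K : Coefficients) (embedding : Embedding K) {e : ℕ} .{{_ : NonZero e}} (root : RootOfUnity K e) where

  open Coefficients K
  open Embedding embedding
  open RootOfUnity root
  open RangeSum +-commutativeMonoid
  open Projection K
  open ≡-Reasoning

  θ^-periodic : Periodic e (θ ^_)
  θ^-periodic x = trans (Exp.^-homo-* semiring θ e x) (trans (cong (_* θ ^ x) θ^e≡1) (*-identityˡ _))

  θ^-unit : ∀ x → θ ^ x * conj (θ ^ x) ≡ 1#
  θ^-unit zero    = trans (*-identityˡ _) conj-1
  θ^-unit (suc x) = begin
    θ * θ ^ x * conj (θ * θ ^ x)                ≡⟨ cong (θ * θ ^ x *_) (conj-* θ (θ ^ x)) ⟩
    θ * θ ^ x * (conj θ * conj (θ ^ x))         ≡⟨ interchange θ (θ ^ x) (conj θ) (conj (θ ^ x)) ⟩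
    θ * conj θ * (θ ^ x * conj (θ ^ x))         ≡⟨ cong₂ _*_ θ*conjθ (θ^-unit x) ⟩
    1# * 1#                                     ≡⟨ *-identityˡ 1# ⟩
    1#                                          ∎
    where open import Algebra.Properties.CommutativeSemigroup (CommutativeRing.*-commutativeSemigroup commutativeRing) using (interchange)

  -- Followed by `project l m` this is the homomorphism that sends the generator of C_v to θ times
  -- the generator of C_m.
  twisted : (ℕ → ℤ) → ℕ → Carrier
  twisted f x = θ ^ x * emb (f x)

  -- Because θ conj θ = 1, each product of two coefficients at distance d acquires the same factor
  -- θ^d; vanishing correlations still vanish.
  twisted-correlation : ∀ v f d → correlation K v (twisted f) d ≡ θ ^ d * emb (correlation integers v f d)
  twisted-correlation v f d = begin
    ∑ v (λ i → θ ^ (d ℕ.+ i) * emb (f (d ℕ.+ i)) * conj (θ ^ i * emb (f i)))     ≡⟨ ∑-cong v term ⟩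
    ∑ v (λ i → θ ^ d * emb (f (d ℕ.+ i) ℤ.* f i))
      ≡⟨ SemiringSum.*-distribˡ-sum semiring {v} (θ ^ d) ((λ i → emb (f (d ℕ.+ i) ℤ.* f i)) ∘ toℕ) ⟨
    θ ^ d * ∑ v (λ i → emb (f (d ℕ.+ i) ℤ.* f i))
      ≡⟨ cong (θ ^ d *_) (emb-∑ v (λ i → f (d ℕ.+ i) ℤ.* f i)) ⟨
    θ ^ d * emb (correlation integers v f d)                                     ∎
    where
    open import Algebra.Properties.CommutativeSemigroup (CommutativeRing.*-commutativeSemigroup commutativeRing) using (interchange)
    term : ∀ i → θ ^ (d ℕ.+ i) * emb (f (d ℕ.+ i)) * conj (θ ^ i * emb (f i)) ≡ θ ^ d * emb (f (d ℕ.+ i) ℤ.* f i)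
    term i = begin
      θ ^ (d ℕ.+ i) * emb (f (d ℕ.+ i)) * conj (θ ^ i * emb (f i))
        ≡⟨ cong (θ ^ (d ℕ.+ i) * emb (f (d ℕ.+ i)) *_) (trans (conj-* _ _) (cong (conj (θ ^ i) *_) (conj-emb (f i)))) ⟩
      θ ^ (d ℕ.+ i) * emb (f (d ℕ.+ i)) * (conj (θ ^ i) * emb (f i))
        ≡⟨ interchange (θ ^ (d ℕ.+ i)) (emb (f (d ℕ.+ i))) (conj (θ ^ i)) (emb (f i)) ⟩
      θ ^ (d ℕ.+ i) * conj (θ ^ i) * (emb (f (d ℕ.+ i)) * emb (f i))              ≡⟨ cong₂ _*_ power (sym (emb-* _ _)) ⟩
      θ ^ d * emb (f (d ℕ.+ i) ℤ.* f i)                                           ∎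
      where
      power : θ ^ (d ℕ.+ i) * conj (θ ^ i) ≡ θ ^ d
      power = trans (cong (_* conj (θ ^ i)) (Exp.^-homo-* semiring θ d i))
        (trans (*-assoc _ _ _) (trans (cong (θ ^ d *_) (θ^-unit i)) (*-identityʳ _)))

  twisted-perfect : ∀ {v ν f} k → k ℕ.* e ≡ v → Perfect integers v ν f → Perfect K v ν (twisted f)
  twisted-perfect {v} {ν} {f} k refl perfect = record
    { periodic-f = λ x → cong₂ _*_ (periodic-* θ^-periodic k x) (cong emb (periodic-f x))
    ; peak       = trans (twisted-correlation v f 0) (trans (*-identityˡ _)
        (trans (cong emb (trans peak (Coefficients.re-· integers ν))) (emb-pos ν)))
    ; off-peak   = λ d 0<d d<v → trans (twisted-correlation v f d) (trans (cong (λ z → θ ^ d * z)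
        (trans (cong emb (off-peak d 0<d d<v)) emb-0)) (zeroʳ _)) }
    where open Perfect perfect

  combine : ℕ → ℕ → List ℤ → Carrier
  combine m x []       = 0#
  combine m x (a ∷ as) = θ ^ x * emb a + combine m (x ℕ.+ m) as

  project-combine : ∀ l m f x → project l m (twisted f) x ≡ combine m x (applyUpTo (λ j → f (x ℕ.+ m ℕ.* j)) l)
  project-combine zero    m f x = refl
  project-combine (suc l) m f x = cong₂ _+_ (cong₂ (λ y z → θ ^ y * emb (f z)) (x+m*0≡x x m) refl)
    (trans (∑-cong l (λ j → cong (twisted f) (index x m j)))
    (trans (project-combine l m f (x ℕ.+ m)) (cong (combine m (x ℕ.+ m)) (applyUpTo-cong l (λ j _ → cong f (sym (index x m j)))))))
    where
    x+m*0≡x : ∀ x m → x ℕ.+ m ℕ.* 0 ≡ x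
    x+m*0≡x = ℕ-Solver.solve-∀
    index : ∀ x m j → x ℕ.+ m ℕ.* suc j ≡ x ℕ.+ m ℕ.+ m ℕ.* j
    index = ℕ-Solver.solve-∀

  combine-% : ∀ m x as → combine m (x % e) as ≡ combine m x as
  combine-% m x as = go as (x % e) x (ℕ.m%n%n≡m%n x e)
    where
    go : ∀ as x y → x % e ≡ y % e → combine m x as ≡ combine m y as
    go []       x y eq = refl
    go (a ∷ as) x y eq = cong₂ (λ z w → z * emb a + w) (periodic-≡% θ^-periodic eq)
      (go as (x ℕ.+ m) (y ℕ.+ m) (trans (cong (_% e) (ℕ.+-comm x m)) (trans (%-congʳ-+ e m x y eq) (cong (_% e) (ℕ.+-comm m y)))))

  -- A projected coefficient depends only on x modulo e and on l entries from {0, 1, -1}, so a bound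
  -- on all coefficients is a check of e · 3^l cases.
  fibrewise : ∀ l m allowed → all (λ x → all (λ as → allowed (combine m x as)) (tuples l)) (upTo e) ≡ true →
              ∀ f → (∀ x → f x ∈ trits) → ∀ x → T (allowed (project l m (twisted f) x))
  fibrewise l m allowed checked f trit x = subst (T ∘ allowed) (trans (combine-% m x (applyUpTo (λ j → f (x ℕ.+ m ℕ.* j)) l)) (sym (project-combine l m f x)))
    (all-∈ (allowed ∘ combine m (x % e)) (all-∈ (λ y → all (allowed ∘ combine m y) (tuples l)) (subst T (sym checked) _) (∈-applyUpTo⁺ id (ℕ.m%n<n x e)))
      (∈-tuples l (λ j → f (x ℕ.+ m ℕ.* j)) (λ j → trit _)))

-- First rows of circulant weighing matrices

module _ {v′ ν : ℕ} {W : Matrix (suc v′)} (cw : IsCW (suc v′) ν W) where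

  private
    v = suc v′
    open IsCW cw
    open IsWeighing isWeighing

    toℕ-mod : ∀ x → toℕ (x ℕ.mod v) ≡ x % v
    toℕ-mod x = Fin.toℕ-fromℕ< (ℕ.m%n<n x v)

    mod-cong : ∀ x y → x % v ≡ y % v → x ℕ.mod v ≡ y ℕ.mod v
    mod-cong x y eq = Fin.toℕ-injective (trans (toℕ-mod x) (trans eq (sym (toℕ-mod y))))

  firstRow : ℕ → ℤ
  firstRow x = W Fin.zero (x ℕ.mod v)

  firstRow-trits : ∀ x → firstRow x ∈ trits
  firstRow-trits x with entries Fin.zero (x ℕ.mod v)
  ... | inj₁ eq        = here eq
  ... | inj₂ (inj₁ eq) = there (here eq)
  ... | inj₂ (inj₂ eq) = there (there (here eq))

  row : ∀ k (k<v : k < v) x → W (fromℕ< k<v) ((k ℕ.+ x) ℕ.mod v) ≡ firstRow x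
  row zero    (s≤s _) x = refl
  row (suc k) k<v     x = trans (cong (W (fromℕ< k<v)) (mod-cong (suc k ℕ.+ x) (suc (toℕ ((k ℕ.+ x) ℕ.mod v))) shift))
    (trans (isCirculant (fromℕ< k<v′) (fromℕ< k<v) ((k ℕ.+ x) ℕ.mod v)
      (trans (Fin.toℕ-fromℕ< k<v) (cong suc (sym (Fin.toℕ-fromℕ< k<v′))))) (row k k<v′ x))
    where
    k<v′ : k < v
    k<v′ = ℕ.<-trans (ℕ.n<1+n k) k<v
    shift : (suc k ℕ.+ x) % v ≡ suc (toℕ ((k ℕ.+ x) ℕ.mod v)) % v
    shift = trans (%-congʳ-+ v 1 (k ℕ.+ x) ((k ℕ.+ x) % v) (sym (ℕ.m%n%n≡m%n (k ℕ.+ x) v)))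
      (cong (λ y → suc y % v) (sym (toℕ-mod (k ℕ.+ x))))

  firstRow-periodic : Periodic v firstRow
  firstRow-periodic x = cong (W Fin.zero) (mod-cong (v ℕ.+ x) x (trans (cong (_% v) (ℕ.+-comm v x)) (ℕ.[m+n]%n≡m%n x v)))

  -- Row d is row 0 moved by d, so entry (0 , d) of W Wᵀ is the autocorrelation of the first row at
  -- shift d.
  firstRow-correlation : ∀ d (d<v : d < v) → correlation integers v firstRow d ≡ (+ ν ·ᴹ I) Fin.zero (fromℕ< d<v)
  firstRow-correlation d d<v = begin
    ∑ v (λ x → firstRow (d ℕ.+ x) ℤ.* firstRow x)
      ≡⟨ ∑-cong v (λ x → cong (firstRow (d ℕ.+ x) ℤ.*_) (sym (row d d<v x))) ⟩
    ∑ v (λ x → product (d ℕ.+ x))                                         ≡⟨ ∑-shift v product-periodic d ⟩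
    ∑ v product
      ≡⟨ Sum.sum-cong-≗ (Coefficients.+-commutativeMonoid integers) {v} (λ k → cong₂ ℤ._*_ (cong (W Fin.zero) (mod-toℕ k)) (cong (W (fromℕ< d<v)) (mod-toℕ k))) ⟩
    (W ⊗ transpose W) Fin.zero (fromℕ< d<v)                               ≡⟨ WWᵀ≡nI Fin.zero (fromℕ< d<v) ⟩
    (+ ν ·ᴹ I) Fin.zero (fromℕ< d<v)                                       ∎
    where
    open ≡-Reasoning
    open RangeSum (Coefficients.+-commutativeMonoid integers)
    product : ℕ → ℤ
    product y = W Fin.zero (y ℕ.mod v) ℤ.* W (fromℕ< d<v) (y ℕ.mod v)
    product-periodic : Periodic v product
    product-periodic y = cong (λ z → W Fin.zero z ℤ.* W (fromℕ< d<v) z)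
      (mod-cong (v ℕ.+ y) y (trans (cong (_% v) (ℕ.+-comm v y)) (ℕ.[m+n]%n≡m%n y v)))
    mod-toℕ : ∀ (k : Fin v) → toℕ k ℕ.mod v ≡ k
    mod-toℕ k = Fin.toℕ-injective (trans (toℕ-mod (toℕ k)) (ℕ.m<n⇒m%n≡m (Fin.toℕ<n k)))

  firstRow-perfect : Perfect integers v ν firstRow
  firstRow-perfect = record
    { periodic-f = firstRow-periodic
    ; peak       = trans (firstRow-correlation 0 (s≤s z≤n)) (trans (ℤ.*-identityʳ (+ ν)) (sym (Coefficients.re-· integers ν)))
    ; off-peak   = λ { (suc d) _ d<v → trans (firstRow-correlation (suc d) d<v) (off d d<v) } }
    where
    off : ∀ d (d<v : suc d < v) → (+ ν ·ᴹ I) Fin.zero (fromℕ< d<v) ≡ 0ℤ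
    off d (s≤s d<v′) = ℤ.*-zeroʳ (+ ν)

-- Existence of multipliers

MultiplierAt : Coefficients → ℕ → ℕ → ℕ → Set
MultiplierAt K N ν s = ∀ a → Perfect K (suc N) ν a → ∃[ h ] ∀ x → a (h ℕ.+ s ℕ.* x) ≡ a (h ℕ.+ x)

module _ (K : Coefficients) (N ν : ℕ) (ν≢0 : ν ≢ 0) (s t : ℕ) (st : (s ℕ.* t) % suc N ≡ 1 % suc N) where

  open Coefficients K
  private
    n = suc N
    module M a (perfect : Perfect K n ν a) = Multiplier K N ν ν≢0 a perfect

  Divisible : Set
  Divisible = ∀ a perfect x → ∃[ c ] Twist.at (M.F a perfect s t st) x ≡ ν · 1# * c

  -- If g = k d and d = (t - 1) r, then h = k r solves (t - 1) h = g. Where t - 1 is a unit d = 1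
  -- will do; for t = 7 and the even moduli the gcd with t - 1 = 6 is 2, hence d = 2.
  multiplierAt : (divisible : Divisible) → ∀ d r → ((t ℕ.+ N) ℕ.* r) % n ≡ d % n →
                 (∀ a perfect → ∃[ k ] M.g a perfect s t st (divisible a perfect) ≡ k ℕ.* d) → MultiplierAt K N ν s
  multiplierAt divisible d r tr≡d multiple a perfect = let (k , g≡kd) = multiple a perfect in
    k ℕ.* r , M.fixed-translate a perfect s t st (divisible a perfect) (k ℕ.* r)
      (trans (cong (_% n) (swap (t ℕ.+ N) k r)) (trans (%-congʳ-* n k ((t ℕ.+ N) ℕ.* r) d tr≡d) (cong (_% n) (sym g≡kd))))
    where
    swap : ∀ x k r → x ℕ.* (k ℕ.* r) ≡ k ℕ.* (x ℕ.* r)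
    swap = ℕ-Solver.solve-∀

  module _ {p k : ℕ} (above : PrimeAbove K p k) (sq : (s ℕ.* p ℕ.^ k) % n ≡ 1 % n)
           (f : ℕ) (order : (s ℕ.^ suc f) % n ≡ 1 % n) (M : ℕ) where

    open PrimeAbove above

    -- The unit u absorbs what is left when ν is written as a power of π, as in 64 = -(1 + i)^12.
    divisible-by-prime : ∀ u u⁻¹ → u * u⁻¹ ≡ 1# → ν · 1# ≡ π ^ M * u → Divisible
    divisible-by-prime u u⁻¹ unit ν≡ a perfect x =
      let (c , F≡) = M.prime-power-divides a perfect s t st above sq f order M u ν≡ x in
      u⁻¹ * c , trans F≡ (sym (trans (cong (_* (u⁻¹ * c)) ν≡) (trans (*-assoc _ _ _) (cong (π ^ M *_)
        (trans (sym (*-assoc u u⁻¹ c)) (trans (cong (_* c) unit) (*-identityˡ c)))))))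

    -- Both prime powers divide F separately; expanding F = (α z + β y) F and using one divisibility
    -- in each summand exhibits the factor z y. The same s has to invert both residue field powers
    -- modulo n.
    divisible-by-primes : ∀ {p′ k′} (above′ : PrimeAbove K p′ k′) → (s ℕ.* p′ ℕ.^ k′) % n ≡ 1 % n → ∀ M′ →
                          let π′ = PrimeAbove.π above′ in
                          ν · 1# ≡ π ^ M * π′ ^ M′ → ∀ α β → α * π ^ M + β * π′ ^ M′ ≡ 1# → Divisible
    divisible-by-primes above′ sq′ M′ ν≡ α β bezout a perfect x =
      let (c  , F≡c)  = M.prime-power-divides a perfect s t st above sq f order M y ν≡ x
          (c′ , F≡c′) = M.prime-power-divides a perfect s t st above′ sq′ f order M′ z (trans ν≡ (*-comm z y)) x
          F = Twist.at (M.F a perfect s t st) x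
      in α * c′ + β * c , (begin
        F                                              ≡⟨ *-identityˡ F ⟨
        1# * F                                         ≡⟨ cong (_* F) bezout ⟨
        (α * z + β * y) * F                            ≡⟨ distribʳ F (α * z) (β * y) ⟩
        α * z * F + β * y * F                          ≡⟨ cong₂ (λ v w → α * z * v + β * y * w) F≡c′ F≡c ⟩
        α * z * (y * c′) + β * y * (z * c)
          ≡⟨ cong₂ _+_ (shuffle α z y c′) (trans (shuffle β y z c) (cong (_* (β * c)) (*-comm y z))) ⟩
        z * y * (α * c′) + z * y * (β * c)             ≡⟨ distribˡ (z * y) (α * c′) (β * c) ⟨
        z * y * (α * c′ + β * c)                       ≡⟨ cong (_* (α * c′ + β * c)) ν≡ ⟨
        ν · 1# * (α * c′ + β * c)                      ∎)
      where
      open ≡-Reasoning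
      open import Algebra.Properties.CommutativeSemigroup (CommutativeRing.*-commutativeSemigroup commutativeRing) using (interchange)
      z = π ^ M
      y = PrimeAbove.π above′ ^ M′
      shuffle : ∀ α z y c → α * z * (y * c) ≡ z * y * (α * c)
      shuffle α z y c = trans (cong (_* (y * c)) (*-comm α z)) (interchange z α y c)

-- For even n the character x ↦ (-1)^x takes equal nonzero values on A and on its image under
-- the multiplier, so the two differ by an even translation.
module _ (N ν : ℕ) (ν≢0 : ν ≢ 0) (s t : ℕ) (st : (s ℕ.* t) % suc N ≡ 1 % suc N) where

  private
    open Coefficients integers
    n = suc N

  even-multiplierAt : Divisible integers N ν ν≢0 s t st → -1ℤ ^ n ≡ 1ℤ → -1ℤ ^ N ≡ -1ℤ → -1ℤ ^ s ≡ -1ℤ →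
                      ∀ r → ((t ℕ.+ N) ℕ.* r) % n ≡ 2 % n → MultiplierAt integers N ν s
  even-multiplierAt divisible n-even N-odd s-odd r tr≡2 =
    multiplierAt integers N ν ν≢0 s t st divisible 2 r tr≡2 λ a perfect →
      even _ (Multiplier.character-trivial integers N ν ν≢0 a perfect s t st (divisible a perfect) (sign a perfect) (odd-multiple s s-odd))
    where
    odd-multiple : ∀ m → -1ℤ ^ m ≡ -1ℤ → ∀ x → -1ℤ ^ (m ℕ.* x) ≡ -1ℤ ^ x
    odd-multiple m odd x = trans (sym (Exp.^-assocʳ semiring -1ℤ m x)) (cong (_^ x) odd)
    sign : ∀ a perfect → Multiplier.Character integers N ν ν≢0 a perfect
    sign a perfect = record
      { χ = -1ℤ ^_
      ; χ-periodic = λ x → trans (Exp.^-homo-* semiring -1ℤ n x) (trans (cong (_* -1ℤ ^ x) n-even) (*-identityˡ _))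
      ; χ-+ = λ x y → Exp.^-homo-* semiring -1ℤ x y
      ; χ-0 = refl
      ; χ-conj = λ x → sym (odd-multiple N N-odd x) }
    even : ∀ g → -1ℤ ^ g ≡ 1ℤ → ∃[ k ] g ≡ k ℕ.* 2
    even zero          _  = 0 , refl
    even (suc (suc g)) eq = let (k , g≡2k) = even g (trans (sym (negate-twice (-1ℤ ^ g))) eq) in suc k , cong (2 ℕ.+_) g≡2k
      where
      negate-twice : ∀ i → -1ℤ ℤ.* (-1ℤ ℤ.* i) ≡ i
      negate-twice = ℤ-Solver.solve-∀

module Solve (K : Coefficients) (embedding : Embedding K) (ν s t : ℕ) (box : List (Coefficients.Carrier K))
             (box-complete : ∀ z → Coefficients.norm K z ≤ ν → z ∈ box)
             {e : ℕ} .{{_ : NonZero e}} (root : RootOfUnity K e) where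

  open Coefficients K
  open Tower K ν s t box box-complete
  open TwistedProjection K embedding root
  open Projection K

  -- Both `allowed` and `p` are conditions on every coefficient, hence unaffected by translation, so
  -- the search may run on the translate that s fixes.
  values : ∀ l N → .{{_ : NonZero l}} → MultiplierAt K N ν s → (c : Chain (suc N)) → coherent c ≡ true →
           ∀ allowed p → all (all p) (solutions allowed c) ≡ true →
           all (λ x → all (λ as → allowed (combine (suc N) x as)) (tuples l)) (upTo e) ≡ true →
           ∀ k → k ℕ.* e ≡ l ℕ.* suc N →
           ∀ f → (∀ x → f x ∈ trits) → Perfect integers (l ℕ.* suc N) ν f →
           ∀ x → T (p (project l (suc N) (twisted f) x))
  values l N multiplier c ok allowed p checked bounded k ke≡v f trit perfect x =
    -- Undoes the translation: the coefficient at x is that of the translate at x - h, with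
    -- `N ℕ.* h` for -h.
    subst (T ∘ p) (periodic-cong (Perfect.periodic-f B-perfect) 0 h (index N h x))
      (property c ok allowed p checked (λ y → B (h ℕ.+ y)) (perfect-shift K h B-perfect) fixed
        (λ y → fibrewise l (suc N) allowed bounded f trit (h ℕ.+ y)) (x ℕ.+ N ℕ.* h))
    where
    B = project l (suc N) (twisted f)
    B-perfect : Perfect K (suc N) ν B
    B-perfect = project-perfect l (suc N) (twisted-perfect k ke≡v perfect)
    h = proj₁ (multiplier B B-perfect)
    fixed = proj₂ (multiplier B B-perfect)
    index : ∀ m h x → 0 ℕ.* suc m ℕ.+ (h ℕ.+ (x ℕ.+ m ℕ.* h)) ≡ h ℕ.* suc m ℕ.+ x
    index = ℕ-Solver.solve-∀

-- The eight cases

-- Taking 1 as generator reduces the condition on the residue field to 1^q = 1; Fermat's little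
-- theorem for the other residues comes out of `primeAbove`.
ℤ-above : ∀ p k → Prime p → 1 ≤ k → PrimeAbove integers p k
ℤ-above p k p-prime 1≤k = primeAbove integers integers-embedding p-prime 1≤k (+ p)
  (λ p²≡0 → ¬prime[0] (subst Prime ([ id , id ]′ (ℕ.m*n≡0⇒m≡0∨n≡0 p p²≡0)) p-prime))
  (1ℤ , trans (Coefficients.re-· integers p) (sym (ℤ.*-identityʳ (+ p))))
  1ℤ (λ x → x , 0ℤ , sym (ℤ.+-identityʳ x))
  (0ℤ , trans (1^q≡1 (p ℕ.^ k)) (cong (λ z → 1ℤ ℤ.+ z) (sym (ℤ.*-zeroʳ (+ p)))))
  where
  open Coefficients integers using (_^_)
  1^q≡1 : ∀ q → 1ℤ ^ q ≡ 1ℤ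
  1^q≡1 zero    = refl
  1^q≡1 (suc q) = trans (ℤ.*-identityˡ _) (1^q≡1 q)

module _ (p : ℤ) (d : ℕ) (discriminant : p ℤ.* p ℤ.+ + 4 ℤ.* -1ℤ ≡ -[1+ d ]) where

  open Coefficients (Quadratic.quadratic p -1ℤ d discriminant)

  quadratic-above : ∀ {q k} → Prime q → 1 ≤ k → ∀ π → norm π ≢ 0 → (∃[ c ] q · 1# ≡ π * c) →
                    (∃[ c ] (0ℤ , 1ℤ) ^ (q ℕ.^ k) ≡ (0ℤ , 1ℤ) + π * c) → PrimeAbove (Quadratic.quadratic p -1ℤ d discriminant) q k
  quadratic-above q-prime 1≤k π norm≢0 over θ-fixed =
    primeAbove _ (quadratic-embedding p -1ℤ d discriminant) q-prime 1≤k π norm≢0 over (0ℤ , 1ℤ)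
      (λ (a , b) → a , b , cong₂ _,_ (coordinate₁ a b) (coordinate₂ p b)) θ-fixed
    where
    coordinate₁ : ∀ a b → a ≡ a ℤ.+ (b ℤ.* 0ℤ ℤ.+ -1ℤ ℤ.* (0ℤ ℤ.* 1ℤ))
    coordinate₁ = ℤ-Solver.solve-∀
    coordinate₂ : ∀ p b → b ≡ 0ℤ ℤ.+ (b ℤ.* 1ℤ ℤ.+ 0ℤ ℤ.* 0ℤ ℤ.+ p ℤ.* (0ℤ ℤ.* 1ℤ))
    coordinate₂ = ℤ-Solver.solve-∀

prime[3] : Prime 3
prime[3] = toWitness {a? = prime? 3} _

prime[7] : Prime 7
prime[7] = toWitness {a? = prime? 7} _

-- Over ℤ[i] the prime 2 = (1 + i)(1 - i) ramifies with residue field of two elements, so t = 2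
-- itself is available.
1+i-above : PrimeAbove gaussian 2 1
1+i-above = quadratic-above 0ℤ 3 refl prime[2] (s≤s z≤n) (1ℤ , 1ℤ) (λ ()) ((1ℤ , -1ℤ) , refl) ((-1ℤ , 0ℤ) , refl)

-- In ℤ[ω] the prime 2 is inert with residue field of four elements, so the exponent must be even.
-- The least k with 2^k ≡ 9 = 3² modulo 35 is 10.
2-above : PrimeAbove eisenstein 2 10
2-above = quadratic-above -1ℤ 2 refl prime[2] (s≤s z≤n) (+ 2 , 0ℤ) (λ ()) ((1ℤ , 0ℤ) , refl) ((0ℤ , 0ℤ) , refl)

-- Here 1 + 2ω = √-3, with square -3.
√-3-above : PrimeAbove eisenstein 3 2
√-3-above = quadratic-above -1ℤ 2 refl prime[3] (s≤s z≤n) (1ℤ , + 2) (λ ()) ((-1ℤ , -[1+ 1 ]) , refl) ((-1ℤ , -1ℤ) , refl)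

any-multiple : ∀ g → ∃[ k ] g ≡ k ℕ.* 1
any-multiple g = g , sym (ℕ.*-identityʳ g)

ν≢0 : ∀ {m} → suc m ≢ 0
ν≢0 ()

-- For t = 2 the factor t - 1 is 1, so every translation can be absorbed.
gaussian-64 : ∀ N s f → (st : (s ℕ.* 2) % suc N ≡ 1 % suc N) → (s ℕ.^ suc f) % suc N ≡ 1 % suc N →
              ((2 ℕ.+ N) ℕ.* 1) % suc N ≡ 1 % suc N → MultiplierAt gaussian N 64 s
gaussian-64 N s f st order one = multiplierAt gaussian N 64 ν≢0 s 2 st
  (divisible-by-prime gaussian N 64 ν≢0 s 2 st 1+i-above st f order 12 (-1ℤ , 0ℤ) (-1ℤ , 0ℤ) refl refl)
  1 1 one (λ _ _ → any-multiple _)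

-- Constants: 36 = 2² (√-3)⁴ with Bézout relation -2 · 4 + 9 = 1; t = 9 with inverse s = 4, of order
-- 6 modulo 35; and 22 inverts t - 1 = 8.
eisenstein-36 : MultiplierAt eisenstein 34 36 4
eisenstein-36 = multiplierAt eisenstein 34 36 ν≢0 4 9 refl
  (divisible-by-primes eisenstein 34 36 ν≢0 4 9 refl 2-above refl 5 refl 2 √-3-above refl 4 refl (-[1+ 1 ] , 0ℤ) (1ℤ , 0ℤ) refl)
  1 22 refl (λ _ _ → any-multiple _)

integers-36 : MultiplierAt integers 34 36 4
integers-36 = multiplierAt integers 34 36 ν≢0 4 9 refl
  (divisible-by-primes integers 34 36 ν≢0 4 9 refl (ℤ-above 2 10 prime[2] (s≤s z≤n)) refl 5 refl 2
    (ℤ-above 3 2 prime[3] (s≤s z≤n)) refl 2 refl -[1+ 1 ] 1ℤ refl)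
  1 22 refl (λ _ _ → any-multiple _)

integers-49 : ∀ N s f r → (st : (s ℕ.* 7) % suc N ≡ 1 % suc N) → (s ℕ.^ suc f) % suc N ≡ 1 % suc N →
              let open Coefficients integers in -1ℤ ^ suc N ≡ 1ℤ → -1ℤ ^ N ≡ -1ℤ → -1ℤ ^ s ≡ -1ℤ →
              ((7 ℕ.+ N) ℕ.* r) % suc N ≡ 2 % suc N → MultiplierAt integers N 49 s
integers-49 N s f r st order n-even N-odd s-odd r≡2 = even-multiplierAt N 49 ν≢0 s 7 st
  (divisible-by-prime integers N 49 ν≢0 s 7 st (ℤ-above 7 1 prime[7] (s≤s z≤n)) st f order 2 1ℤ 1ℤ refl refl)
  n-even N-odd s-odd r r≡2

bounded : ℕ → ℤ → Bool
bounded r a = ∣ a ∣ ℕ.≤ᵇ r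

-- As the property of all coefficients of all solutions it forces the list of solutions to be empty,
-- since each solution has at least one coefficient.
never : {A : Set} → A → Bool
never _ = false

root-1 : RootOfUnity integers 1
root-1 = record { θ = 1ℤ ; θ^e≡1 = refl ; θ*conjθ = refl }

root--1 : RootOfUnity integers 2
root--1 = record { θ = -1ℤ ; θ^e≡1 = refl ; θ*conjθ = refl }

root-i : RootOfUnity gaussian 4
root-i = record { θ = 0ℤ , 1ℤ ; θ^e≡1 = refl ; θ*conjθ = refl }

root-ω : RootOfUnity eisenstein 3
root-ω = record { θ = 0ℤ , 1ℤ ; θ^e≡1 = refl ; θ*conjθ = refl }

module Solve-49 (s : ℕ) = Solve integers integers-embedding 49 s 7 (interval 7) (integers-box 7 49 (ℕ.<ᵇ⇒< 49 64 _)) root-1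

module Solve-64 (s : ℕ) where
  open Cyclotomic 0ℤ 3 refl
  open Solve gaussian (quadratic-embedding 0ℤ -1ℤ 3 refl) 64 s 2 (square 8) (square-box 8 64 (ℕ.<ᵇ⇒< 256 324 _)) root-i public

  -- The moduli 35, 45 and 49 are odd, so the four points of a fibre carry the four different powers
  -- of i: two entries are real and two imaginary.
  small : ℤ × ℤ → Bool
  small (a , b) = bounded 2 a ∧ bounded 2 b

-- No coset sums are taken at the top. The tower starts with C_29, where 7 has order 7 and there are
-- only five orbits.
¬CW-116-49 : ¬ CWExists 116 49
¬CW-116-49 (_ , cw) = Solve-49.values 83 1 115 (integers-49 115 83 13 39 refl refl refl refl refl refl) (2 ◂ 2 ◂ 29 ◂ []) refl
  (bounded 1) never refl refl 116 refl (firstRow cw) (firstRow-trits cw) (firstRow-perfect cw) 0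

-- A sum of six entries is at most 6 in absolute value, which excludes the ever-present solutions
-- ±7g.
¬CW-120-49 : ¬ CWExists 120 49
¬CW-120-49 (_ , cw) = Solve-49.values 3 6 19 (integers-49 19 3 3 7 refl refl refl refl refl refl) (2 ◂ 2 ◂ 5 ◂ []) refl
  (bounded 6) never refl refl 120 refl (firstRow cw) (firstRow-trits cw) (firstRow-perfect cw) 0

¬CW-192-49 : ¬ CWExists 192 49
¬CW-192-49 (_ , cw) = Solve-49.values 55 3 63 (integers-49 63 55 7 11 refl refl refl refl refl refl) (2 ◂ 2 ◂ 2 ◂ 2 ◂ 2 ◂ 2 ◂ []) refl
  (bounded 3) never refl refl 192 refl (firstRow cw) (firstRow-trits cw) (firstRow-perfect cw) 0

¬CW-140-64 : ¬ CWExists 140 64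
¬CW-140-64 (_ , cw) = values 4 34 (gaussian-64 34 18 11 refl refl refl) (7 ◂ 5 ◂ []) refl
  small never refl refl 35 refl (firstRow cw) (firstRow-trits cw) (firstRow-perfect cw) 0
  where open Solve-64 18

¬CW-180-64 : ¬ CWExists 180 64
¬CW-180-64 (_ , cw) = values 4 44 (gaussian-64 44 23 11 refl refl refl) (5 ◂ 3 ◂ 3 ◂ []) refl
  small never refl refl 45 refl (firstRow cw) (firstRow-trits cw) (firstRow-perfect cw) 0
  where open Solve-64 23

¬CW-196-64 : ¬ CWExists 196 64
¬CW-196-64 (_ , cw) = values 4 48 (gaussian-64 48 25 20 refl refl refl) (7 ◂ 7 ◂ []) refl
  small never refl refl 49 refl (firstRow cw) (firstRow-trits cw) (firstRow-perfect cw) 0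
  where open Solve-64 25

¬CW-105-36 : ¬ CWExists 105 36
¬CW-105-36 (_ , cw) = values 3 34 eisenstein-36 (7 ◂ 5 ◂ []) refl
  small never refl refl 35 refl (firstRow cw) (firstRow-trits cw) (firstRow-perfect cw) 0
  where
  open Cyclotomic -1ℤ 2 refl
  open Solve eisenstein (quadratic-embedding -1ℤ -1ℤ 2 refl) 36 4 9 (square 6) (square-box 6 36 (ℕ.<ᵇ⇒< 144 147 _)) root-ω
  -- From a₀ + a₁ω + a₂ω² = (a₀ - a₂) + (a₁ - a₂)ω, the three bounded numbers are the differences of
  -- the three entries of a fibre.
  small : ℤ × ℤ → Bool
  small (a , b) = bounded 2 a ∧ bounded 2 b ∧ bounded 2 (a ℤ.- b)

-- Here the search leaves solutions, so it is asked for divisibility by 3 instead. With both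
-- projections divisible, B₊ vanishes, against its correlation 36 at shift 0.
¬CW-140-36 : ¬ CWExists 140 36
¬CW-140-36 (_ , cw) = contradiction (trans (sym (∑-zero 35 (λ i _ → trans (cong (B₊ i ℤ.*_) (B₊≡0 i)) (ℤ.*-zeroʳ (B₊ i))))) (Perfect.peak B₊-perfect)) λ ()
  where
  open RangeSum (Coefficients.+-commutativeMonoid integers)
  open Projection integers
  module ₊ = Solve integers integers-embedding 36 4 9 (interval 6) (integers-box 6 36 (ℕ.<ᵇ⇒< 36 49 _)) root-1
  module ₋ = Solve integers integers-embedding 36 4 9 (interval 6) (integers-box 6 36 (ℕ.<ᵇ⇒< 36 49 _)) root--1
  module T₊ = TwistedProjection integers integers-embedding root-1
  module T₋ = TwistedProjection integers integers-embedding root--1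
  f = firstRow cw
  B₊ B₋ : ℕ → ℤ
  B₊ = project 4 35 (T₊.twisted f)
  B₋ = project 4 35 (T₋.twisted f)
  B₊-perfect : Perfect integers 35 36 B₊
  B₊-perfect = project-perfect 4 35 (T₊.twisted-perfect 140 refl (firstRow-perfect cw))
  triple : ℤ → Bool
  triple a = ∣ a ∣ % 3 ℕ.≡ᵇ 0
  B₊-triple : ∀ x → T (triple (B₊ x))
  B₊-triple = ₊.values 4 34 integers-36 (7 ◂ 5 ◂ []) refl (bounded 4) triple refl refl 140 refl f (firstRow-trits cw) (firstRow-perfect cw)
  B₋-triple : ∀ x → T (triple (B₋ x))
  B₋-triple = ₋.values 4 34 integers-36 (7 ◂ 5 ◂ []) refl (bounded 4) triple refl refl 70 refl f (firstRow-trits cw) (firstRow-perfect cw)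
  -- B₊ ± B₋ are twice sums of two entries of the first row, so both can be divisible by 3 only if they vanish.
  vanishing : ℕ → List ℤ → Bool
  vanishing x as = if triple (T₊.combine 35 0 as) ∧ triple (T₋.combine 35 x as) then ∣ T₊.combine 35 0 as ∣ ℕ.≡ᵇ 0 else true
  checked : all (λ x → all (vanishing x) (tuples 4)) (upTo 2) ≡ true
  checked = refl
  B₊≡0 : ∀ x → B₊ x ≡ 0ℤ
  B₊≡0 x = ℤ.∣i∣≡0⇒i≡0 (trans (cong ∣_∣ ₊≡) (ℕ.≡ᵇ⇒≡ ∣ T₊.combine 35 0 entries ∣ 0
    (subst T (if-true (triple (T₊.combine 35 0 entries) ∧ triple (T₋.combine 35 (x % 2) entries))
        (T-∧ (subst (T ∘ triple) ₊≡ (B₊-triple x)) (subst (T ∘ triple) ₋≡ (B₋-triple x))))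
      (all-∈ (vanishing (x % 2)) (all-∈ (λ y → all (vanishing y) (tuples 4)) (subst T (sym checked) _) (∈-applyUpTo⁺ id (ℕ.m%n<n x 2)))
        (∈-tuples 4 (λ j → f (x ℕ.+ 35 ℕ.* j)) (λ j → firstRow-trits cw (x ℕ.+ 35 ℕ.* j)))))))
    where
    entries = applyUpTo (λ j → f (x ℕ.+ 35 ℕ.* j)) 4
    ₊≡ : B₊ x ≡ T₊.combine 35 0 entries
    ₊≡ = trans (T₊.project-combine 4 35 f x) (trans (sym (T₊.combine-% 35 x entries)) (cong (λ y → T₊.combine 35 y entries) (ℕ.n<1⇒n≡0 (ℕ.m%n<n x 1))))
    ₋≡ : B₋ x ≡ T₋.combine 35 (x % 2) entries
    ₋≡ = trans (T₋.project-combine 4 35 f x) (sym (T₋.combine-% 35 x entries))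

theorem1p1 : ¬ CWExists 105 36 × ¬ CWExists 140 36 ×
    ¬ CWExists 116 49 × ¬ CWExists 120 49 × ¬ CWExists 192 49 ×
    ¬ CWExists 140 64 × ¬ CWExists 180 64 × ¬ CWExists 196 64
theorem1p1 = ¬CW-105-36 , ¬CW-140-36 , ¬CW-116-49 , ¬CW-120-49 , ¬CW-192-49 , ¬CW-140-64 , ¬CW-180-64 , ¬CW-196-64
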